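{- As $n\to\infty$, $$\log \mathrm{PL}(n)\sim\left(\frac{27\cdot\zeta(3)}{4}\right)^{1/3}\cdot n^{2/3}.$$
   Context: $\mathrm{PL}(n)$ denotes the number of plane partitions of $n$: the number of arrays $(\pi_{i,j})_{i,j\ge1}$ of nonnegative integers such that $\sum_{i,j}\pi_{i,j}=n$ and all rows and columns are non-increasing, i.e. for every $k$ the sequences $i\mapsto\pi_{i,k}$ and $i\mapsto\pi_{k,i}$ are non-increasing in $i$. $\zeta(s)=\sum_{n=1}^\infty n^{ -s}$ is the zeta function, $\log$ is the natural logarithm, and $g(n)\sim h(n)$ means $g(n)/h(n)\to1$. -}

module Defs where

open import Level using (0ℓ)
open import Data.Nat as ℕ using (ℕ; zero; suc)
import Data.Nat.Properties as ℕₚ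
open import Data.Integer as ℤ using (+_)
import Data.Integer.Properties as ℤₚ
open import Data.Rational as ℚ using (ℚ; 0ℚ; 1ℚ; ½)
import Data.Rational.Properties as ℚₚ
import Data.Rational.Unnormalised as ℚᵘ
import Data.Rational.Unnormalised.Properties as ℚᵘₚ
open import Data.Rational.Solver using (module +-*-Solver)
open import Algebra.Definitions.RawSemiring ℚ.+-*-rawSemiring using () renaming (_^_ to _^ℚ_)
open import Data.Fin using (Fin; toℕ; fromℕ<; combine; funToFin; finToFun)
import Data.Fin.Properties as Finₚ
open import Data.List using (List; filter; allFin; lookup; length)
open import Data.List.Relation.Unary.All as All using (All; []; _∷_)
open import Data.List.Relation.Unary.All.Properties using (all-filter)
import Data.List.Relation.Unary.Any as Any
open import Data.List.Relation.Unary.Any.Properties using (lookup-index)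
open import Data.List.Relation.Unary.AllPairs using ([]; _∷_)
open import Data.List.Relation.Unary.Unique.Propositional using (Unique)
import Data.List.Relation.Unary.Unique.Propositional.Properties as Uniqueₚ
open import Data.List.Membership.Propositional.Properties using (∈-filter⁺; ∈-allFin; ∈-lookup)
open import Data.Product using (∃-syntax; Σ-syntax; _×_; _,_; proj₁; proj₂)
open import Data.Sum using (_⊎_; inj₁; inj₂)
open import Data.Empty using (⊥-elim)
open import Function.Bundles using (Inverse)
open import Relation.Nullary using (Dec; yes; no; ¬_)
open import Relation.Nullary.Decidable using (_×-dec_; map′)
open import Relation.Binary.Bundles using (Setoid)
open import Relation.Binary.PropositionalEquality as ≡
  using (_≡_; refl; sym; trans; cong; cong₂; subst; subst₂)

module S = +-*-Solver

∑ℕ : ℕ → (ℕ → ℕ) → ℕ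
∑ℕ zero    f = 0
∑ℕ (suc m) f = ∑ℕ m f ℕ.+ f m

boxSum : ℕ → (ℕ → ℕ → ℕ) → ℕ
boxSum m π = ∑ℕ m (λ i → ∑ℕ m (π i))

-- A series of natural numbers sums to n iff its partial sums are eventually n.
SumsTo : (ℕ → ℕ → ℕ) → ℕ → Set
SumsTo π n = ∃[ m₀ ] (∀ m → m₀ ℕ.≤ m → boxSum m π ≡ n)

-- entry i j is π_{i+1,j+1}.
record PlanePartition (n : ℕ) : Set where
  field
    entry        : ℕ → ℕ → ℕ
    columns-mono : ∀ k {i j} → i ℕ.≤ j → entry j k ℕ.≤ entry i k
    rows-mono    : ∀ k {i j} → i ℕ.≤ j → entry k j ℕ.≤ entry k i
    total        : SumsTo entry n

open PlanePartition

-- Arrays are functions, so they are counted up to pointwise equality.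
planePartitions : ℕ → Setoid 0ℓ 0ℓ
planePartitions n = record
  { Carrier       = PlanePartition n
  ; _≈_           = λ x y → ∀ i j → entry x i j ≡ entry y i j
  ; isEquivalence = record
    { refl  = λ i j → refl
    ; sym   = λ p i j → sym (p i j)
    ; trans = λ p q i j → trans (p i j) (q i j)
    }
  }

Cardinality : Setoid 0ℓ 0ℓ → ℕ → Set
Cardinality S k = Inverse S (≡.setoid (Fin k))

lookup-injective : ∀ {A : Set} {xs : List A} → Unique xs →
                   ∀ i j → lookup xs i ≡ lookup xs j → i ≡ j
lookup-injective (p ∷ u) Fin.zero    Fin.zero    e = refl
lookup-injective (p ∷ u) Fin.zero    (Fin.suc j) e = ⊥-elim (All.lookup p (∈-lookup j) e)
lookup-injective (p ∷ u) (Fin.suc i) Fin.zero    e = ⊥-elim (All.lookup p (∈-lookup i) (sym e))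
lookup-injective (p ∷ u) (Fin.suc i) (Fin.suc j) e = cong Fin.suc (lookup-injective u i j e)

finite : (S : Setoid 0ℓ 0ℓ) (let open Setoid S) {K : ℕ} (enc : Carrier → Fin K) →
         (∀ {x y} → x ≈ y → enc x ≡ enc y) →
         (∀ {x y} → enc x ≡ enc y → x ≈ y) →
         (∀ c → Dec (∃[ x ] (enc x ≡ c))) →
         ∃[ k ] Cardinality S k
finite S {K} enc enc-cong enc-inj dec = length codes , record
  { to        = to
  ; from      = λ i → proj₁ (pre i)
  ; to-cong   = λ {x} {y} x≈y →
      inj (trans (to-enc x) (trans (enc-cong x≈y) (sym (to-enc y))))
  ; from-cong = λ { refl → Setoid.refl S }
  ; inverse   =
      (λ {i} {y} y≈ → inj (trans (to-enc y) (trans (enc-cong y≈) (proj₂ (pre i)))))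
    , (λ { {x} refl → enc-inj (trans (proj₂ (pre (to x))) (to-enc x)) })
  }
  where
  open Setoid S using (Carrier)
  codes : List (Fin K)
  codes = filter dec (allFin K)
  inj : ∀ {i j} → lookup codes i ≡ lookup codes j → i ≡ j
  inj = lookup-injective (Uniqueₚ.filter⁺ dec (Uniqueₚ.allFin⁺ K)) _ _
  to : Carrier → Fin (length codes)
  to x = Any.index (∈-filter⁺ dec (∈-allFin (enc x)) (x , refl))
  to-enc : ∀ x → lookup codes (to x) ≡ enc x
  to-enc x = sym (lookup-index (∈-filter⁺ dec (∈-allFin (enc x)) (x , refl)))
  pre : ∀ i → ∃[ x ] (enc x ≡ lookup codes i)
  pre i = All.lookup (all-filter dec (allFin K)) (∈-lookup i)

∑ℕ-cong : ∀ m {f g} → (∀ i → f i ≡ g i) → ∑ℕ m f ≡ ∑ℕ m g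
∑ℕ-cong zero    h = refl
∑ℕ-cong (suc m) h = cong₂ ℕ._+_ (∑ℕ-cong m h) (h m)

term≤∑ℕ : ∀ m f {i} → i ℕ.< m → f i ℕ.≤ ∑ℕ m f
term≤∑ℕ (suc m) f {i} i<1+m with i ℕ.≟ m
... | yes refl = ℕₚ.m≤n+m (f m) (∑ℕ m f)
... | no i≢m   = ℕₚ.≤-trans (term≤∑ℕ m f (ℕₚ.≤∧≢⇒< (ℕₚ.≤-pred i<1+m) i≢m))
                            (ℕₚ.m≤m+n (∑ℕ m f) (f m))

count≤∑ℕ : ∀ m f k → k ℕ.≤ m → (∀ i → i ℕ.< k → 1 ℕ.≤ f i) → k ℕ.≤ ∑ℕ m f
count≤∑ℕ zero    f .zero ℕ.z≤n h = ℕ.z≤n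
count≤∑ℕ (suc m) f k     k≤1+m h with k ℕ.≟ suc m
... | yes refl = subst (ℕ._≤ ∑ℕ m f ℕ.+ f m) (ℕₚ.+-comm m 1)
                   (ℕₚ.+-mono-≤ (count≤∑ℕ m f m ℕₚ.≤-refl (λ i i<m → h i (ℕₚ.m<n⇒m<1+n i<m)))
                                (h m ℕₚ.≤-refl))
... | no k≢    = ℕₚ.≤-trans (count≤∑ℕ m f k (ℕₚ.≤-pred (ℕₚ.≤∧≢⇒< k≤1+m k≢)) h)
                            (ℕₚ.m≤m+n (∑ℕ m f) (f m))

∑ℕ-zero : ∀ m {f} → (∀ i → f i ≡ 0) → ∑ℕ m f ≡ 0
∑ℕ-zero zero    h = refl
∑ℕ-zero (suc m) h = cong₂ ℕ._+_ (∑ℕ-zero m h) (h m)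

∑ℕ-tail : ∀ n m f → (∀ i → n ℕ.≤ i → f i ≡ 0) → n ℕ.≤ m → ∑ℕ m f ≡ ∑ℕ n f
∑ℕ-tail n m f h n≤m = subst (λ m → ∑ℕ m f ≡ ∑ℕ n f) (ℕₚ.m∸n+n≡m n≤m) (go (m ℕ.∸ n))
  where
  go : ∀ d → ∑ℕ (d ℕ.+ n) f ≡ ∑ℕ n f
  go zero    = refl
  go (suc d) = trans (cong₂ ℕ._+_ (go d) (h _ (ℕₚ.m≤n+m n d))) (ℕₚ.+-identityʳ _)

module Enumerate (n : ℕ) where

  record Supported (π : ℕ → ℕ → ℕ) : Set where
    field
      below : ∀ i j → n ℕ.≤ i → π i j ≡ 0
      right : ∀ i j → n ℕ.≤ j → π i j ≡ 0
  open Supported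

  boxSum-stable : ∀ {π} → Supported π → ∀ m → n ℕ.≤ m → boxSum m π ≡ boxSum n π
  boxSum-stable {π} s m n≤m = trans
    (∑ℕ-tail n m _ (λ i n≤i → ∑ℕ-zero m (λ j → below s i j n≤i)) n≤m)
    (∑ℕ-cong n (λ i → ∑ℕ-tail n m (π i) (λ j → right s i j) n≤m))

  module _ (P : PlanePartition n) where
    private
      π = entry P
      m₀ = proj₁ (total P)

    entry≤n : ∀ i j → π i j ℕ.≤ n
    entry≤n i j = subst (π i j ℕ.≤_) (proj₂ (total P) m (ℕₚ.m≤m+n m₀ _))
      (ℕₚ.≤-trans (term≤∑ℕ m (π i) j<m) (term≤∑ℕ m (λ i → ∑ℕ m (π i)) i<m))
      where
      m = m₀ ℕ.+ suc (i ℕ.+ j)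
      i<m = ℕₚ.≤-trans (ℕ.s≤s (ℕₚ.m≤m+n i j)) (ℕₚ.m≤n+m _ m₀)
      j<m = ℕₚ.≤-trans (ℕ.s≤s (ℕₚ.m≤n+m j i)) (ℕₚ.m≤n+m _ m₀)

    entry≥1⇒i<n : ∀ i j → 1 ℕ.≤ π i j → i ℕ.< n
    entry≥1⇒i<n i j 1≤ = subst (suc i ℕ.≤_) (proj₂ (total P) m (ℕₚ.m≤m+n m₀ _))
      (count≤∑ℕ m _ (suc i) (ℕₚ.m≤n+m _ m₀) λ i′ i′<1+i →
        ℕₚ.≤-trans (ℕₚ.≤-trans 1≤ (ℕₚ.≤-trans (columns-mono P j (ℕₚ.≤-pred i′<1+i))
                                              (rows-mono P i′ ℕ.z≤n)))
                   (term≤∑ℕ m (π i′) (ℕₚ.≤-trans (ℕ.s≤s ℕ.z≤n) (ℕₚ.m≤n+m _ m₀))))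
      where m = m₀ ℕ.+ suc i

    entry≥1⇒j<n : ∀ i j → 1 ℕ.≤ π i j → j ℕ.< n
    entry≥1⇒j<n i j 1≤ = subst (suc j ℕ.≤_) (proj₂ (total P) m (ℕₚ.m≤m+n m₀ _))
      (ℕₚ.≤-trans
        (count≤∑ℕ m (π 0) (suc j) (ℕₚ.m≤n+m _ m₀) λ j′ j′<1+j →
          ℕₚ.≤-trans 1≤ (ℕₚ.≤-trans (rows-mono P i (ℕₚ.≤-pred j′<1+j)) (columns-mono P j′ ℕ.z≤n)))
        (term≤∑ℕ m (λ i → ∑ℕ m (π i)) (ℕₚ.≤-trans (ℕ.s≤s ℕ.z≤n) (ℕₚ.m≤n+m _ m₀))))
      where m = m₀ ℕ.+ suc j

    supported : Supported π
    supported .below i j n≤i = ℕₚ.n<1⇒n≡0 (ℕₚ.≰⇒> λ 1≤ → ℕₚ.<⇒≱ (entry≥1⇒i<n i j 1≤) n≤i)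
    supported .right i j n≤j = ℕₚ.n<1⇒n≡0 (ℕₚ.≰⇒> λ 1≤ → ℕₚ.<⇒≱ (entry≥1⇒j<n i j 1≤) n≤j)

  Code : Set
  Code = Fin ((suc n ℕ.^ n) ℕ.^ n)

  encode : PlanePartition n → Code
  encode P = funToFin {n} λ i → funToFin {n} λ j →
    fromℕ< (ℕ.s≤s (entry≤n P (toℕ i) (toℕ j)))

  decode : Code → ℕ → ℕ → ℕ
  decode c i j with i ℕ.<? n | j ℕ.<? n
  ... | yes i<n | yes j<n = toℕ (finToFun (finToFun c (fromℕ< i<n)) (fromℕ< j<n))
  ... | _       | _       = 0

  decode-supported : ∀ c → Supported (decode c)
  decode-supported c .below i j n≤i with i ℕ.<? n | j ℕ.<? n
  ... | yes i<n | yes j<n = ⊥-elim (ℕₚ.<⇒≱ i<n n≤i)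
  ... | yes i<n | no _    = refl
  ... | no _    | yes _   = refl
  ... | no _    | no _    = refl
  decode-supported c .right i j n≤j with i ℕ.<? n | j ℕ.<? n
  ... | yes i<n | yes j<n = ⊥-elim (ℕₚ.<⇒≱ j<n n≤j)
  ... | yes i<n | no _    = refl
  ... | no _    | yes _   = refl
  ... | no _    | no _    = refl

  decode-encode : ∀ P i j → decode (encode P) i j ≡ entry P i j
  decode-encode P i j with i ℕ.<? n | j ℕ.<? n
  ... | yes i<n | yes j<n = trans
    (cong toℕ (trans
      (cong (λ c → finToFun c (fromℕ< j<n)) (Finₚ.finToFun-funToFin {n} _ (fromℕ< i<n)))
      (Finₚ.finToFun-funToFin {n} _ (fromℕ< j<n))))
    (trans (Finₚ.toℕ-fromℕ< _)
           (cong₂ (entry P) (Finₚ.toℕ-fromℕ< i<n) (Finₚ.toℕ-fromℕ< j<n)))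
  ... | yes _ | no j≮n = sym (right (supported P) i j (ℕₚ.≮⇒≥ j≮n))
  ... | no i≮n | yes _ = sym (below (supported P) i j (ℕₚ.≮⇒≥ i≮n))
  ... | no i≮n | no _  = sym (below (supported P) i j (ℕₚ.≮⇒≥ i≮n))

  funToFin-cong : ∀ {m k} {f g : Fin m → Fin k} → (∀ i → f i ≡ g i) → funToFin f ≡ funToFin g
  funToFin-cong {zero}  h = refl
  funToFin-cong {suc m} h = cong₂ combine (h Fin.zero) (funToFin-cong (λ i → h (Fin.suc i)))

  encode-decode : ∀ P c → (∀ i j → entry P i j ≡ decode c i j) → encode P ≡ c
  encode-decode P c h = trans
    (funToFin-cong {n} λ i → trans
      (funToFin-cong {n} λ j → Finₚ.toℕ-injective (trans (Finₚ.toℕ-fromℕ< _)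
        (trans (h (toℕ i) (toℕ j)) (decode-toℕ i j))))
      (Finₚ.funToFin-finToFin {n} (finToFun c i)))
    (Finₚ.funToFin-finToFin {n} c)
    where
    decode-toℕ : ∀ i j → decode c (toℕ i) (toℕ j) ≡ toℕ (finToFun (finToFun c i) j)
    decode-toℕ i j with toℕ i ℕ.<? n | toℕ j ℕ.<? n
    ... | yes i<n | yes j<n = cong₂ (λ i j → toℕ (finToFun (finToFun c i) j))
                                (Finₚ.fromℕ<-toℕ i i<n) (Finₚ.fromℕ<-toℕ j j<n)
    ... | yes _   | no j≮n  = ⊥-elim (j≮n (Finₚ.toℕ<n j))
    ... | no i≮n  | _       = ⊥-elim (i≮n (Finₚ.toℕ<n i))

  record Check (π : ℕ → ℕ → ℕ) : Set where
    constructor check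
    field
      columns : ∀ {k} → k ℕ.< n → ∀ {i} → i ℕ.< n → π (suc i) k ℕ.≤ π i k
      rows    : ∀ {k} → k ℕ.< n → ∀ {i} → i ℕ.< n → π k (suc i) ℕ.≤ π k i
      box     : boxSum n π ≡ n
  open Check

  check? : ∀ π → Dec (Check π)
  check? π = map′ (λ (a , b , c) → check (λ {k} → a {k}) (λ {k} → b {k}) c)
                  (λ ok → (λ {k} → columns ok {k}) , (λ {k} → rows ok {k}) , box ok)
    (ℕₚ.allUpTo? (λ k → ℕₚ.allUpTo? (λ i → π (suc i) k ℕ.≤? π i k) n) n ×-dec
     (ℕₚ.allUpTo? (λ k → ℕₚ.allUpTo? (λ i → π k (suc i) ℕ.≤? π k i) n) n ×-dec
      (boxSum n π ℕ.≟ n)))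

  antitone : ∀ (f : ℕ → ℕ) → (∀ i → f (suc i) ℕ.≤ f i) → ∀ {i j} → i ℕ.≤ j → f j ℕ.≤ f i
  antitone f h {i} {j} i≤j = subst (λ j → f j ℕ.≤ f i) (ℕₚ.m∸n+n≡m i≤j) (go (j ℕ.∸ i))
    where
    go : ∀ d → f (d ℕ.+ i) ℕ.≤ f i
    go zero    = ℕₚ.≤-refl
    go (suc d) = ℕₚ.≤-trans (h _) (go d)

  fromCheck : ∀ π → Supported π → Check π → PlanePartition n
  fromCheck π s c = record
    { entry        = π
    ; columns-mono = λ k → antitone (λ i → π i k) (column-step k)
    ; rows-mono    = λ k → antitone (π k) (row-step k)
    ; total        = n , λ m n≤m → trans (boxSum-stable s m n≤m) (box c)
    }
    where
    column-step : ∀ k i → π (suc i) k ℕ.≤ π i k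
    column-step k i with k ℕ.<? n | i ℕ.<? n
    ... | yes k<n | yes i<n = columns c k<n i<n
    ... | no k≮n  | _       = ℕₚ.≤-trans (ℕₚ.≤-reflexive (right s (suc i) k (ℕₚ.≮⇒≥ k≮n))) ℕ.z≤n
    ... | yes _   | no i≮n  = ℕₚ.≤-trans
      (ℕₚ.≤-reflexive (below s (suc i) k (ℕₚ.m≤n⇒m≤1+n (ℕₚ.≮⇒≥ i≮n)))) ℕ.z≤n
    row-step : ∀ k i → π k (suc i) ℕ.≤ π k i
    row-step k i with k ℕ.<? n | i ℕ.<? n
    ... | yes k<n | yes i<n = rows c k<n i<n
    ... | no k≮n  | _       = ℕₚ.≤-trans (ℕₚ.≤-reflexive (below s k (suc i) (ℕₚ.≮⇒≥ k≮n))) ℕ.z≤n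
    ... | yes _   | no i≮n  = ℕₚ.≤-trans
      (ℕₚ.≤-reflexive (right s k (suc i) (ℕₚ.m≤n⇒m≤1+n (ℕₚ.≮⇒≥ i≮n)))) ℕ.z≤n

  toCheck : ∀ P π → (∀ i j → π i j ≡ entry P i j) → Check π
  toCheck P π h = check
    (λ {k} _ {i} _ → subst₂ ℕ._≤_ (sym (h (suc i) k)) (sym (h i k)) (columns-mono P k (ℕₚ.n≤1+n i)))
    (λ {k} _ {i} _ → subst₂ ℕ._≤_ (sym (h k (suc i))) (sym (h k i)) (rows-mono P k (ℕₚ.n≤1+n i)))
    (trans (∑ℕ-cong n (λ i → ∑ℕ-cong n (h i)))
      (trans (sym (boxSum-stable (supported P) m (ℕₚ.m≤n+m n m₀)))
             (proj₂ (total P) m (ℕₚ.m≤m+n m₀ n))))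
    where
    m₀ = proj₁ (total P)
    m = m₀ ℕ.+ n

  decide : ∀ c → Dec (∃[ P ] (encode P ≡ c))
  decide c = map′
    (λ ok → let P = fromCheck (decode c) (decode-supported c) ok in
            P , encode-decode P c (λ i j → refl))
    (λ { (P , refl) → toCheck P _ (decode-encode P) })
    (check? (decode c))

  enumeration : ∃[ k ] Cardinality (planePartitions n) k
  enumeration = finite (planePartitions n) encode
    (λ {P} {Q} P≈Q → encode-decode P (encode Q) (λ i j → trans (P≈Q i j) (sym (decode-encode Q i j))))
    (λ {P} {Q} e i j → trans (sym (decode-encode P i j))
                         (trans (cong (λ c → decode c i j) e) (decode-encode Q i j)))
    decide

-- The number of plane partitions: the k for which they are in bijection with Fin k.
PL : ℕ → ℕ
PL n = proj₁ (Enumerate.enumeration n)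

PL-cardinality : ∀ n → Cardinality (planePartitions n) (PL n)
PL-cardinality n = proj₂ (Enumerate.enumeration n)

singleton : ∀ n → PlanePartition n
singleton n = record
  { entry = π ; columns-mono = col ; rows-mono = row
  ; total = 1 , λ { (suc m) _ → trans (∑ℕ-tail 1 (suc m) _ rest (ℕ.s≤s ℕ.z≤n))
                                      (∑ℕ-tail 1 (suc m) _ rest₀ (ℕ.s≤s ℕ.z≤n)) } }
  where
  π : ℕ → ℕ → ℕ
  π zero zero = n
  π _    _    = 0
  col : ∀ k {i j} → i ℕ.≤ j → π j k ℕ.≤ π i k
  col k {zero} {zero} _ = ℕₚ.≤-refl
  col k {zero} {suc j} _ = ℕ.z≤n
  col k {suc i} {suc j} _ = ℕ.z≤n
  row : ∀ k {i j} → i ℕ.≤ j → π k j ℕ.≤ π k i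
  row zero    {zero} {zero} _ = ℕₚ.≤-refl
  row zero    {_} {suc j}   _ = ℕ.z≤n
  row (suc k)               _ = ℕ.z≤n
  rest₀ : ∀ i → 1 ℕ.≤ i → π 0 i ≡ 0
  rest₀ (suc i) _ = refl
  rest : ∀ {m} i → 1 ℕ.≤ i → ∑ℕ m (π i) ≡ 0
  rest {m} (suc i) _ = ∑ℕ-zero m (λ j → refl)

PL-nonZero : ∀ n → ℕ.NonZero (PL n)
PL-nonZero n = Finₚ.nonZeroIndex (Inverse.to (PL-cardinality n) (singleton n))

0≤q-p : ∀ {p q} → p ℚ.≤ q → 0ℚ ℚ.≤ q ℚ.- p
0≤q-p {p} {q} p≤q = subst (ℚ._≤ q ℚ.- p) (ℚₚ.+-inverseʳ p) (ℚₚ.+-monoˡ-≤ (ℚ.- p) p≤q)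

∣-∣-< : ∀ {p ε} → p ℚ.< ε → ℚ.- p ℚ.< ε → ℚ.∣ p ∣ ℚ.< ε
∣-∣-< {p} {ε} a b with ℚₚ.∣p∣≡p∨∣p∣≡-p p
... | inj₁ e = subst (ℚ._< ε) (sym e) a
... | inj₂ e = subst (ℚ._< ε) (sym e) b

∣-∣-≤ : ∀ {p r} → p ℚ.≤ r → ℚ.- p ℚ.≤ r → ℚ.∣ p ∣ ℚ.≤ r
∣-∣-≤ {p} {ε} a b with ℚₚ.∣p∣≡p∨∣p∣≡-p p
... | inj₁ e = subst (ℚ._≤ ε) (sym e) a
... | inj₂ e = subst (ℚ._≤ ε) (sym e) b

p≤∣p∣ : ∀ p → p ℚ.≤ ℚ.∣ p ∣
p≤∣p∣ p with ℚₚ.≤-total 0ℚ p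
... | inj₁ 0≤p = ℚₚ.≤-reflexive (sym (ℚₚ.0≤p⇒∣p∣≡p 0≤p))
... | inj₂ p≤0 = ℚₚ.≤-trans p≤0 (ℚₚ.0≤∣p∣ p)

∣p-q∣≡∣q-p∣ : ∀ p q → ℚ.∣ p ℚ.- q ∣ ≡ ℚ.∣ q ℚ.- p ∣
∣p-q∣≡∣q-p∣ p q = trans (sym (ℚₚ.∣-p∣≡∣p∣ (p ℚ.- q)))
  (cong ℚ.∣_∣ (S.solve 2 (λ p q → S.:- (p S.:- q) S.:= q S.:- p) refl p q))

∣p∣-∣q∣≤∣p-q∣ : ∀ p q → ℚ.∣ p ∣ ℚ.- ℚ.∣ q ∣ ℚ.≤ ℚ.∣ p ℚ.- q ∣
∣p∣-∣q∣≤∣p-q∣ p q = subst (ℚ.∣ p ∣ ℚ.- ℚ.∣ q ∣ ℚ.≤_)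
  (S.solve 2 (λ d b → (d S.:+ b) S.:- b S.:= d) refl ℚ.∣ p ℚ.- q ∣ ℚ.∣ q ∣)
  (ℚₚ.+-monoˡ-≤ (ℚ.- ℚ.∣ q ∣)
    (subst (λ r → ℚ.∣ r ∣ ℚ.≤ ℚ.∣ p ℚ.- q ∣ ℚ.+ ℚ.∣ q ∣)
      (S.solve 2 (λ p q → (p S.:- q) S.:+ q S.:= p) refl p q)
      (ℚₚ.∣p+q∣≤∣p∣+∣q∣ (p ℚ.- q) q)))

∣∣p∣-∣q∣∣≤∣p-q∣ : ∀ p q → ℚ.∣ ℚ.∣ p ∣ ℚ.- ℚ.∣ q ∣ ∣ ℚ.≤ ℚ.∣ p ℚ.- q ∣
∣∣p∣-∣q∣∣≤∣p-q∣ p q = ∣-∣-≤ (∣p∣-∣q∣≤∣p-q∣ p q)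
  (subst₂ ℚ._≤_ (S.solve 2 (λ a b → b S.:- a S.:= S.:- (a S.:- b)) refl ℚ.∣ p ∣ ℚ.∣ q ∣)
    (∣p-q∣≡∣q-p∣ q p) (∣p∣-∣q∣≤∣p-q∣ q p))

halves : ∀ ε → ½ ℚ.* ε ℚ.+ ½ ℚ.* ε ≡ ε
halves ε = trans (sym (ℚₚ.*-distribʳ-+ ε ½ ½)) (ℚₚ.*-identityˡ ε)

*-pos : ∀ {p q} → 0ℚ ℚ.< p → 0ℚ ℚ.< q → 0ℚ ℚ.< p ℚ.* q
*-pos {p} {q} 0<p 0<q = ℚₚ.positive⁻¹ (p ℚ.* q)
  {{ℚₚ.pos*pos⇒pos p {{ℚ.positive 0<p}} q {{ℚ.positive 0<q}}}}

half-pos : ∀ {ε} → 0ℚ ℚ.< ε → 0ℚ ℚ.< ½ ℚ.* ε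
half-pos = *-pos (ℚₚ.positive⁻¹ ½)

*-mono-≤-nonNeg : ∀ {p q r s} → 0ℚ ℚ.≤ p → p ℚ.≤ q → 0ℚ ℚ.≤ r → r ℚ.≤ s → p ℚ.* r ℚ.≤ q ℚ.* s
*-mono-≤-nonNeg {p} {q} {r} {s} 0≤p p≤q 0≤r r≤s = ℚₚ.≤-trans
  (ℚₚ.*-monoʳ-≤-nonNeg r {{ℚ.nonNegative 0≤r}} p≤q)
  (ℚₚ.*-monoˡ-≤-nonNeg q {{ℚ.nonNegative (ℚₚ.≤-trans 0≤p p≤q)}} r≤s)

recip : (q : ℚ) → 0ℚ ℚ.< q → Σ[ r ∈ ℚ ] (0ℚ ℚ.< r × r ℚ.* q ≡ 1ℚ)
recip q 0<q = ℚ.1/ q , ℚₚ.positive⁻¹ _ {{ℚₚ.1/pos⇒pos q}} , ℚₚ.*-inverseˡ q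
  where
  instance
    q-pos = ℚ.positive 0<q
    q-nz  = ℚₚ.pos⇒nonZero q

-- Real numbers are Cauchy sequences of rationals (Bishop style, modulus included).
IsCauchy : (ℕ → ℚ) → Set
IsCauchy s = ∀ ε → 0ℚ ℚ.< ε →
             ∃[ N ] (∀ m n → N ℕ.≤ m → N ℕ.≤ n → ℚ.∣ s m ℚ.- s n ∣ ℚ.< ε)

record ℝ : Set where
  constructor mkℝ
  field
    seq    : ℕ → ℚ
    cauchy : IsCauchy seq
open ℝ

fromℚ : ℚ → ℝ
fromℚ q = mkℝ (λ _ → q) λ ε 0<ε → 0 , λ _ _ _ _ →
  subst (λ r → ℚ.∣ r ∣ ℚ.< ε) (sym (ℚₚ.+-inverseʳ q)) 0<ε

fromℕ : ℕ → ℝ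
fromℕ n = fromℚ (+ n ℚ./ 1)

infix  8 _^[_∕_] _^_
infixl 7 _*_ _÷_[_]
infixl 6 _-_
infix  4 _<_ _∼_

-- A fixed rational gap δ keeps < invariant under equality of limits.
_<_ : ℝ → ℝ → Set
x < y = Σ[ δ ∈ ℚ ] (0ℚ ℚ.< δ × ∃[ N ] (∀ n → N ℕ.≤ n → seq x n ℚ.+ δ ℚ.≤ seq y n))

∣_∣ : ℝ → ℝ
∣ x ∣ = mkℝ (λ n → ℚ.∣ seq x n ∣) λ ε 0<ε → let (N , h) = cauchy x ε 0<ε in
  N , λ m n N≤m N≤n → ℚₚ.≤-<-trans (∣∣p∣-∣q∣∣≤∣p-q∣ (seq x m) (seq x n)) (h m n N≤m N≤n)

_-_ : ℝ → ℝ → ℝ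
x - y = mkℝ (λ n → seq x n ℚ.- seq y n) λ ε 0<ε →
  let (N , h) = cauchy x (½ ℚ.* ε) (half-pos 0<ε)
      (M , k) = cauchy y (½ ℚ.* ε) (half-pos 0<ε)
  in N ℕ.+ M , λ m n N+M≤m N+M≤n →
    let a = seq x m ; b = seq y m ; c = seq x n ; d = seq y n
        N≤ = ℕₚ.m+n≤o⇒m≤o N ; M≤ = ℕₚ.m+n≤o⇒n≤o N in
    subst₂ ℚ._<_
      (cong ℚ.∣_∣ (S.solve 4 (λ a b c d →
        (a S.:- c) S.:- (b S.:- d) S.:= (a S.:- b) S.:- (c S.:- d)) refl a b c d))
      (halves ε)
      (ℚₚ.≤-<-trans (ℚₚ.∣p-q∣≤∣p∣+∣q∣ (a ℚ.- c) (b ℚ.- d))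
        (ℚₚ.+-mono-< (h m n (N≤ N+M≤m) (N≤ N+M≤n)) (k m n (M≤ N+M≤m) (M≤ N+M≤n))))

bounded : ∀ x → Σ[ B ∈ ℚ ] (0ℚ ℚ.< B × ∃[ N ] (∀ n → N ℕ.≤ n → ℚ.∣ seq x n ∣ ℚ.≤ B))
bounded x = let (N , h) = cauchy x 1ℚ (ℚₚ.positive⁻¹ 1ℚ) in
  1ℚ ℚ.+ ℚ.∣ seq x N ∣
  , ℚₚ.<-≤-trans (ℚₚ.positive⁻¹ 1ℚ)
      (ℚₚ.≤-trans (ℚₚ.≤-reflexive (sym (ℚₚ.+-identityʳ 1ℚ)))
                  (ℚₚ.+-monoʳ-≤ 1ℚ (ℚₚ.0≤∣p∣ (seq x N))))
  , N , λ n N≤n →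
      subst (λ r → ℚ.∣ r ∣ ℚ.≤ _)
        (S.solve 2 (λ a b → (a S.:- b) S.:+ b S.:= a) refl (seq x n) (seq x N))
        (ℚₚ.≤-trans (ℚₚ.∣p+q∣≤∣p∣+∣q∣ (seq x n ℚ.- seq x N) (seq x N))
          (ℚₚ.+-monoˡ-≤ ℚ.∣ seq x N ∣ (ℚₚ.<⇒≤ (h n N N≤n ℕₚ.≤-refl))))

_*_ : ℝ → ℝ → ℝ
x * y = mkℝ (λ n → seq x n ℚ.* seq y n) λ ε 0<ε →
  let (B , 0<B , N₁ , x≤B) = bounded x
      (C , 0<C , N₂ , y≤C) = bounded y
      (B⁻¹ , 0<B⁻¹ , B⁻¹B) = recip B 0<B
      (C⁻¹ , 0<C⁻¹ , C⁻¹C) = recip C 0<C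
      (N₃ , h) = cauchy x (C⁻¹ ℚ.* (½ ℚ.* ε)) (*-pos 0<C⁻¹ (half-pos 0<ε))
      (N₄ , k) = cauchy y (B⁻¹ ℚ.* (½ ℚ.* ε)) (*-pos 0<B⁻¹ (half-pos 0<ε))
  in ((N₁ ℕ.+ N₂) ℕ.+ (N₃ ℕ.+ N₄)) , λ m n N≤m N≤n →
    let a = seq x m ; b = seq y m ; c = seq x n ; d = seq y n
        N₁₂≤ = λ {o} (p : _ ℕ.≤ o) → ℕₚ.m+n≤o⇒m≤o (N₁ ℕ.+ N₂) {N₃ ℕ.+ N₄} p
        N₃₄≤ = λ {o} (p : _ ℕ.≤ o) → ℕₚ.m+n≤o⇒n≤o (N₁ ℕ.+ N₂) {N₃ ℕ.+ N₄} p
        part : ∀ D D⁻¹ {u v} → 0ℚ ℚ.< D → D⁻¹ ℚ.* D ≡ 1ℚ → ℚ.∣ u ∣ ℚ.≤ D →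
               ℚ.∣ v ∣ ℚ.< D⁻¹ ℚ.* (½ ℚ.* ε) → ℚ.∣ u ℚ.* v ∣ ℚ.< ½ ℚ.* ε
        part D D⁻¹ {u} {v} 0<D inverse u≤D v< = ℚₚ.≤-<-trans
          (ℚₚ.≤-trans (ℚₚ.≤-reflexive (ℚₚ.∣p*q∣≡∣p∣*∣q∣ u v))
            (ℚₚ.*-monoʳ-≤-nonNeg ℚ.∣ v ∣ {{ℚ.nonNegative (ℚₚ.0≤∣p∣ v)}} u≤D))
          (subst (D ℚ.* ℚ.∣ v ∣ ℚ.<_)
            (trans (S.solve 3 (λ D D⁻¹ e → D S.:* (D⁻¹ S.:* e) S.:= (D⁻¹ S.:* D) S.:* e) refl
                     D D⁻¹ (½ ℚ.* ε))
              (trans (cong (ℚ._* (½ ℚ.* ε)) inverse) (ℚₚ.*-identityˡ _)))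
            (ℚₚ.*-monoʳ-<-pos D {{ℚ.positive 0<D}} v<))
    in subst₂ ℚ._<_
      (cong ℚ.∣_∣ (S.solve 4 (λ a b c d →
        a S.:* (b S.:- d) S.:+ d S.:* (a S.:- c) S.:= a S.:* b S.:- c S.:* d) refl a b c d))
      (halves ε)
      (ℚₚ.≤-<-trans (ℚₚ.∣p+q∣≤∣p∣+∣q∣ (a ℚ.* (b ℚ.- d)) (d ℚ.* (a ℚ.- c)))
        (ℚₚ.+-mono-<
          (part B B⁻¹ 0<B B⁻¹B (x≤B m (ℕₚ.m+n≤o⇒m≤o N₁ (N₁₂≤ N≤m)))
            (k m n (ℕₚ.m+n≤o⇒n≤o N₃ (N₃₄≤ N≤m)) (ℕₚ.m+n≤o⇒n≤o N₃ (N₃₄≤ N≤n))))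
          (part C C⁻¹ 0<C C⁻¹C (y≤C n (ℕₚ.m+n≤o⇒n≤o N₁ (N₁₂≤ N≤n)))
            (h m n (ℕₚ.m+n≤o⇒m≤o N₃ (N₃₄≤ N≤m)) (ℕₚ.m+n≤o⇒m≤o N₃ (N₃₄≤ N≤n))))))

-- x ≠ 0 in the constructive sense: |x| is bounded below by a positive rational.
Apart0 : ℝ → Set
Apart0 x = Σ[ δ ∈ ℚ ] (0ℚ ℚ.< δ × ∃[ N ] (∀ n → N ℕ.≤ n → δ ℚ.≤ ℚ.∣ seq x n ∣))

-- 1/0 = 0; only values bounded away from 0 matter in the reciprocal below.
inv : ℚ → ℚ
inv q with q ℚₚ.≟ 0ℚ
... | yes _  = 0ℚ
... | no q≢0 = (ℚ.1/ q) {{ℚ.≢-nonZero q≢0}}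

inv-inverse : ∀ {q δ} → 0ℚ ℚ.< δ → δ ℚ.≤ ℚ.∣ q ∣ → inv q ℚ.* q ≡ 1ℚ
inv-inverse {q} 0<δ δ≤ with q ℚₚ.≟ 0ℚ
... | yes refl = ⊥-elim (ℚₚ.<-irrefl refl (ℚₚ.<-≤-trans 0<δ δ≤))
... | no q≢0   = ℚₚ.*-inverseˡ q {{ℚ.≢-nonZero q≢0}}

reciprocal : (x : ℝ) → Apart0 x → ℝ
reciprocal x (δ , 0<δ , N₁ , δ≤) = mkℝ (λ n → inv (seq x n)) λ ε 0<ε →
  let (N₂ , h) = cauchy x (ε ℚ.* (δ ℚ.* δ)) (*-pos 0<ε (*-pos 0<δ 0<δ))
  in N₁ ℕ.+ N₂ , λ m n N≤m N≤n →
    let a = seq x m ; b = seq x n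
        δ≤a = δ≤ m (ℕₚ.m+n≤o⇒m≤o N₁ N≤m) ; δ≤b = δ≤ n (ℕₚ.m+n≤o⇒m≤o N₁ N≤n)
        0≤δ = ℚₚ.<⇒≤ 0<δ ; 0≤ε = ℚₚ.<⇒≤ 0<ε
        ab = ℚ.∣ a ∣ ℚ.* ℚ.∣ b ∣
        δδ≤ab = *-mono-≤-nonNeg 0≤δ δ≤a 0≤δ δ≤b
        key : (inv a ℚ.- inv b) ℚ.* (a ℚ.* b) ≡ b ℚ.- a
        key = trans
          (S.solve 4 (λ a b i j → (i S.:- j) S.:* (a S.:* b) S.:= (i S.:* a) S.:* b S.:- (j S.:* b) S.:* a)
            refl a b (inv a) (inv b))
          (cong₂ ℚ._-_ (trans (cong (ℚ._* b) (inv-inverse 0<δ δ≤a)) (ℚₚ.*-identityˡ b))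
                       (trans (cong (ℚ._* a) (inv-inverse 0<δ δ≤b)) (ℚₚ.*-identityˡ a)))
        key′ : ℚ.∣ inv a ℚ.- inv b ∣ ℚ.* ab ≡ ℚ.∣ a ℚ.- b ∣
        key′ = trans (cong (ℚ.∣ inv a ℚ.- inv b ∣ ℚ.*_) (sym (ℚₚ.∣p*q∣≡∣p∣*∣q∣ a b)))
          (trans (sym (ℚₚ.∣p*q∣≡∣p∣*∣q∣ (inv a ℚ.- inv b) (a ℚ.* b)))
            (trans (cong ℚ.∣_∣ key) (∣p-q∣≡∣q-p∣ b a)))
    in ℚₚ.*-cancelʳ-<-nonNeg ab
         {{ℚ.nonNegative (ℚₚ.≤-trans (ℚₚ.<⇒≤ (*-pos 0<δ 0<δ)) δδ≤ab)}}
         (subst (ℚ._< ε ℚ.* ab) (sym key′)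
           (ℚₚ.<-≤-trans (h m n (ℕₚ.m+n≤o⇒n≤o N₁ N≤m) (ℕₚ.m+n≤o⇒n≤o N₁ N≤n))
             (ℚₚ.*-monoˡ-≤-nonNeg ε {{ℚ.nonNegative 0≤ε}} δδ≤ab)))

_÷_[_] : (x y : ℝ) → Apart0 y → ℝ
x ÷ y [ y≉0 ] = x * reciprocal y y≉0

_^_ : ℝ → ℕ → ℝ
x ^ zero  = fromℚ 1ℚ
x ^ suc n = x * x ^ n

1/suc_ : ℕ → ℚ
1/suc k = + 1 ℚ./ suc k

/-≤ : ∀ a b c d .{{_ : ℕ.NonZero b}} .{{_ : ℕ.NonZero d}} →
      a ℕ.* d ℕ.≤ c ℕ.* b → + a ℚ./ b ℚ.≤ + c ℚ./ d
/-≤ a (suc b) c (suc d) le = ℚₚ.toℚᵘ-cancel-≤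
  (ℚᵘₚ.≤-respʳ-≃ (ℚᵘₚ.≃-sym (ℚₚ.toℚᵘ-fromℚᵘ (ℚᵘ.mkℚᵘ (+ c) d)))
    (ℚᵘₚ.≤-respˡ-≃ (ℚᵘₚ.≃-sym (ℚₚ.toℚᵘ-fromℚᵘ (ℚᵘ.mkℚᵘ (+ a) b)))
      (ℚᵘ.*≤* (subst₂ ℤ._≤_ (ℤₚ.pos-* a (suc d)) (ℤₚ.pos-* c (suc b)) (ℤ.+≤+ le)))))

/-*-/ : ∀ a b c d e f .{{_ : ℕ.NonZero b}} .{{_ : ℕ.NonZero d}} .{{_ : ℕ.NonZero f}} →
        a ℕ.* c ℕ.* f ≡ e ℕ.* (b ℕ.* d) → (+ a ℚ./ b) ℚ.* (+ c ℚ./ d) ≡ + e ℚ./ f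
/-*-/ a (suc b) c (suc d) e (suc f) eq = ℚₚ.toℚᵘ-injective
  (ℚᵘₚ.≃-trans (ℚₚ.toℚᵘ-homo-* (+ a ℚ./ suc b) (+ c ℚ./ suc d))
    (ℚᵘₚ.≃-trans (ℚᵘₚ.*-cong (ℚₚ.toℚᵘ-fromℚᵘ (ℚᵘ.mkℚᵘ (+ a) b)) (ℚₚ.toℚᵘ-fromℚᵘ (ℚᵘ.mkℚᵘ (+ c) d)))
      (ℚᵘₚ.≃-trans
        (ℚᵘ.*≡* (trans (cong (ℤ._* + suc f) (sym (ℤₚ.pos-* a c)))
                 (trans (sym (ℤₚ.pos-* (a ℕ.* c) (suc f)))
                   (trans (cong +_ eq) (ℤₚ.pos-* e (suc b ℕ.* suc d))))))
        (ℚᵘₚ.≃-sym (ℚₚ.toℚᵘ-fromℚᵘ (ℚᵘ.mkℚᵘ (+ e) f))))))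

/-+-/ : ∀ a c d .{{_ : ℕ.NonZero d}} → (+ a ℚ./ d) ℚ.+ (+ c ℚ./ d) ≡ + (a ℕ.+ c) ℚ./ d
/-+-/ a c (suc d) = ℚₚ.toℚᵘ-injective
  (ℚᵘₚ.≃-trans (ℚₚ.toℚᵘ-homo-+ (+ a ℚ./ suc d) (+ c ℚ./ suc d))
    (ℚᵘₚ.≃-trans (ℚᵘₚ.+-cong (ℚₚ.toℚᵘ-fromℚᵘ (ℚᵘ.mkℚᵘ (+ a) d)) (ℚₚ.toℚᵘ-fromℚᵘ (ℚᵘ.mkℚᵘ (+ c) d)))
      (ℚᵘₚ.≃-trans
        (ℚᵘ.*≡* (trans (cong (ℤ._* + suc d)
                         (trans (sym (ℤₚ.*-distribʳ-+ (+ suc d) (+ a) (+ c)))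
                                (cong (ℤ._* + suc d) (sym (ℤₚ.pos-+ a c)))))
                 (trans (ℤₚ.*-assoc (+ (a ℕ.+ c)) (+ suc d) (+ suc d))
                        (cong (+ (a ℕ.+ c) ℤ.*_) (sym (ℤₚ.pos-* (suc d) (suc d)))))))
        (ℚᵘₚ.≃-sym (ℚₚ.toℚᵘ-fromℚᵘ (ℚᵘ.mkℚᵘ (+ (a ℕ.+ c)) d))))))

1/suc-pos : ∀ k → 0ℚ ℚ.< 1/suc k
1/suc-pos k = ℚₚ.positive⁻¹ (1/suc k) {{ℚₚ.normalize-pos 1 (suc k)}}

1/suc-antitone : ∀ {m n} → m ℕ.≤ n → 1/suc n ℚ.≤ 1/suc m
1/suc-antitone {m} {n} m≤n = /-≤ 1 (suc n) 1 (suc m) (ℕₚ.*-monoʳ-≤ 1 (ℕ.s≤s m≤n))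

1/suc-telescope : ∀ m → 1/suc m ℚ.- 1/suc (suc m) ≡ + 1 ℚ./ (suc m ℕ.* suc (suc m))
1/suc-telescope m = trans (cong (ℚ._- y) x≡) (trans
  (S.solve 2 (λ p y → (p S.:+ y) S.:- y S.:= p) refl (+ 1 ℚ./ (suc m ℕ.* suc (suc m))) y) refl)
  where
  x = 1/suc m
  y = 1/suc (suc m)
  M = suc m
  x≡ : x ≡ + 1 ℚ./ (M ℕ.* suc M) ℚ.+ y
  x≡ = trans (sym (/-*-/ (suc M) (M ℕ.* suc M) 1 1 1 M
                    (trans (cong (ℕ._* M) (ℕₚ.*-identityʳ (suc M)))
                      (trans (ℕₚ.*-comm (suc M) M)
                        (sym (trans (ℕₚ.*-identityˡ _) (ℕₚ.*-identityʳ _)))))))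
         (trans (ℚₚ.*-identityʳ _) (trans (sym (/-+-/ 1 M (M ℕ.* suc M)))
           (cong (+ 1 ℚ./ (M ℕ.* suc M) ℚ.+_)
             (trans (sym (ℚₚ.*-identityʳ _)) (/-*-/ M (M ℕ.* suc M) 1 1 1 (suc M)
               (trans (cong (ℕ._* suc M) (ℕₚ.*-identityʳ M))
                 (sym (trans (ℕₚ.*-identityˡ _) (ℕₚ.*-identityʳ _)))))))))

archimedean : ∀ ε → 0ℚ ℚ.< ε → ∃[ N ] (1/suc N ℚ.< ε)
archimedean ε@(ℚ.mkℚ (+ suc a) d _) 0<ε = suc d , ℚₚ.<-≤-trans
  (ℚₚ.toℚᵘ-cancel-<
    (ℚᵘₚ.<-respʳ-≃ (ℚᵘₚ.≃-sym (ℚₚ.toℚᵘ-fromℚᵘ (ℚᵘ.mkℚᵘ (+ 1) d)))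
      (ℚᵘₚ.<-respˡ-≃ (ℚᵘₚ.≃-sym (ℚₚ.toℚᵘ-fromℚᵘ (ℚᵘ.mkℚᵘ (+ 1) (suc d))))
        (ℚᵘ.*<* (ℤ.+<+ (ℕₚ.*-monoʳ-< 1 (ℕₚ.n<1+n (suc d))))))))
  (subst (1/suc d ℚ.≤_) (ℚₚ.↥p/↧p≡p ε)
    (/-≤ 1 (suc d) (suc a) (suc d) (ℕₚ.*-monoˡ-≤ (suc d) {1} {suc a} (ℕ.s≤s ℕ.z≤n))))
archimedean (ℚ.mkℚ (+ zero) d c) (ℚ.*<* (ℤ.+<+ ()))
archimedean (ℚ.mkℚ (ℤ.-[1+ a ]) d c) (ℚ.*<* ())

-- Monotone sequences whose increments are dominated by those of - 1/suc m.
squeeze : ∀ s → (∀ m → s m ℚ.≤ s (suc m)) →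
          (∀ m → s (suc m) ℚ.- s m ℚ.≤ 1/suc m ℚ.- 1/suc (suc m)) → IsCauchy s
squeeze s mono step ε 0<ε = let (N , N<ε) = archimedean ε 0<ε in
  N , λ m n N≤m N≤n → ℚₚ.≤-<-trans (both N m n N≤m N≤n) N<ε
  where
  up : ∀ m d → s m ℚ.≤ s (d ℕ.+ m)
  up m zero    = ℚₚ.≤-refl
  up m (suc d) = ℚₚ.≤-trans (up m d) (mono _)
  bound : ∀ m d → s (d ℕ.+ m) ℚ.- s m ℚ.≤ 1/suc m ℚ.- 1/suc (d ℕ.+ m)
  bound m zero    = ℚₚ.≤-reflexive (trans (ℚₚ.+-inverseʳ (s m)) (sym (ℚₚ.+-inverseʳ (1/suc m))))
  bound m (suc d) = subst₂ ℚ._≤_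
    (S.solve 3 (λ a b c → (a S.:- b) S.:+ (b S.:- c) S.:= a S.:- c) refl
      (s (suc (d ℕ.+ m))) (s (d ℕ.+ m)) (s m))
    (S.solve 3 (λ a b c → (b S.:- a) S.:+ (c S.:- b) S.:= c S.:- a) refl
      (1/suc (suc (d ℕ.+ m))) (1/suc (d ℕ.+ m)) (1/suc m))
    (ℚₚ.+-mono-≤ (step (d ℕ.+ m)) (bound m d))
  close : ∀ N m d → N ℕ.≤ m → s (d ℕ.+ m) ℚ.- s m ℚ.≤ 1/suc N
  close N m d N≤m = ℚₚ.≤-trans (bound m d) (ℚₚ.≤-trans
    (subst (1/suc m ℚ.- 1/suc (d ℕ.+ m) ℚ.≤_) (ℚₚ.+-identityʳ (1/suc m))
      (ℚₚ.+-monoʳ-≤ (1/suc m) (ℚₚ.neg-antimono-≤ (ℚₚ.<⇒≤ (1/suc-pos (d ℕ.+ m))))))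
    (1/suc-antitone N≤m))
  ordered : ∀ N m n → N ℕ.≤ m → m ℕ.≤ n → ℚ.∣ s n ℚ.- s m ∣ ℚ.≤ 1/suc N
  ordered N m n N≤m m≤n = subst (λ n → ℚ.∣ s n ℚ.- s m ∣ ℚ.≤ 1/suc N) (ℕₚ.m∸n+n≡m m≤n)
    (ℚₚ.≤-trans (ℚₚ.≤-reflexive (ℚₚ.0≤p⇒∣p∣≡p (0≤q-p (up m (n ℕ.∸ m)))))
                (close N m (n ℕ.∸ m) N≤m))
  both : ∀ N m n → N ℕ.≤ m → N ℕ.≤ n → ℚ.∣ s m ℚ.- s n ∣ ℚ.≤ 1/suc N
  both N m n N≤m N≤n with ℕₚ.≤-total m n
  ... | inj₁ m≤n = subst (ℚ._≤ 1/suc N) (∣p-q∣≡∣q-p∣ (s n) (s m)) (ordered N m n N≤m m≤n)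
  ... | inj₂ n≤m = ordered N n m N≤n n≤m

∑ℚ : ℕ → (ℕ → ℚ) → ℚ
∑ℚ zero    f = 0ℚ
∑ℚ (suc m) f = ∑ℚ m f ℚ.+ f m

-- The sequence is ∑ 1/k^s over 1 ≤ k ≤ m + 1.
ζ : (s : ℕ) .{{_ : ℕ.NonTrivial s}} → ℝ
ζ s = mkℝ (λ m → ∑ℚ (suc m) term) (squeeze _ mono step)
  where
  term : ℕ → ℚ
  term k = (+ 1 ℚ./ suc k ℕ.^ s) {{ℕₚ.m^n≢0 (suc k) s}}
  mono : ∀ m → ∑ℚ (suc m) term ℚ.≤ ∑ℚ (suc (suc m)) term
  mono m = subst (ℚ._≤ ∑ℚ (suc (suc m)) term) (ℚₚ.+-identityʳ _)
    (ℚₚ.+-monoʳ-≤ (∑ℚ (suc m) term)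
      (/-≤ 0 1 1 (suc (suc m) ℕ.^ s) {{_}} {{ℕₚ.m^n≢0 (suc (suc m)) s}} ℕ.z≤n))
  step : ∀ m → ∑ℚ (suc (suc m)) term ℚ.- ∑ℚ (suc m) term ℚ.≤ 1/suc m ℚ.- 1/suc (suc m)
  step m = subst₂ ℚ._≤_
    (S.solve 2 (λ t u → t S.:= (u S.:+ t) S.:- u) refl (term (suc m)) (∑ℚ (suc m) term))
    (sym (1/suc-telescope m))
    (/-≤ 1 (M ℕ.^ s) 1 (suc m ℕ.* M) {{ℕₚ.m^n≢0 M s}}
      (ℕₚ.*-monoʳ-≤ 1 (ℕₚ.≤-trans (ℕₚ.*-monoˡ-≤ M (ℕₚ.n≤1+n (suc m)))
        (subst (ℕ._≤ M ℕ.^ s) (cong (M ℕ.*_) (ℕₚ.*-identityʳ M))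
          (ℕₚ.^-monoʳ-≤ M (ℕ.nonTrivial⇒n>1 s))))))
    where M = suc (suc m)

∑ℚ-+ : ∀ a b f → ∑ℚ (a ℕ.+ b) f ≡ ∑ℚ a f ℚ.+ ∑ℚ b (λ i → f (a ℕ.+ i))
∑ℚ-+ a zero    f = trans (cong (λ k → ∑ℚ k f) (ℕₚ.+-identityʳ a)) (sym (ℚₚ.+-identityʳ _))
∑ℚ-+ a (suc b) f = trans (cong (λ k → ∑ℚ k f) (ℕₚ.+-suc a b))
  (trans (cong (ℚ._+ f (a ℕ.+ b)) (∑ℚ-+ a b f)) (ℚₚ.+-assoc (∑ℚ a f) _ _))

const≤∑ℚ : ∀ k f c → (∀ i → i ℕ.< k → c ℚ.≤ f i) → (+ k ℚ./ 1) ℚ.* c ℚ.≤ ∑ℚ k f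
const≤∑ℚ zero    f c h = ℚₚ.≤-reflexive (ℚₚ.*-zeroˡ c)
const≤∑ℚ (suc k) f c h = subst (ℚ._≤ ∑ℚ k f ℚ.+ f k)
  (trans (S.solve 2 (λ k c → k S.:* c S.:+ c S.:= (k S.:+ S.con 1ℚ) S.:* c) refl (+ k ℚ./ 1) c)
    (cong (ℚ._* c) (trans (/-+-/ k 1 1) (cong (λ k → + k ℚ./ 1) (ℕₚ.+-comm k 1)))))
  (ℚₚ.+-mono-≤ (const≤∑ℚ k f c (λ i i<k → h i (ℕₚ.m<n⇒m<1+n i<k))) (h k ℕₚ.≤-refl))

∑ℚ≤const : ∀ k f c → (∀ i → i ℕ.< k → f i ℚ.≤ c) → ∑ℚ k f ℚ.≤ (+ k ℚ./ 1) ℚ.* c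
∑ℚ≤const zero    f c h = ℚₚ.≤-reflexive (sym (ℚₚ.*-zeroˡ c))
∑ℚ≤const (suc k) f c h = subst (∑ℚ k f ℚ.+ f k ℚ.≤_)
  (trans (S.solve 2 (λ k c → k S.:* c S.:+ c S.:= (k S.:+ S.con 1ℚ) S.:* c) refl (+ k ℚ./ 1) c)
    (cong (ℚ._* c) (trans (/-+-/ k 1 1) (cong (λ k → + k ℚ./ 1) (ℕₚ.+-comm k 1)))))
  (ℚₚ.+-mono-≤ (∑ℚ≤const k f c (λ i i<k → h i (ℕₚ.m<n⇒m<1+n i<k))) (h k ℕₚ.≤-refl))

-- log n = ∫₁ⁿ dt/t, approximated by right-endpoint Riemann sums of mesh 1/M,
-- M = m + 1: the (n - 1) · M summands are (1/M) · 1/(1 + (j + 1)/M) = 1/(M + j + 1).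
logSeq : ℕ → ℕ → ℚ
logSeq n m = ∑ℚ (suc m ℕ.* ℕ.pred n) (λ j → 1/suc (suc m ℕ.+ j))

logSeq-step : ∀ n m → logSeq (suc n) m ℚ.+ ∑ℚ (suc n) (λ i → 1/suc (suc m ℕ.* suc n ℕ.+ i))
                    ≡ logSeq (suc n) (suc m) ℚ.+ 1/suc (suc m)
logSeq-step n m = cancel (H M)
  (trans (trans (trans (sym (ℚₚ.+-assoc (H M) (logSeq (suc n) m) _))
                  (cong (ℚ._+ rest) (sym (∑ℚ-+ M (M ℕ.* n) 1/suc_))))
          (trans (cong (λ k → H k ℚ.+ rest) (sym (ℕₚ.*-suc M n)))
            (trans (sym (∑ℚ-+ (M ℕ.* suc n) (suc n) 1/suc_))
              (cong H (trans (ℕₚ.+-comm (M ℕ.* suc n) (suc n)) (ℕₚ.*-suc (suc M) n))))))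
    (trans (∑ℚ-+ (suc M) (suc M ℕ.* n) 1/suc_)
      (S.solve 3 (λ h r l → (h S.:+ r) S.:+ l S.:= h S.:+ (l S.:+ r)) refl
        (H M) (1/suc M) (logSeq (suc n) (suc m)))))
  where
  M = suc m
  H : ℕ → ℚ
  H k = ∑ℚ k 1/suc_
  rest = ∑ℚ (suc n) (λ i → 1/suc (M ℕ.* suc n ℕ.+ i))
  cancel : ∀ h {a b} → h ℚ.+ a ≡ h ℚ.+ b → a ≡ b
  cancel h {a} {b} e = trans (S.solve 2 (λ h a → a S.:= (h S.:+ a) S.:- h) refl h a)
    (trans (cong (ℚ._- h) e) (S.solve 2 (λ h a → (h S.:+ a) S.:- h S.:= a) refl h b))

log : (n : ℕ) .{{_ : ℕ.NonZero n}} → ℝ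
log (suc n) = mkℝ (logSeq (suc n)) (squeeze _ mono step)
  where
  rest : ℕ → ℚ
  rest m = ∑ℚ (suc n) (λ i → 1/suc (suc m ℕ.* suc n ℕ.+ i))
  scale : ∀ k → (+ suc n ℚ./ 1) ℚ.* (+ 1 ℚ./ (suc k ℕ.* suc n)) ≡ 1/suc k
  scale k = /-*-/ (suc n) 1 1 (suc k ℕ.* suc n) 1 (suc k)
    (trans (cong (ℕ._* suc k) (ℕₚ.*-identityʳ (suc n)))
      (trans (ℕₚ.*-comm (suc n) (suc k))
        (sym (trans (ℕₚ.*-identityˡ _) (ℕₚ.*-identityˡ _)))))
  lower : ∀ m → 1/suc (suc m) ℚ.≤ rest m
  lower m = subst (ℚ._≤ rest m) (scale (suc m)) (const≤∑ℚ (suc n) _ _ λ i i≤n →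
    /-≤ 1 (suc (suc m) ℕ.* suc n) 1 (suc (suc m ℕ.* suc n ℕ.+ i))
      (ℕₚ.*-monoʳ-≤ 1 (subst₂ ℕ._≤_ (ℕₚ.+-suc (suc m ℕ.* suc n) i) (ℕₚ.+-comm (suc m ℕ.* suc n) (suc n))
        (ℕₚ.+-monoʳ-≤ (suc m ℕ.* suc n) i≤n))))
  upper : ∀ m → rest m ℚ.≤ 1/suc m
  upper m = subst (rest m ℚ.≤_) (scale m) (∑ℚ≤const (suc n) _ _ λ i _ →
    /-≤ 1 (suc (suc m ℕ.* suc n ℕ.+ i)) 1 (suc m ℕ.* suc n)
      (ℕₚ.*-monoʳ-≤ 1 (ℕₚ.m≤n⇒m≤1+n (ℕₚ.m≤m+n _ i))))
  diff : ∀ m → logSeq (suc n) (suc m) ℚ.- logSeq (suc n) m ≡ rest m ℚ.- 1/suc (suc m)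
  diff m = trans
    (S.solve 3 (λ a b r → a S.:- b S.:= (a S.:+ r) S.:- (b S.:+ r)) refl
      (logSeq (suc n) (suc m)) (logSeq (suc n) m) (1/suc (suc m)))
    (trans (cong (ℚ._- (logSeq (suc n) m ℚ.+ 1/suc (suc m))) (sym (logSeq-step n m)))
      (S.solve 3 (λ b t r → (b S.:+ t) S.:- (b S.:+ r) S.:= t S.:- r) refl
        (logSeq (suc n) m) (rest m) (1/suc (suc m))))
  mono : ∀ m → logSeq (suc n) m ℚ.≤ logSeq (suc n) (suc m)
  mono m = subst₂ ℚ._≤_ (ℚₚ.+-identityˡ _)
    (S.solve 2 (λ a b → (a S.:- b) S.:+ b S.:= a) refl
      (logSeq (suc n) (suc m)) (logSeq (suc n) m))
    (ℚₚ.+-monoˡ-≤ (logSeq (suc n) m) (subst (0ℚ ℚ.≤_) (sym (diff m)) (0≤q-p (lower m))))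
  step : ∀ m → logSeq (suc n) (suc m) ℚ.- logSeq (suc n) m ℚ.≤ 1/suc m ℚ.- 1/suc (suc m)
  step m = subst (ℚ._≤ _) (sym (diff m)) (ℚₚ.+-monoˡ-≤ (ℚ.- 1/suc (suc m)) (upper m))

^-nonNeg : ∀ {a} → 0ℚ ℚ.≤ a → ∀ p → 0ℚ ℚ.≤ a ^ℚ p
^-nonNeg 0≤a zero    = ℚₚ.nonNegative⁻¹ 1ℚ
^-nonNeg {a} 0≤a (suc p) = subst (ℚ._≤ a ^ℚ suc p) (ℚₚ.*-zeroˡ 0ℚ)
  (*-mono-≤-nonNeg ℚₚ.≤-refl 0≤a ℚₚ.≤-refl (^-nonNeg 0≤a p))

^-mono : ∀ {a b} → 0ℚ ℚ.≤ a → a ℚ.≤ b → ∀ p → a ^ℚ p ℚ.≤ b ^ℚ p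
^-mono 0≤a a≤b zero    = ℚₚ.≤-refl
^-mono 0≤a a≤b (suc p) = *-mono-≤-nonNeg 0≤a a≤b (^-nonNeg 0≤a p) (^-mono 0≤a a≤b p)

^-pos : ∀ {a} → 0ℚ ℚ.< a → ∀ p → 0ℚ ℚ.< a ^ℚ p
^-pos 0<a zero    = ℚₚ.positive⁻¹ 1ℚ
^-pos 0<a (suc p) = *-pos 0<a (^-pos 0<a p)

1≤^ : ∀ {t} → 1ℚ ℚ.≤ t → ∀ p → 1ℚ ℚ.≤ t ^ℚ p
1≤^ 1≤t zero    = ℚₚ.≤-refl
1≤^ {t} 1≤t (suc p) = subst (ℚ._≤ t ^ℚ suc p) (ℚₚ.*-identityˡ 1ℚ)
  (*-mono-≤-nonNeg (ℚₚ.nonNegative⁻¹ 1ℚ) 1≤t (ℚₚ.nonNegative⁻¹ 1ℚ) (1≤^ 1≤t p))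

t≤t^ : ∀ {t} → 1ℚ ℚ.≤ t → ∀ p → t ℚ.≤ t ^ℚ suc p
t≤t^ {t} 1≤t p = subst (ℚ._≤ t ^ℚ suc p) (ℚₚ.*-identityʳ t)
  (ℚₚ.*-monoˡ-≤-nonNeg t {{ℚ.nonNegative (ℚₚ.≤-trans (ℚₚ.nonNegative⁻¹ 1ℚ) 1≤t)}} (1≤^ 1≤t p))

p≤p+q : ∀ p {q} → 0ℚ ℚ.≤ q → p ℚ.≤ p ℚ.+ q
p≤p+q p 0≤q = ℚₚ.≤-trans (ℚₚ.≤-reflexive (sym (ℚₚ.+-identityʳ p))) (ℚₚ.+-monoʳ-≤ p 0≤q)

^-superadditive : ∀ {a b} → 0ℚ ℚ.≤ a → 0ℚ ℚ.≤ b → ∀ p →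
                  a ^ℚ suc p ℚ.+ b ^ℚ suc p ℚ.≤ (a ℚ.+ b) ^ℚ suc p
^-superadditive {a} {b} 0≤a 0≤b p = subst (a ^ℚ suc p ℚ.+ b ^ℚ suc p ℚ.≤_)
  (sym (ℚₚ.*-distribʳ-+ ((a ℚ.+ b) ^ℚ p) a b))
  (ℚₚ.+-mono-≤
    (*-mono-≤-nonNeg 0≤a ℚₚ.≤-refl (^-nonNeg 0≤a p) (^-mono 0≤a (p≤p+q a 0≤b) p))
    (*-mono-≤-nonNeg 0≤b ℚₚ.≤-refl (^-nonNeg 0≤b p)
      (^-mono 0≤b (subst (b ℚ.≤_) (ℚₚ.+-comm b a) (p≤p+q b 0≤a)) p)))

-- The largest j ≤ b with P j, or 0 if there is none.
largest : {P : ℕ → Set} → (∀ j → Dec (P j)) → ℕ → ℕ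
largest P? zero = 0
largest P? (suc b) with P? (suc b)
... | yes _ = suc b
... | no _  = largest P? b

largest-holds : ∀ {P : ℕ → Set} (P? : ∀ j → Dec (P j)) b → largest P? b ≡ 0 ⊎ P (largest P? b)
largest-holds P? zero = inj₁ refl
largest-holds P? (suc b) with P? (suc b)
... | yes p = inj₂ p
... | no _  = largest-holds P? b

largest-fails : ∀ {P : ℕ → Set} (P? : ∀ j → Dec (P j)) b → ¬ P (suc b) → ¬ P (suc (largest P? b))
largest-fails P? zero    ¬p = ¬p
largest-fails P? (suc b) ¬p with P? (suc b)
... | yes _ = ¬p
... | no ¬q = largest-fails P? b ¬q

below? : ∀ q a k j → Dec ((+ j ℚ./ suc k) ^ℚ q ℚ.≤ a)
below? q a k j = (+ j ℚ./ suc k) ^ℚ q ℚₚ.≤? a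

searchBound : ℚ → ℕ → ℕ
searchBound a k = suc ℤ.∣ ℚ.↥ a ∣ ℕ.* suc k

-- The largest multiple of 1/(k + 1) whose q-th power is at most a (searchBound exceeds
-- every such numerator); 0 if a < 0.
rootApprox : ℕ → ℚ → ℕ → ℚ
rootApprox q a k = + largest (below? q a k) (searchBound a k) ℚ./ suc k

module RootCauchy (p : ℕ) where

  record Approx (a : ℚ) (k : ℕ) (u : ℚ) : Set where
    field
      nonNeg : 0ℚ ℚ.≤ u
      lower  : 0ℚ ℚ.< u → u ^ℚ suc p ℚ.≤ a
      upper  : a ℚ.< (u ℚ.+ 1/suc k) ^ℚ suc p
  open Approx

  <1+∣↥∣ : ∀ a → a ℚ.< + suc ℤ.∣ ℚ.↥ a ∣ ℚ./ 1
  <1+∣↥∣ a = ℚₚ.toℚᵘ-cancel-<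
    (ℚᵘₚ.<-respʳ-≃ (ℚᵘₚ.≃-sym (ℚₚ.toℚᵘ-fromℚᵘ (ℚᵘ.mkℚᵘ (+ suc ℤ.∣ ℚ.↥ a ∣) 0))) (lemma a))
    where
    lemma : ∀ a → ℚ.toℚᵘ a ℚᵘ.< ℚᵘ.mkℚᵘ (+ suc ℤ.∣ ℚ.↥ a ∣) 0
    lemma (ℚ.mkℚ (+ n) d _) = ℚᵘ.*<* (subst (ℤ._< + suc n ℤ.* + suc d) (sym (ℤₚ.*-identityʳ (+ n)))
      (ℤ.+<+ (ℕₚ.m≤m*n (suc n) (suc d))))
    lemma (ℚ.mkℚ ℤ.-[1+ n ] d _) = ℚᵘ.*<* ℤ.-<+

  -- t stands for (searchBound a k + 1) / (k + 1)
  above : ∀ {a b t} → a ℚ.< b → 1ℚ ℚ.≤ b → b ℚ.≤ t → ¬ (t ^ℚ suc p ℚ.≤ a)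
  above a<b 1≤b b≤t t^≤a = ℚₚ.<-irrefl refl (ℚₚ.<-≤-trans a<b
    (ℚₚ.≤-trans b≤t (ℚₚ.≤-trans (t≤t^ (ℚₚ.≤-trans 1≤b b≤t) p) t^≤a)))

  fromNumerator : ∀ a k j → j ≡ 0 ⊎ (+ j ℚ./ suc k) ^ℚ suc p ℚ.≤ a →
                  ¬ ((+ suc j ℚ./ suc k) ^ℚ suc p ℚ.≤ a) → Approx a k (+ j ℚ./ suc k)
  fromNumerator a k j holds fails = record
    { nonNeg = ℚₚ.nonNegative⁻¹ (+ j ℚ./ suc k) {{ℚₚ.normalize-nonNeg j (suc k)}}
    ; lower  = low holds
    ; upper  = subst (λ t → a ℚ.< t ^ℚ suc p)
                 (trans (cong (λ i → + i ℚ./ suc k) (ℕₚ.+-comm 1 j)) (sym (/-+-/ j 1 (suc k))))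
                 (ℚₚ.≰⇒> fails)
    }
    where
    low : ∀ {j} → j ≡ 0 ⊎ (+ j ℚ./ suc k) ^ℚ suc p ℚ.≤ a →
          0ℚ ℚ.< + j ℚ./ suc k → (+ j ℚ./ suc k) ^ℚ suc p ℚ.≤ a
    low (inj₂ h)    _  = h
    low (inj₁ refl) 0< = ⊥-elim (ℚₚ.<-irrefl (sym (ℚₚ.0/n≡0 (suc k))) 0<)

  approx : ∀ a k → Approx a k (rootApprox (suc p) a k)
  approx a k = fromNumerator a k (largest P? (searchBound a k))
    (largest-holds P? (searchBound a k))
    (largest-fails P? (searchBound a k) (above (<1+∣↥∣ a) 1≤n n≤t))
    where
    P? = below? (suc p) a k
    n = suc ℤ.∣ ℚ.↥ a ∣
    1≤n : 1ℚ ℚ.≤ + n ℚ./ 1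
    1≤n = /-≤ 1 1 n 1 (ℕₚ.*-monoˡ-≤ 1 {1} {n} (ℕ.s≤s ℕ.z≤n))
    n≤t : + n ℚ./ 1 ℚ.≤ + suc (searchBound a k) ℚ./ suc k
    n≤t = /-≤ n 1 (suc (searchBound a k)) (suc k)
            (ℕₚ.≤-trans (ℕₚ.n≤1+n (searchBound a k))
              (ℕₚ.≤-reflexive (sym (ℕₚ.*-identityʳ (suc (searchBound a k))))))

  gap : ∀ {ε a b k l u v} → Approx a k u → Approx b l v → 0ℚ ℚ.< ε → 1/suc l ℚ.≤ ½ ℚ.* ε →
        ℚ.∣ a ℚ.- b ∣ ℚ.< (½ ℚ.* ε) ^ℚ suc p → u ℚ.- v ℚ.< ε
  gap {ε} {a} {b} {k} {l} {u} {v} A B 0<ε l≤ ab< = ℚₚ.≰⇒> λ ε≤u-v →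
    ℚₚ.<-irrefl refl (ℚₚ.<-trans (η^<a-b ε≤u-v) (ℚₚ.≤-<-trans (p≤∣p∣ (a ℚ.- b)) ab<))
    where
    η = ½ ℚ.* ε
    0≤η : 0ℚ ℚ.≤ η
    0≤η = ℚₚ.<⇒≤ (half-pos 0<ε)
    0≤v+η : 0ℚ ℚ.≤ v ℚ.+ η
    0≤v+η = ℚₚ.≤-trans (nonNeg B) (p≤p+q v 0≤η)
    b< : b ℚ.< (v ℚ.+ η) ^ℚ suc p
    b< = ℚₚ.<-≤-trans (upper B)
      (^-mono (ℚₚ.≤-trans (nonNeg B) (p≤p+q v (ℚₚ.<⇒≤ (1/suc-pos l)))) (ℚₚ.+-monoʳ-≤ v l≤) (suc p))
    v+ε≤u : ε ℚ.≤ u ℚ.- v → v ℚ.+ ε ℚ.≤ u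
    v+ε≤u ε≤u-v = subst (v ℚ.+ ε ℚ.≤_) (S.solve 2 (λ u v → v S.:+ (u S.:- v) S.:= u) refl u v)
                    (ℚₚ.+-monoʳ-≤ v ε≤u-v)
    0<u : v ℚ.+ ε ℚ.≤ u → 0ℚ ℚ.< u
    0<u le = ℚₚ.<-≤-trans 0<ε
      (ℚₚ.≤-trans (subst (ε ℚ.≤_) (ℚₚ.+-comm ε v) (p≤p+q ε (nonNeg B))) le)
    ≤a : v ℚ.+ ε ℚ.≤ u → (v ℚ.+ η) ^ℚ suc p ℚ.+ η ^ℚ suc p ℚ.≤ a
    ≤a le = ℚₚ.≤-trans (^-superadditive 0≤v+η 0≤η p)
      (ℚₚ.≤-trans (^-mono (ℚₚ.≤-trans 0≤v+η (p≤p+q (v ℚ.+ η) 0≤η))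
                    (subst (ℚ._≤ u) (trans (cong (v ℚ.+_) (sym (halves ε)))
                                           (sym (ℚₚ.+-assoc v η η))) le) (suc p))
                  (lower A (0<u le)))
    η^<a-b : ε ℚ.≤ u ℚ.- v → η ^ℚ suc p ℚ.< a ℚ.- b
    η^<a-b ε≤u-v = subst (ℚ._< a ℚ.- b)
      (S.solve 2 (λ b e → (b S.:+ e) S.:- b S.:= e) refl b (η ^ℚ suc p))
      (ℚₚ.+-monoˡ-< (ℚ.- b)
        (ℚₚ.<-≤-trans (ℚₚ.+-monoˡ-< (η ^ℚ suc p) b<) (≤a (v+ε≤u ε≤u-v))))

  approx-cauchy : ∀ x (u : ℕ → ℚ) → (∀ k → Approx (seq x k) k (u k)) → IsCauchy u
  approx-cauchy x u A ε 0<ε =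
    let (N , h) = cauchy x ((½ ℚ.* ε) ^ℚ suc p) (^-pos (half-pos 0<ε) (suc p))
        (M , M<) = archimedean (½ ℚ.* ε) (half-pos 0<ε)
        near = λ {m} (N+M≤m : N ℕ.+ M ℕ.≤ m) →
          ℚₚ.≤-trans (1/suc-antitone (ℕₚ.m+n≤o⇒n≤o N N+M≤m)) (ℚₚ.<⇒≤ M<)
    in N ℕ.+ M , λ m n N+M≤m N+M≤n →
      let N≤m = ℕₚ.m+n≤o⇒m≤o N N+M≤m ; N≤n = ℕₚ.m+n≤o⇒m≤o N N+M≤n in
      ∣-∣-< (gap (A m) (A n) 0<ε (near N+M≤n) (h m n N≤m N≤n))
        (subst (ℚ._< ε) (S.solve 2 (λ u v → v S.:- u S.:= S.:- (u S.:- v)) refl (u m) (u n))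
          (gap (A n) (A m) 0<ε (near N+M≤m) (h n m N≤n N≤m)))

root : (q : ℕ) .{{_ : ℕ.NonZero q}} → ℝ → ℝ
root (suc p) x = mkℝ (λ k → rootApprox (suc p) (seq x k) k)
  (RootCauchy.approx-cauchy p x _ λ k → RootCauchy.approx p (seq x k) k)

-- The real power x^(p/q) for x ≥ 0; the q-th root of a negative real is 0 here.
_^[_∕_] : ℝ → ℕ → (q : ℕ) .{{_ : ℕ.NonZero q}} → ℝ
x ^[ p ∕ q ] = root q (x ^ p)

-- g(n)/h(n) → 1; part of the claim is that h(n) ≠ 0 (so that the quotient exists)
-- for all large n.
_∼_ : (ℕ → ℝ) → (ℕ → ℝ) → Set
g ∼ h = ∀ ε → 0ℚ ℚ.< ε → ∃[ N ] (∀ n → N ℕ.≤ n →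
  Σ[ h≉0 ∈ Apart0 (h n) ] ∣ g n ÷ h n [ h≉0 ] - fromℚ 1ℚ ∣ < fromℚ ε)

{-# OPTIONS --safe #-}

-- Plane partitions of n correspond to matrices a of natural numbers with Σ (i + j + 1) a i j = n: the
-- diagonals of a plane partition form an interlacing path of partitions, and reflecting one partition at a
-- time in the interval allowed by its neighbours peels off the matrix entries (MacMahon's formula).
-- Logarithmic differentiation of ∏ (1 - x^d)^(-d) then gives
--     n PL(n) = Σ_{m, d ≥ 1} d² PL(n - m d).
-- If PL(k) grows locally like ((N + 1) / N)^k, the right-hand side is about Σ_m 2 (N / m)³ PL(n) = 2 ζ(3) N³ PL(n),
-- so the recurrence propagates the growth rate (N + 1) / N near n = 2 ζ(3) N³.  Inductions on N turn this into
--     log PL(n) = n / N + ζ(3) N² + O(N) = 3 ζ(3) N² + O(N),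
-- an upper bound for every N and a lower bound for n near 2 ζ(3) N³, and (3 ζ(3) N²)³ is (27/4) ζ(3) n².
module Submission where

-- Passing from rate (N + 1) / N to (N + 2) / (N + 1) multiplies the constant in front by (1 + 1 /
-- (N (N + 2)))^s with s near 2 ζ(3) N³: up to s the old bound is inherited, past s the recurrence
-- takes over. The logarithms 2 ζ(3) N + O(1) of these factors add up to ζ(3) N² + O(N), which is
-- why the errors in the threshold must stay O(N²). The two directions are not symmetric. The upper
-- bound sums over all m and admits any rational Z above the partial sums of ζ(3). The lower bound
-- keeps finitely many m and d, so there Z is a partial sum with K terms, the recurrence reads back
-- a window of about K N² arguments, and the constant improves only by giving up the arguments below
-- the window. Since ζ(3) and log are Cauchy sequences and cube roots are rounded, all inductions
-- run in ℚ: logarithms are taken of explicit fractions, Z is rational, and cube roots are compared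
-- by cubing. At the end the two values of Z are brought within a small factor of each other.

-- Finite sums of natural numbers and summation by parts.

module Sums where
  open import Data.Nat using (ℕ; zero; suc; _+_; _*_; _≤_; _<_)
  open import Data.Nat.Properties
  open import Data.Nat.Solver using (module +-*-Solver)
  open import Function using (_∘_)
  open import Relation.Binary.PropositionalEquality
  open import Defs using (∑ℕ; ∑ℕ-cong; ∑ℕ-zero)
  open +-*-Solver using (solve; _:+_; _:*_; _:=_; con)

  +-interchange : ∀ a b c d → (a + b) + (c + d) ≡ (a + c) + (b + d)
  +-interchange = solve 4 (λ a b c d → (a :+ b) :+ (c :+ d) := (a :+ c) :+ (b :+ d)) refl

  ∑-cong< : ∀ m {f g} → (∀ i → i < m → f i ≡ g i) → ∑ℕ m f ≡ ∑ℕ m g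
  ∑-cong< zero    h = refl
  ∑-cong< (suc m) h = cong₂ _+_ (∑-cong< m (λ i i<m → h i (m<n⇒m<1+n i<m))) (h m ≤-refl)

  ∑-zero< : ∀ m {f} → (∀ i → i < m → f i ≡ 0) → ∑ℕ m f ≡ 0
  ∑-zero< m h = trans (∑-cong< m h) (∑ℕ-zero m (λ _ → refl))

  ∑-front : ∀ m f → ∑ℕ (suc m) f ≡ f 0 + ∑ℕ m (f ∘ suc)
  ∑-front zero    f = +-comm 0 (f 0)
  ∑-front (suc m) f = trans (cong (_+ f (suc m)) (∑-front m f)) (+-assoc (f 0) _ _)

  ∑-distrib-+ : ∀ m f g → ∑ℕ m (λ i → f i + g i) ≡ ∑ℕ m f + ∑ℕ m g
  ∑-distrib-+ zero    f g = refl
  ∑-distrib-+ (suc m) f g = trans (cong (_+ (f m + g m)) (∑-distrib-+ m f g))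
    (+-interchange (∑ℕ m f) (∑ℕ m g) (f m) (g m))

  ∑-distribˡ-* : ∀ m c f → ∑ℕ m (λ i → c * f i) ≡ c * ∑ℕ m f
  ∑-distribˡ-* zero    c f = sym (*-zeroʳ c)
  ∑-distribˡ-* (suc m) c f = trans (cong (_+ c * f m) (∑-distribˡ-* m c f))
    (sym (*-distribˡ-+ c (∑ℕ m f) (f m)))

  ∑-swap : ∀ m n (f : ℕ → ℕ → ℕ) → ∑ℕ m (λ i → ∑ℕ n (f i)) ≡ ∑ℕ n (λ j → ∑ℕ m (λ i → f i j))
  ∑-swap zero    n f = sym (∑ℕ-zero n (λ _ → refl))
  ∑-swap (suc m) n f = trans (cong (_+ ∑ℕ n (f m)) (∑-swap m n f))
    (sym (∑-distrib-+ n (λ j → ∑ℕ m (λ i → f i j)) (f m)))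

  ∑-++ : ∀ a b f → ∑ℕ (a + b) f ≡ ∑ℕ a f + ∑ℕ b (λ i → f (a + i))
  ∑-++ a zero    f = trans (cong (λ k → ∑ℕ k f) (+-identityʳ a)) (sym (+-identityʳ _))
  ∑-++ a (suc b) f = trans (cong (λ k → ∑ℕ k f) (+-suc a b))
    (trans (cong (_+ f (a + b)) (∑-++ a b f)) (+-assoc (∑ℕ a f) _ _))

  -- Summation by parts without subtraction: the decrement `c i` is contained in each of `t 0`, ...,
  -- `t i`, hence is counted `suc i` times.
  abel : ∀ n (t c : ℕ → ℕ) → (∀ i → i < n → t i ≡ t (suc i) + c i) →
         ∑ℕ n t ≡ ∑ℕ n (λ i → suc i * c i) + n * t n
  abel zero    t c h = refl
  abel (suc n) t c h = trans
    (cong (_+ t n) (abel n t c (λ i i<n → h i (m<n⇒m<1+n i<n))))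
    (trans (cong (λ u → ∑ℕ n (λ i → suc i * c i) + n * u + u) (h n ≤-refl))
      (solve 4 (λ s n u c → s :+ n :* (u :+ c) :+ (u :+ c)
                         := (s :+ (con 1 :+ n) :* c) :+ (con 1 :+ n) :* u) refl
        (∑ℕ n (λ i → suc i * c i)) n (t (suc n)) (c n)))

  abel₀ : ∀ n (t c : ℕ → ℕ) → (∀ i → i < n → t i ≡ t (suc i) + c i) → t n ≡ 0 →
          ∑ℕ n t ≡ ∑ℕ n (λ i → suc i * c i)
  abel₀ n t c h tn = trans (abel n t c h)
    (trans (cong (λ u → ∑ℕ n (λ i → suc i * c i) + n * u) tn)
      (trans (cong (∑ℕ n (λ i → suc i * c i) +_) (*-zeroʳ n)) (+-identityʳ _)))

  telescope : ∀ n (t c : ℕ → ℕ) → (∀ i → i < n → t i ≡ t (suc i) + c i) → t 0 ≡ ∑ℕ n c + t n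
  telescope zero    t c h = refl
  telescope (suc n) t c h = trans (telescope n t c (λ i i<n → h i (m<n⇒m<1+n i<n)))
    (trans (cong (∑ℕ n c +_) (trans (h n ≤-refl) (+-comm (t (suc n)) (c n))))
      (sym (+-assoc (∑ℕ n c) (c n) (t (suc n)))))

  -- A sum `d` has `suc d` decompositions. The row sums drop by `h i` from one row to the next,
  -- because `h` vanishes from `n` on, so summation by parts applies.
  ∑-antidiagonal : ∀ n (h : ℕ → ℕ) → (∀ d → n ≤ d → h d ≡ 0) →
                   ∑ℕ n (λ i → ∑ℕ n (λ j → h (i + j))) ≡ ∑ℕ n (λ d → suc d * h d)
  ∑-antidiagonal n h h0 = abel₀ n (λ i → ∑ℕ n (λ j → h (i + j))) h
    (λ i _ → trans (sym (trans (cong (∑ℕ n (λ j → h (i + j)) +_) (h0 (i + n) (m≤n+m n i))) (+-identityʳ _)))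
      (trans (∑-front n (λ j → h (i + j)))
        (trans (cong₂ _+_ (cong h (+-identityʳ i)) (∑ℕ-cong n (λ j → cong h (+-suc i j))))
          (+-comm (h i) _))))
    (∑-zero< n (λ j _ → h0 (n + j) (m≤m+n n j)))

  ∑-block : ∀ m n f → ∑ℕ (m * n) f ≡ ∑ℕ m (λ i → ∑ℕ n (λ j → f (i * n + j)))
  ∑-block zero    n f = refl
  ∑-block (suc m) n f = trans (cong (λ k → ∑ℕ k f) (+-comm n (m * n)))
    (trans (∑-++ (m * n) n f) (cong (_+ ∑ℕ n (λ j → f (m * n + j))) (∑-block m n f)))

-- Generating functions and the logarithmic derivative of a product.

-- Generating functions are sequences ℕ → ℕ; shift k f is multiplication by x^k.
module Shift where
  open import Data.Nat using (ℕ; zero; suc; _+_; _*_; _∸_; _≤_; _<_; s≤s)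
  open import Data.Nat.Properties
  open import Data.Nat.Solver using (module +-*-Solver)
  open import Relation.Binary.PropositionalEquality
  open import Defs using (∑ℕ; ∑ℕ-cong; ∑ℕ-zero)
  open +-*-Solver using (solve; _:+_; _:*_; _:=_)
  open Sums

  shift : ℕ → (ℕ → ℕ) → ℕ → ℕ
  shift zero    f n       = f n
  shift (suc k) f zero    = 0
  shift (suc k) f (suc n) = shift k f n

  shift-shift : ∀ j k f n → shift j (shift k f) n ≡ shift (j + k) f n
  shift-shift zero    k f n       = refl
  shift-shift (suc j) k f zero    = refl
  shift-shift (suc j) k f (suc n) = shift-shift j k f n

  shift-> : ∀ k f n → n < k → shift k f n ≡ 0
  shift-> (suc k) f zero    _         = refl
  shift-> (suc k) f (suc n) (s≤s n<k) = shift-> k f n n<k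

  shift-≤ : ∀ k f n → k ≤ n → shift k f n ≡ f (n ∸ k)
  shift-≤ zero    f n       _         = refl
  shift-≤ (suc k) f (suc n) (s≤s k≤n) = shift-≤ k f n k≤n

  shift-∑ : ∀ k m (f : ℕ → ℕ → ℕ) n →
            shift k (λ n → ∑ℕ m (λ i → f i n)) n ≡ ∑ℕ m (λ i → shift k (f i) n)
  shift-∑ zero    m f n       = refl
  shift-∑ (suc k) m f zero    = sym (∑ℕ-zero m (λ _ → refl))
  shift-∑ (suc k) m f (suc n) = shift-∑ k m f n

  shift-* : ∀ k c f n → shift k (λ n → c * f n) n ≡ c * shift k f n
  shift-* zero    c f n       = refl
  shift-* (suc k) c f zero    = sym (*-zeroʳ c)
  shift-* (suc k) c f (suc n) = shift-* k c f n

  shift-cong : ∀ k {f g} n → (∀ m → m ≤ n → f m ≡ g m) → shift k f n ≡ shift k g n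
  shift-cong zero    n       h = h n ≤-refl
  shift-cong (suc k) zero    h = refl
  shift-cong (suc k) (suc n) h = shift-cong k n (λ m m≤n → h m (m≤n⇒m≤1+n m≤n))

  -- The product rule for the derivation n ↦ n * f n.
  shift-weighted : ∀ k f n → n * shift k f n ≡ shift k (λ n → n * f n) n + k * shift k f n
  shift-weighted zero    f n       = sym (+-identityʳ _)
  shift-weighted (suc k) f zero    = sym (*-zeroʳ k)
  shift-weighted (suc k) f (suc n) = trans (cong (shift k f n +_) (shift-weighted k f n))
    (solve 3 (λ s t u → s :+ (t :+ u) := t :+ (s :+ u)) refl (shift k f n) _ (k * shift k f n))

  -- Coefficients below x^B of ∏_{l<L} (1 - x^(w l))⁻¹.
  partsCount : (ℕ → ℕ) → ℕ → ℕ → ℕ → ℕ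
  partsCount w B zero    zero    = 1
  partsCount w B zero    (suc n) = 0
  partsCount w B (suc L) n       = ∑ℕ B (λ j → shift (j * w L) (partsCount w B L) n)

  -- Logarithmic differentiation of the product.
  partsCount-recurrence : ∀ w B → (∀ l → 1 ≤ w l) → ∀ L n → n < B →
    n * partsCount w B L n ≡
    ∑ℕ L (λ l → w l * ∑ℕ B (λ m → shift (suc m * w l) (partsCount w B L) n))
  partsCount-recurrence w B 1≤w zero    zero    n<B = refl
  partsCount-recurrence w B 1≤w zero    (suc n) n<B = *-zeroʳ n
  partsCount-recurrence w B 1≤w (suc L) n       n<B = begin
    n * ∑ℕ B (λ j → shift (j * u) F n)
      ≡⟨ sym (∑-distribˡ-* B n _) ⟩
    ∑ℕ B (λ j → n * shift (j * u) F n)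
      ≡⟨ ∑ℕ-cong B (λ j → shift-weighted (j * u) F n) ⟩
    ∑ℕ B (λ j → shift (j * u) (λ n → n * F n) n + j * u * shift (j * u) F n)
      ≡⟨ ∑-distrib-+ B _ _ ⟩
    ∑ℕ B (λ j → shift (j * u) (λ n → n * F n) n) + ∑ℕ B (λ j → j * u * shift (j * u) F n)
      ≡⟨ cong₂ _+_ old new ⟩
    _ ∎
    where
    open ≡-Reasoning
    u = w L
    F = partsCount w B L
    G = partsCount w B (suc L)

    -- Multiplication by `x^k` commutes with the geometric series that turns `F` into `G`.
    commute : ∀ k → ∑ℕ B (λ j → shift (j * u) (shift k F) n) ≡ shift k G n
    commute k = trans
      (∑ℕ-cong B (λ j → trans (shift-shift (j * u) k F n)
        (trans (cong (λ i → shift i F n) (+-comm (j * u) k)) (sym (shift-shift k (j * u) F n)))))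
      (sym (shift-∑ k B (λ j → shift (j * u) F) n))

    -- The derivation falls on `F`: the induction hypothesis applies, and `commute` turns every `F`
    -- into `G`.
    old : ∑ℕ B (λ j → shift (j * u) (λ n → n * F n) n) ≡
          ∑ℕ L (λ l → w l * ∑ℕ B (λ m → shift (suc m * w l) G n))
    old = begin
      ∑ℕ B (λ j → shift (j * u) (λ n → n * F n) n)
        ≡⟨ ∑ℕ-cong B (λ j → trans
             (shift-cong (j * u) n (λ m m≤n → partsCount-recurrence w B 1≤w L m (≤-<-trans m≤n n<B)))
             (trans (shift-∑ (j * u) L _ n)
               (∑ℕ-cong L (λ l → trans (shift-* (j * u) (w l) _ n)
                 (cong (w l *_) (shift-∑ (j * u) B _ n)))))) ⟩
      ∑ℕ B (λ j → ∑ℕ L (λ l → w l * ∑ℕ B (λ m → shift (j * u) (shift (suc m * w l) F) n)))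
        ≡⟨ ∑-swap B L _ ⟩
      ∑ℕ L (λ l → ∑ℕ B (λ j → w l * ∑ℕ B (λ m → shift (j * u) (shift (suc m * w l) F) n)))
        ≡⟨ ∑ℕ-cong L (λ l → trans (∑-distribˡ-* B (w l) _)
             (cong (w l *_) (trans (∑-swap B B _) (∑ℕ-cong B (λ m → commute (suc m * w l)))))) ⟩
      ∑ℕ L (λ l → w l * ∑ℕ B (λ m → shift (suc m * w l) G n)) ∎

    g : ℕ → ℕ
    g k = shift (k * u) F n
    -- Cutting the geometric series at `B` loses nothing below `x^B`, since its exponents `k * u`
    -- are at least `k`.
    g0 : ∀ k → B ≤ k → g k ≡ 0
    g0 k B≤k = shift-> (k * u) F n (<-≤-trans n<B
      (≤-trans B≤k (≤-trans (≤-reflexive (sym (*-identityʳ k))) (*-monoʳ-≤ k (1≤w L)))))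

    t : ℕ → ℕ
    t i = ∑ℕ B (λ j → g (suc i + j))
    t-step : ∀ i → t i ≡ t (suc i) + g (suc i)
    t-step i = trans (sym (trans (cong (t i +_) (g0 (suc i + B) (m≤n+m B (suc i)))) (+-identityʳ _)))
      (trans (∑-front B (λ j → g (suc i + j)))
        (trans (cong₂ _+_ (cong g (+-identityʳ (suc i))) (∑ℕ-cong B (λ j → cong g (+-suc (suc i) j))))
          (+-comm (g (suc i)) _)))

    -- The derivation falls on the geometric series: `∑ j u x^(j u)` is `u ∑ x^((m + 1) u)` times
    -- the series itself, by summation by parts.
    new : ∑ℕ B (λ j → j * u * shift (j * u) F n) ≡ u * ∑ℕ B (λ m → shift (suc m * u) G n)
    new = begin
      ∑ℕ B (λ j → j * u * g j)
        ≡⟨ ∑ℕ-cong B (λ j → solve 3 (λ j u g → j :* u :* g := u :* (j :* g)) refl j u (g j)) ⟩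
      ∑ℕ B (λ j → u * (j * g j))
        ≡⟨ ∑-distribˡ-* B u _ ⟩
      u * ∑ℕ B (λ j → j * g j)
        ≡⟨ cong (u *_) (trans
             (sym (trans (cong (λ v → ∑ℕ B (λ j → j * g j) + B * v) (g0 B ≤-refl))
               (trans (cong (∑ℕ B (λ j → j * g j) +_) (*-zeroʳ B)) (+-identityʳ _))))
             (∑-front B (λ j → j * g j))) ⟩
      u * ∑ℕ B (λ i → suc i * g (suc i))
        ≡⟨ cong (u *_) (sym (abel₀ B t (λ i → g (suc i)) (λ i _ → t-step i)
             (∑-zero< B (λ j _ → g0 (suc B + j) (≤-trans (n≤1+n B) (m≤m+n (suc B) j)))))) ⟩
      u * ∑ℕ B t
        ≡⟨ cong (u *_) (∑ℕ-cong B (λ i → trans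
             (∑ℕ-cong B (λ j → trans (cong (λ k → shift k F n)
                 (trans (*-distribʳ-+ u (suc i) j) (+-comm (suc i * u) (j * u))))
               (sym (shift-shift (j * u) (suc i * u) F n))))
             (commute (suc i * u)))) ⟩
      u * ∑ℕ B (λ m → shift (suc m * u) G n) ∎

-- Interlacing partitions, local reflections and the matrix of a plane partition.

module Toggle where
  open import Data.Nat using (ℕ; zero; suc; _+_; _*_; _∸_; _≤_; _<_; z≤n; s≤s; _⊔_; _⊓_)
  open import Data.Nat.Properties
  open import Data.Nat.Solver using (module +-*-Solver)
  open import Data.Product using (_×_; _,_; proj₁; proj₂)
  open import Data.Sum using (inj₁; inj₂)
  open import Function using (_∘_)
  open import Relation.Binary.PropositionalEquality hiding (J)
  open import Defs using (∑ℕ; ∑ℕ-cong; ∑ℕ-zero; boxSum; module Enumerate)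
  open Enumerate using (Supported)
  open Supported
  open +-*-Solver using (solve; _:+_; _:*_; _:=_; con)
  open Sums

  infix 4 _≺_
  -- Interlacing: the skew shape between `κ` and `μ` is a horizontal strip. Neighbouring diagonals
  -- of a plane partition are related in this way.
  _≺_ : (ℕ → ℕ) → (ℕ → ℕ) → Set
  κ ≺ μ = (∀ k → κ k ≤ μ k) × (∀ k → μ (suc k) ≤ κ k)

  ⊓+⊔ : ∀ m n → m ⊓ n + (m ⊔ n) ≡ m + n
  ⊓+⊔ m n with ≤-total m n
  ... | inj₁ m≤n = cong₂ _+_ (m≤n⇒m⊓n≡m m≤n) (m≤n⇒m⊔n≡n m≤n)
  ... | inj₂ n≤m = trans (cong₂ _+_ (m≥n⇒m⊓n≡n n≤m) (m≥n⇒m⊔n≡m n≤m)) (+-comm n m)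

  window : (A B : ℕ → ℕ) → ℕ → ℕ
  window A B k = A k ⊓ B k + (A (suc k) ⊔ B (suc k))

  -- The entries μ (k + 1) above A, B and κ k below them range over the same
  -- interval [max (A (k+1)) (B (k+1)), min (A k) (B k)], which is reflected.
  down : (A B μ : ℕ → ℕ) → ℕ → ℕ
  down A B μ k = window A B k ∸ μ (suc k)

  -- The inverse local rule. The first part is bounded by its neighbours from below only, so it is
  -- not reflected: its excess `e` over them is free, and this is the number that gets peeled off.
  up : (A B κ : ℕ → ℕ) → ℕ → ℕ → ℕ
  up A B κ e zero    = A 0 ⊔ B 0 + e
  up A B κ e (suc k) = window A B k ∸ κ k

  reflect-≤ : ∀ {p q m} → q ≤ m → p + q ∸ m ≤ p
  reflect-≤ {p} {q} {m} q≤m = m≤n+o⇒m∸n≤o _ m (≤-trans (+-monoʳ-≤ p q≤m) (≤-reflexive (+-comm p m)))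

  ≤-reflect : ∀ {p q m} → m ≤ p → q ≤ p + q ∸ m
  ≤-reflect {p} {q} {m} m≤p = m+n≤o⇒m≤o∸n q
    (≤-trans (+-monoʳ-≤ q m≤p) (≤-reflexive (+-comm q p)))

  module _ {A B μ : ℕ → ℕ} (A≺μ : A ≺ μ) (B≺μ : B ≺ μ) where
    private
      above : ∀ k → μ (suc k) ≤ A k ⊓ B k
      above k = ⊓-glb (proj₂ A≺μ k) (proj₂ B≺μ k)
      below′ : ∀ k → A (suc k) ⊔ B (suc k) ≤ μ (suc k)
      below′ k = ⊔-lub (proj₁ A≺μ (suc k)) (proj₁ B≺μ (suc k))

    down-≺ˡ : down A B μ ≺ A
    down-≺ˡ = (λ k → ≤-trans (reflect-≤ (below′ k)) (m⊓n≤m _ _))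
            , (λ k → ≤-trans (m≤m⊔n _ _) (≤-reflect (above k)))

    down-≺ʳ : down A B μ ≺ B
    down-≺ʳ = (λ k → ≤-trans (reflect-≤ (below′ k)) (m⊓n≤n _ _))
            , (λ k → ≤-trans (m≤n⊔m _ _) (≤-reflect (above k)))

    down-+ : ∀ k → down A B μ k + μ (suc k) ≡ window A B k
    down-+ k = m∸n+n≡m (≤-trans (above k) (m≤m+n _ _))

    up-down : ∀ k → up A B (down A B μ) (μ 0 ∸ (A 0 ⊔ B 0)) k ≡ μ k
    up-down zero    = m+[n∸m]≡n (⊔-lub (proj₁ A≺μ 0) (proj₁ B≺μ 0))
    up-down (suc k) = m∸[m∸n]≡n (≤-trans (above k) (m≤m+n _ _))

    -- Reflection keeps `κ k + μ (k + 1)` equal to a minimum at `k` plus a maximum at `k + 1`. In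
    -- the sum, minima and maxima recombine to `A k + B k`; the missing maximum at `0` is `μ 0` less
    -- the excess, and `μ n ≡ 0` closes the other end.
    down-sum : ∀ n → μ n ≡ 0 →
      ∑ℕ n μ + ∑ℕ n (down A B μ) ≡ ∑ℕ n A + ∑ℕ n B + (μ 0 ∸ (A 0 ⊔ B 0))
    down-sum n μn = begin
      ∑ℕ n μ + ∑ℕ n κ
        ≡⟨ cong (_+ ∑ℕ n κ) (rotate μ μn) ⟩
      (μ 0 + ∑ℕ n (μ ∘ suc)) + ∑ℕ n κ
        ≡⟨ solve 3 (λ m s d → (m :+ s) :+ d := (d :+ s) :+ m) refl (μ 0) _ (∑ℕ n κ) ⟩
      (∑ℕ n κ + ∑ℕ n (μ ∘ suc)) + μ 0
        ≡⟨ cong₂ _+_ (trans (sym (∑-distrib-+ n κ (μ ∘ suc))) (trans (∑ℕ-cong n down-+) (∑-distrib-+ n _ _)))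
                     (sym (m+[n∸m]≡n (⊔-lub (proj₁ A≺μ 0) (proj₁ B≺μ 0)))) ⟩
      (∑ℕ n mn + ∑ℕ n (mx ∘ suc)) + (mx 0 + e)
        ≡⟨ solve 4 (λ a b c d → (a :+ b) :+ (c :+ d) := a :+ (c :+ b) :+ d) refl (∑ℕ n mn) _ (mx 0) e ⟩
      ∑ℕ n mn + (mx 0 + ∑ℕ n (mx ∘ suc)) + e
        ≡⟨ cong (λ s → ∑ℕ n mn + s + e) (sym (rotate mx mxn)) ⟩
      ∑ℕ n mn + ∑ℕ n mx + e
        ≡⟨ cong (_+ e) (trans (sym (∑-distrib-+ n mn mx))
             (trans (∑ℕ-cong n (λ k → ⊓+⊔ (A k) (B k))) (∑-distrib-+ n A B))) ⟩
      ∑ℕ n A + ∑ℕ n B + e ∎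
      where
      open ≡-Reasoning
      κ mn mx : ℕ → ℕ
      κ = down A B μ
      mn k = A k ⊓ B k
      mx k = A k ⊔ B k
      e = μ 0 ∸ (A 0 ⊔ B 0)
      mxn : mx n ≡ 0
      mxn = n≤0⇒n≡0 (≤-trans (⊔-lub (proj₁ A≺μ n) (proj₁ B≺μ n)) (≤-reflexive μn))
      rotate : ∀ g → g n ≡ 0 → ∑ℕ n g ≡ g 0 + ∑ℕ n (g ∘ suc)
      rotate g gn = trans (sym (trans (cong (∑ℕ n g +_) gn) (+-identityʳ _))) (∑-front n g)

  module _ {A B κ : ℕ → ℕ} (κ≺A : κ ≺ A) (κ≺B : κ ≺ B) (e : ℕ) where
    private
      above : ∀ k → κ k ≤ A k ⊓ B k
      above k = ⊓-glb (proj₁ κ≺A k) (proj₁ κ≺B k)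
      below′ : ∀ k → A (suc k) ⊔ B (suc k) ≤ κ k
      below′ k = ⊔-lub (proj₂ κ≺A k) (proj₂ κ≺B k)

    ≺-upˡ : A ≺ up A B κ e
    ≺-upˡ = (λ { zero    → ≤-trans (m≤m⊔n _ _) (m≤m+n _ e)
               ; (suc k) → ≤-trans (m≤m⊔n _ _) (≤-reflect (above k)) })
          , (λ k → ≤-trans (reflect-≤ (below′ k)) (m⊓n≤m _ _))

    ≺-upʳ : B ≺ up A B κ e
    ≺-upʳ = (λ { zero    → ≤-trans (m≤n⊔m _ _) (m≤m+n _ e)
               ; (suc k) → ≤-trans (m≤n⊔m _ _) (≤-reflect (above k)) })
          , (λ k → ≤-trans (reflect-≤ (below′ k)) (m⊓n≤n _ _))

    down-up : ∀ k → down A B (up A B κ e) k ≡ κ k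
    down-up k = m∸[m∸n]≡n (≤-trans (above k) (m≤m+n _ _))

  window-cong : ∀ {A B A′ B′} → (∀ k → A k ≡ A′ k) → (∀ k → B k ≡ B′ k) →
                ∀ k → window A B k ≡ window A′ B′ k
  window-cong a b k = cong₂ _+_ (cong₂ _⊓_ (a k) (b k)) (cong₂ _⊔_ (a (suc k)) (b (suc k)))

  down-cong : ∀ {A B μ A′ B′ μ′} → (∀ k → A k ≡ A′ k) → (∀ k → B k ≡ B′ k) →
              (∀ k → μ k ≡ μ′ k) → ∀ k → down A B μ k ≡ down A′ B′ μ′ k
  down-cong a b m k = cong₂ _∸_ (window-cong a b k) (m (suc k))

  up-cong : ∀ {A B κ e A′ B′ κ′ e′} → (∀ k → A k ≡ A′ k) → (∀ k → B k ≡ B′ k) →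
            (∀ k → κ k ≡ κ′ k) → e ≡ e′ → ∀ k → up A B κ e k ≡ up A′ B′ κ′ e′ k
  up-cong a b c e zero    = cong₂ _+_ (cong₂ _⊔_ (a 0) (b 0)) e
  up-cong a b c e (suc k) = cong₂ _∸_ (window-cong a b k) (c k)

  -- Partitions on the vertices of the quadrant: the boundary carries the diagonals of f
  -- (those below the main diagonal at (i , 0), those above at (0 , j)).
  partition : (ℕ → ℕ → ℕ) → ℕ → ℕ → ℕ → ℕ
  partition f i       zero    k = f (i + k) k
  partition f zero    (suc j) k = f k (suc j + k)
  partition f (suc i) (suc j) k =
    down (partition f i (suc j)) (partition f (suc i) j) (partition f i j) k

  -- The excess of the corner over its two outer neighbours, which `down` discards: the cell label
  -- of a growth diagram run backwards.
  matrix : (ℕ → ℕ → ℕ) → ℕ → ℕ → ℕ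
  matrix f i j = partition f i j 0 ∸ (partition f i (suc j) 0 ⊔ partition f (suc i) j 0)

  partition-0 : ∀ f j k → partition f 0 j k ≡ f k (j + k)
  partition-0 f zero    k = refl
  partition-0 f (suc j) k = refl

  module Forward (f : ℕ → ℕ → ℕ)
                 (column-step : ∀ k i → f (suc i) k ≤ f i k)
                 (row-step    : ∀ k i → f k (suc i) ≤ f k i) where
    private
      M = partition f

    mutual
      -- On the boundary interlacing is the monotonicity of columns and rows; inside, each
      -- reflection preserves it.
      M-≺ˡ : ∀ i j → M (suc i) j ≺ M i j
      M-≺ˡ i zero    = (λ k → column-step k (i + k))
                     , (λ k → ≤-trans (row-step (i + suc k) k)
                                (≤-reflexive (cong (λ r → f r k) (+-suc i k))))
      M-≺ˡ i (suc j) = down-≺ˡ (M-≺ʳ i j) (M-≺ˡ i j)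

      M-≺ʳ : ∀ i j → M i (suc j) ≺ M i j
      M-≺ʳ zero    zero    = (λ k → row-step k k) , (λ k → column-step (suc k) k)
      M-≺ʳ zero    (suc j) = (λ k → row-step k (suc j + k))
                           , (λ k → ≤-trans (column-step (suc j + suc k) k)
                                (≤-reflexive (cong (f k) (cong suc (+-suc j k)))))
      M-≺ʳ (suc i) j       = down-≺ʳ (M-≺ʳ i j) (M-≺ˡ i j)

    M≤M₀ʳ : ∀ i j k → M i j k ≤ M i 0 k
    M≤M₀ʳ i zero    k = ≤-refl
    M≤M₀ʳ i (suc j) k = ≤-trans (proj₁ (M-≺ʳ i j) k) (M≤M₀ʳ i j k)

    M≤M₀ˡ : ∀ i j k → M i j k ≤ M 0 j k
    M≤M₀ˡ zero    j k = ≤-refl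
    M≤M₀ˡ (suc i) j k = ≤-trans (proj₁ (M-≺ˡ i j) k) (M≤M₀ˡ i j k)

    module _ (n : ℕ) (s : Supported n f) where

      M-zeroˡ : ∀ i j k → n ≤ i → M i j k ≡ 0
      M-zeroˡ i j k n≤i = n≤0⇒n≡0 (≤-trans (M≤M₀ʳ i j k)
        (≤-reflexive (below s (i + k) k (≤-trans n≤i (m≤m+n i k)))))

      M-zeroʳ : ∀ i j k → n ≤ j → M i j k ≡ 0
      M-zeroʳ i j k n≤j = n≤0⇒n≡0 (≤-trans (M≤M₀ˡ i j k)
        (≤-reflexive (trans (partition-0 f j k) (right s k (j + k) (≤-trans n≤j (m≤m+n j k))))))

      M-zeroᵏ : ∀ i j k → n ≤ k → M i j k ≡ 0
      M-zeroᵏ i j k n≤k = n≤0⇒n≡0 (≤-trans (M≤M₀ʳ i j k) (≤-reflexive (right s (i + k) k n≤k)))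

      private
        T : ℕ → ℕ → ℕ
        T i j = ∑ℕ n (M i j)

        a = matrix f

        T-step : ∀ i j → T i j + T (suc i) (suc j) ≡ T i (suc j) + T (suc i) j + a i j
        T-step i j = down-sum (M-≺ʳ i j) (M-≺ˡ i j) n (M-zeroᵏ i j n ≤-refl)

        -- The local rules for the sizes telescope along a row. Differences are written as sums on
        -- both sides, hence the cancellation of the two intermediate sizes.
        T-row : ∀ i m → T i 0 + T (suc i) m ≡ T i m + T (suc i) 0 + ∑ℕ m (a i)
        T-row i zero    = sym (+-identityʳ _)
        T-row i (suc m) = +-cancelʳ-≡ (T i m + T (suc i) m) _ _
          (trans (solve 4 (λ x y z w → (x :+ y) :+ (z :+ w) := (x :+ w) :+ (z :+ y)) refl
                    (T i 0) (T (suc i) (suc m)) (T i m) (T (suc i) m))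
            (trans (cong₂ _+_ (T-row i m) (T-step i m))
              (solve 6 (λ p q r u v w → ((p :+ q) :+ r) :+ ((u :+ v) :+ w)
                                     := ((u :+ q) :+ (r :+ w)) :+ (p :+ v)) refl
                (T i m) (T (suc i) 0) (∑ℕ m (a i)) (T i (suc m)) (T (suc i) m) (a i m))))

        T-column : ∀ j m → T 0 j + T m (suc j) ≡ T m j + T 0 (suc j) + ∑ℕ m (λ i → a i j)
        T-column j zero    = sym (+-identityʳ _)
        T-column j (suc m) = +-cancelʳ-≡ (T m j + T m (suc j)) _ _
          (trans (solve 4 (λ x y z w → (x :+ y) :+ (z :+ w) := (x :+ w) :+ (z :+ y)) refl
                    (T 0 j) (T (suc m) (suc j)) (T m j) (T m (suc j)))
            (trans (cong₂ _+_ (T-column j m) (T-step m j))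
              (solve 6 (λ p q r u v w → ((p :+ q) :+ r) :+ ((u :+ v) :+ w)
                                     := ((v :+ q) :+ (r :+ w)) :+ (p :+ u)) refl
                (T m j) (T 0 (suc j)) (∑ℕ m (λ i → a i j)) (T m (suc j)) (T (suc m) j) (a m j))))

        T-zeroˡ : ∀ j → T n j ≡ 0
        T-zeroˡ j = ∑ℕ-zero n (λ k → M-zeroˡ n j k ≤-refl)
        T-zeroʳ : ∀ i → T i n ≡ 0
        T-zeroʳ i = ∑ℕ-zero n (λ k → M-zeroʳ i n k ≤-refl)

        row column : ℕ → ℕ
        row i    = ∑ℕ n (a i)
        column j = ∑ℕ n (λ i → a i j)

        T-row′ : ∀ i → T i 0 ≡ T (suc i) 0 + row i
        T-row′ i = trans (sym (trans (cong (T i 0 +_) (T-zeroʳ (suc i))) (+-identityʳ _)))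
          (trans (T-row i n) (cong (λ t → t + T (suc i) 0 + row i) (T-zeroʳ i)))

        T-column′ : ∀ j → T 0 j ≡ T 0 (suc j) + column j
        T-column′ j = trans (sym (trans (cong (T 0 j +_) (T-zeroˡ (suc j))) (+-identityʳ _)))
          (trans (T-column j n) (cong (λ t → t + T 0 (suc j) + column j) (T-zeroˡ j)))

      weight : ℕ
      weight = ∑ℕ n (λ i → ∑ℕ n (λ j → suc (i + j) * a i j))

      private
        -- Since `suc (i + j) + 1 ≡ suc i + suc j`, the weight together with one copy of the total
        -- `T 0 0` of the matrix splits into row and column moments, and summation by parts turns
        -- these into the sizes of the boundary partitions.
        weight+ : weight + T 0 0 ≡ ∑ℕ n (λ i → T i 0) + ∑ℕ n (T 0)
        weight+ = begin
          weight + T 0 0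
            ≡⟨ cong (weight +_) (trans (telescope n (λ i → T i 0) row (λ i _ → T-row′ i))
                 (trans (cong (∑ℕ n row +_) (T-zeroˡ 0)) (+-identityʳ _))) ⟩
          weight + ∑ℕ n row
            ≡⟨ sym (∑-distrib-+ n _ row) ⟩
          ∑ℕ n (λ i → ∑ℕ n (λ j → suc (i + j) * a i j) + row i)
            ≡⟨ ∑ℕ-cong n (λ i → trans (sym (∑-distrib-+ n _ (a i)))
                 (trans (∑ℕ-cong n (λ j → solve 3
                          (λ i j a → (con 1 :+ (i :+ j)) :* a :+ a := (con 1 :+ i) :* a :+ (con 1 :+ j) :* a)
                          refl i j (a i j)))
                   (∑-distrib-+ n _ _))) ⟩
          ∑ℕ n (λ i → ∑ℕ n (λ j → suc i * a i j) + ∑ℕ n (λ j → suc j * a i j))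
            ≡⟨ ∑-distrib-+ n _ _ ⟩
          ∑ℕ n (λ i → ∑ℕ n (λ j → suc i * a i j)) + ∑ℕ n (λ i → ∑ℕ n (λ j → suc j * a i j))
            ≡⟨ cong₂ _+_ (∑ℕ-cong n (λ i → ∑-distribˡ-* n (suc i) (a i)))
                 (trans (∑-swap n n _) (∑ℕ-cong n (λ j → ∑-distribˡ-* n (suc j) _))) ⟩
          ∑ℕ n (λ i → suc i * row i) + ∑ℕ n (λ j → suc j * column j)
            ≡⟨ cong₂ _+_ (sym (abel₀ n (λ i → T i 0) row (λ i _ → T-row′ i) (T-zeroˡ 0)))
                         (sym (abel₀ n (T 0) column (λ j _ → T-column′ j) (T-zeroʳ 0))) ⟩
          ∑ℕ n (λ i → T i 0) + ∑ℕ n (T 0) ∎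
          where open ≡-Reasoning

      -- Lower and upper diagonals together exhaust the array but count the main diagonal twice;
      -- this extra `T 0 0` is the one in `weight+`.
      boxSum-weight : boxSum n f ≡ weight
      boxSum-weight = +-cancelʳ-≡ (T 0 0) _ _
        (trans (diagonals n f (λ i j → below s i j) (λ i j → right s i j))
          (trans (cong (∑ℕ n (λ i → T i 0) +_)
                   (∑ℕ-cong n (λ j → ∑ℕ-cong n (λ k → sym (partition-0 f j k)))))
            (sym weight+)))
        where
        -- The first row and column of the square consist of the first entries of all diagonals;
        -- removing them leaves a smaller square.
        diagonals : ∀ n (f : ℕ → ℕ → ℕ) → (∀ i j → n ≤ i → f i j ≡ 0) → (∀ i j → n ≤ j → f i j ≡ 0) →
          boxSum n f + ∑ℕ n (λ k → f k k) ≡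
          ∑ℕ n (λ i → ∑ℕ n (λ k → f (i + k) k)) + ∑ℕ n (λ j → ∑ℕ n (λ k → f k (j + k)))
        diagonals zero    f b r = refl
        diagonals (suc n) f b r = begin
          boxSum (suc n) f + ∑ℕ (suc n) (λ k → f k k)
            ≡⟨ cong₂ _+_ (trans (∑ℕ-cong (suc n) (λ i → ∑-front n (f i)))
                 (trans (∑-distrib-+ (suc n) _ _) (cong (c +_) (∑-front n _))))
                 (∑-front n (λ k → f k k)) ⟩
          (c + (d + boxSum n f′)) + (f 0 0 + ∑ℕ n (λ k → f′ k k))
            ≡⟨ solve 5 (λ c d b z e → (c :+ (d :+ b)) :+ (z :+ e) := (c :+ (z :+ d)) :+ (b :+ e)) refl
                 c d (boxSum n f′) (f 0 0) _ ⟩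
          (c + (f 0 0 + d)) + (boxSum n f′ + ∑ℕ n (λ k → f′ k k))
            ≡⟨ cong₂ _+_ (cong (c +_) (sym (∑-front n (f 0))))
                 (diagonals n f′ (λ i j n≤i → b (suc i) (suc j) (s≤s n≤i))
                                 (λ i j n≤j → r (suc i) (suc j) (s≤s n≤j))) ⟩
          (c + ∑ℕ (suc n) (f 0)) +
          (∑ℕ n (λ i → ∑ℕ n (λ k → f′ (i + k) k)) + ∑ℕ n (λ j → ∑ℕ n (λ k → f′ k (j + k))))
            ≡⟨ +-interchange c _ _ _ ⟩
          (c + ∑ℕ n (λ i → ∑ℕ n (λ k → f′ (i + k) k))) +
          (∑ℕ (suc n) (f 0) + ∑ℕ n (λ j → ∑ℕ n (λ k → f′ k (j + k))))
            ≡⟨ cong₂ _+_ (sym (strip (λ i k → f (i + k) k) (λ i → f i 0) (λ i k → f′ (i + k) k)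
                 (λ i → cong (λ r → f r 0) (+-identityʳ i))
                 (λ i k → cong (λ r → f r (suc k)) (+-suc i k))
                 (λ k → b (suc (n + k)) (suc k) (s≤s (m≤m+n n k)))))
               (sym (strip (λ j k → f k (j + k)) (f 0) (λ j k → f′ k (j + k))
                 (λ j → cong (f 0) (+-identityʳ j))
                 (λ j k → cong (f (suc k)) (+-suc j k))
                 (λ k → r (suc k) (suc (n + k)) (s≤s (m≤m+n n k))))) ⟩
          _ ∎
          where
          open ≡-Reasoning
          f′ : ℕ → ℕ → ℕ
          f′ i j = f (suc i) (suc j)
          c = ∑ℕ (suc n) (λ i → f i 0)
          d = ∑ℕ n (λ j → f 0 (suc j))
          strip : ∀ (g : ℕ → ℕ → ℕ) (h : ℕ → ℕ) (g′ : ℕ → ℕ → ℕ) → (∀ i → g i 0 ≡ h i) →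
            (∀ i k → g i (suc k) ≡ g′ i k) → (∀ k → g′ n k ≡ 0) →
            ∑ℕ (suc n) (λ i → ∑ℕ (suc n) (g i)) ≡ ∑ℕ (suc n) h + ∑ℕ n (λ i → ∑ℕ n (g′ i))
          strip g h g′ gh gg′ g′0 = trans
            (∑ℕ-cong (suc n) (λ i → trans (∑-front n (g i)) (cong₂ _+_ (gh i) (∑ℕ-cong n (gg′ i)))))
            (trans (∑-distrib-+ (suc n) h _)
              (cong (∑ℕ (suc n) h +_)
                (trans (cong (∑ℕ n (λ i → ∑ℕ n (g′ i)) +_) (∑ℕ-zero n g′0)) (+-identityʳ _))))

  -- Fomin's growth diagram: from empty partitions on the axes, the label `b i j` and three inner
  -- corners of a cell determine the outer one.
  growth : (ℕ → ℕ → ℕ) → ℕ → ℕ → ℕ → ℕ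
  growth b zero    j       k = 0
  growth b (suc i) zero    k = 0
  growth b (suc i) (suc j) k =
    up (growth b (suc i) j) (growth b i (suc j)) (growth b i j) (b i j) k

  module Growth (b : ℕ → ℕ → ℕ) where

    growth-0 : ∀ i k → growth b i 0 k ≡ 0
    growth-0 zero    k = refl
    growth-0 (suc i) k = refl

    mutual
      growth-≺ˡ : ∀ i j → growth b i j ≺ growth b (suc i) j
      growth-≺ˡ i zero    = (λ k → ≤-reflexive (growth-0 i k)) , (λ k → z≤n)
      growth-≺ˡ i (suc j) = ≺-upʳ (growth-≺ˡ i j) (growth-≺ʳ i j) (b i j)

      growth-≺ʳ : ∀ i j → growth b i j ≺ growth b i (suc j)
      growth-≺ʳ zero    j = (λ k → z≤n) , (λ k → z≤n)
      growth-≺ʳ (suc i) j = ≺-upˡ (growth-≺ˡ i j) (growth-≺ʳ i j) (b i j)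

    -- The axes are empty, and each interlacing step adds at most one part.
    growth-lengthˡ : ∀ i j k → i ≤ k → growth b i j k ≡ 0
    growth-lengthˡ zero    j k       _         = refl
    growth-lengthˡ (suc i) j (suc k) (s≤s i≤k) = n≤0⇒n≡0
      (≤-trans (proj₂ (growth-≺ˡ i j) k) (≤-reflexive (growth-lengthˡ i j k i≤k)))

    growth-lengthʳ : ∀ i j k → j ≤ k → growth b i j k ≡ 0
    growth-lengthʳ i zero    k       _         = growth-0 i k
    growth-lengthʳ i (suc j) (suc k) (s≤s j≤k) = n≤0⇒n≡0
      (≤-trans (proj₂ (growth-≺ʳ i j) k) (≤-reflexive (growth-lengthʳ i j k j≤k)))

  growth-cong : ∀ {b b′} i j → (∀ i′ j′ → i′ < i → j′ < j → b i′ j′ ≡ b′ i′ j′) →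
                ∀ k → growth b i j k ≡ growth b′ i j k
  growth-cong zero    j       h k = refl
  growth-cong (suc i) zero    h k = refl
  growth-cong (suc i) (suc j) h k = up-cong
    (growth-cong (suc i) j (λ i′ j′ p q → h i′ j′ p (m<n⇒m<1+n q)))
    (growth-cong i (suc j) (λ i′ j′ p q → h i′ j′ (m<n⇒m<1+n p) q))
    (growth-cong i j (λ i′ j′ p q → h i′ j′ (m<n⇒m<1+n p) (m<n⇒m<1+n q)))
    (h i j ≤-refl ≤-refl) k

  ∸-lower : ∀ {i n} → i < n → n ∸ i ≡ suc (n ∸ suc i)
  ∸-lower {zero}  (s≤s _)   = refl
  ∸-lower {suc i} (s≤s i<n) = ∸-lower i<n

  ∸-involutive : ∀ {i n} → i < n → n ∸ suc (n ∸ suc i) ≡ i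
  ∸-involutive {i} {n} i<n = trans (cong (n ∸_) (sym (∸-lower i<n))) (m∸[m∸n]≡n (<⇒≤ i<n))

  -- The index reversal matches the corner (n , n) of a growth with the origin of a partition.
  reverse : ℕ → (ℕ → ℕ → ℕ) → ℕ → ℕ → ℕ
  reverse n a i j = a (n ∸ suc i) (n ∸ suc j)

  module Uniqueness (n : ℕ) where

    module _ (f : ℕ → ℕ → ℕ)
             (column-step : ∀ k i → f (suc i) k ≤ f i k)
             (row-step    : ∀ k i → f k (suc i) ≤ f k i)
             (s : Supported n f) where
      open Forward f column-step row-step

      -- Partitions at distance `n` are empty like the axes of a growth, and `up` undoes `down`; so
      -- the matrix alone rebuilds the diagram from its far corner.
      partition≡growth : ∀ i j → i ≤ n → j ≤ n → ∀ k →
        partition f (n ∸ i) (n ∸ j) k ≡ growth (reverse n (matrix f)) i j k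
      partition≡growth zero    j       _   _   k = M-zeroˡ n s n (n ∸ j) k ≤-refl
      partition≡growth (suc i) zero    _   _   k = M-zeroʳ n s (n ∸ suc i) n k ≤-refl
      partition≡growth (suc i) (suc j) i<n j<n k = trans
        (sym (up-down (M-≺ʳ I J) (M-≺ˡ I J) k))
        (up-cong
          (λ k → trans (cong (λ r → partition f I r k) (sym (∸-lower j<n)))
                       (partition≡growth (suc i) j i<n (<⇒≤ j<n) k))
          (λ k → trans (cong (λ r → partition f r J k) (sym (∸-lower i<n)))
                       (partition≡growth i (suc j) (<⇒≤ i<n) j<n k))
          (λ k → trans (cong₂ (λ r q → partition f r q k) (sym (∸-lower i<n)) (sym (∸-lower j<n)))
                       (partition≡growth i j (<⇒≤ i<n) (<⇒≤ j<n) k))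
          refl k)
        where
        I = n ∸ suc i
        J = n ∸ suc j

      partition-cover : ∀ i j k → partition f i j k ≡ growth (reverse n (matrix f)) (n ∸ i) (n ∸ j) k
      partition-cover i j k with ≤-total i n | ≤-total j n
      ... | inj₁ i≤n | inj₁ j≤n = trans
        (cong₂ (λ r q → partition f r q k) (sym (m∸[m∸n]≡n i≤n)) (sym (m∸[m∸n]≡n j≤n)))
        (partition≡growth (n ∸ i) (n ∸ j) (m∸n≤m n i) (m∸n≤m n j) k)
      ... | inj₂ n≤i | _ = trans (M-zeroˡ n s i j k n≤i)
        (cong (λ r → growth (reverse n (matrix f)) r (n ∸ j) k) (sym (m≤n⇒m∸n≡0 n≤i)))
      ... | inj₁ _ | inj₂ n≤j = trans (M-zeroʳ n s i j k n≤j) (sym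
        (trans (cong (λ r → growth (reverse n (matrix f)) (n ∸ i) r k) (m≤n⇒m∸n≡0 n≤j))
          (Growth.growth-0 (reverse n (matrix f)) (n ∸ i) k)))

    boundary-injective : ∀ {f g} → (∀ i j k → partition f i j k ≡ partition g i j k) →
                         ∀ i j → f i j ≡ g i j
    boundary-injective {f} {g} h i j with ≤-total i j
    ... | inj₁ i≤j = subst (λ j → f i j ≡ g i j) (m∸n+n≡m i≤j)
      (trans (sym (partition-0 f (j ∸ i) i)) (trans (h 0 (j ∸ i) i) (partition-0 g (j ∸ i) i)))
    ... | inj₂ j≤i = subst (λ i → f i j ≡ g i j) (m∸n+n≡m j≤i) (h (i ∸ j) 0 j)

  partition-cong : ∀ {f g} → (∀ i j → f i j ≡ g i j) → ∀ i j k → partition f i j k ≡ partition g i j k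
  partition-cong h i       zero    k = h (i + k) k
  partition-cong h zero    (suc j) k = h k (suc j + k)
  partition-cong h (suc i) (suc j) k = down-cong
    (partition-cong h i (suc j)) (partition-cong h (suc i) j) (partition-cong h i j) k

  matrix-cong : ∀ {f g} → (∀ i j → f i j ≡ g i j) → ∀ i j → matrix f i j ≡ matrix g i j
  matrix-cong h i j = cong₂ _∸_ (partition-cong h i j 0)
    (cong₂ _⊔_ (partition-cong h i (suc j) 0) (partition-cong h (suc i) j 0))

  module Backward (n : ℕ) (a : ℕ → ℕ → ℕ) where
    private
      b = reverse n a
      Λ = growth b
    open Growth b

    -- layer r c k is the entry at (r + k , c + k).
    layer : ℕ → ℕ → ℕ → ℕ
    layer r       zero    k = Λ (n ∸ r) n k
    layer zero    (suc c) k = Λ n (n ∸ suc c) k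
    layer (suc r) (suc c) k = layer r c (suc k)

    array : ℕ → ℕ → ℕ
    array r c = layer r c 0

    private
      Λ-antitoneˡ : ∀ i j k → Λ (n ∸ suc i) j k ≤ Λ (n ∸ i) j k
      Λ-antitoneˡ i j k with ≤-<-connex n i
      ... | inj₂ i<n = subst (λ r → Λ (n ∸ suc i) j k ≤ Λ r j k) (sym (∸-lower i<n))
                         (proj₁ (growth-≺ˡ (n ∸ suc i) j) k)
      ... | inj₁ n≤i = subst (λ r → Λ r j k ≤ Λ (n ∸ i) j k) (sym (m≤n⇒m∸n≡0 (m≤n⇒m≤1+n n≤i))) z≤n

      Λ-antitoneʳ : ∀ i j k → Λ i (n ∸ suc j) k ≤ Λ i (n ∸ j) k
      Λ-antitoneʳ i j k with ≤-<-connex n j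
      ... | inj₂ j<n = subst (λ r → Λ i (n ∸ suc j) k ≤ Λ i r k) (sym (∸-lower j<n))
                         (proj₁ (growth-≺ʳ i (n ∸ suc j)) k)
      ... | inj₁ n≤j = subst (λ r → Λ i r k ≤ Λ i (n ∸ j) k) (sym (m≤n⇒m∸n≡0 (m≤n⇒m≤1+n n≤j)))
                         (≤-trans (≤-reflexive (growth-0 i k)) z≤n)

      Λ-interlaceˡ : ∀ i j k → Λ (n ∸ i) j (suc k) ≤ Λ (n ∸ suc i) j k
      Λ-interlaceˡ i j k with ≤-<-connex n i
      ... | inj₂ i<n = subst (λ r → Λ r j (suc k) ≤ Λ (n ∸ suc i) j k) (sym (∸-lower i<n))
                         (proj₂ (growth-≺ˡ (n ∸ suc i) j) k)
      ... | inj₁ n≤i = subst (λ r → Λ r j (suc k) ≤ Λ (n ∸ suc i) j k) (sym (m≤n⇒m∸n≡0 n≤i)) z≤n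

      Λ-interlaceʳ : ∀ i j k → Λ i (n ∸ j) (suc k) ≤ Λ i (n ∸ suc j) k
      Λ-interlaceʳ i j k with ≤-<-connex n j
      ... | inj₂ j<n = subst (λ r → Λ i r (suc k) ≤ Λ i (n ∸ suc j) k) (sym (∸-lower j<n))
                         (proj₂ (growth-≺ʳ i (n ∸ suc j)) k)
      ... | inj₁ n≤j = subst (λ r → Λ i r (suc k) ≤ Λ i (n ∸ suc j) k) (sym (m≤n⇒m∸n≡0 n≤j))
                         (≤-trans (≤-reflexive (growth-0 i (suc k))) z≤n)

      layer-0 : ∀ c k → layer 0 c k ≡ Λ n (n ∸ c) k
      layer-0 zero    k = refl
      layer-0 (suc c) k = refl

      layer-column : ∀ r c k → layer (suc r) c k ≤ layer r c k
      layer-column r       zero    k = Λ-antitoneˡ r n k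
      layer-column zero    (suc c) k = ≤-trans (≤-reflexive (layer-0 c (suc k))) (Λ-interlaceʳ n c k)
      layer-column (suc r) (suc c) k = layer-column r c (suc k)

      layer-row : ∀ r c k → layer r (suc c) k ≤ layer r c k
      layer-row zero    c       k = ≤-trans (Λ-antitoneʳ n c k) (≤-reflexive (sym (layer-0 c k)))
      layer-row (suc r) zero    k = Λ-interlaceˡ r n k
      layer-row (suc r) (suc c) k = layer-row r c (suc k)

      layer-below : ∀ r c k → n ≤ r + k → layer r c k ≡ 0
      layer-below r       zero    k h = growth-lengthˡ (n ∸ r) n k (m≤n+o⇒m∸n≤o n r h)
      layer-below zero    (suc c) k h = growth-lengthˡ n _ k h
      layer-below (suc r) (suc c) k h = layer-below r c (suc k) (≤-trans h (≤-reflexive (sym (+-suc r k))))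

      layer-right : ∀ r c k → n ≤ c + k → layer r c k ≡ 0
      layer-right r       zero    k h = growth-lengthʳ (n ∸ r) n k h
      layer-right zero    (suc c) k h = growth-lengthʳ n (n ∸ suc c) k (m≤n+o⇒m∸n≤o n (suc c) h)
      layer-right (suc r) (suc c) k h = layer-right r c (suc k) (≤-trans h (≤-reflexive (sym (+-suc c k))))

      layer-diagonal : ∀ m r c k → layer (r + m) (c + m) k ≡ layer r c (m + k)
      layer-diagonal zero    r c k = cong₂ (λ r c → layer r c k) (+-identityʳ r) (+-identityʳ c)
      layer-diagonal (suc m) r c k = trans
        (cong₂ (λ r c → layer r c k) (+-suc r m) (+-suc c m))
        (trans (layer-diagonal m r c (suc k)) (cong (layer r c) (+-suc m k)))

    array-column : ∀ k i → array (suc i) k ≤ array i k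
    array-column k i = layer-column i k 0

    array-row : ∀ k i → array k (suc i) ≤ array k i
    array-row k i = layer-row k i 0

    array-supported : Supported n array
    array-supported .below i j n≤i = layer-below i j 0 (≤-trans n≤i (m≤m+n i 0))
    array-supported .right i j n≤j = layer-right i j 0 (≤-trans n≤j (m≤m+n j 0))

    -- On the boundary `array` was read off from `Λ`; inside, `down` undoes `up`. From `n` on the
    -- truncated subtractions give `0`, and both sides are empty.
    partition-array : ∀ i j k → partition array i j k ≡ Λ (n ∸ i) (n ∸ j) k
    partition-array i zero    k = trans (layer-diagonal k i 0 0) (cong (Λ (n ∸ i) n) (+-identityʳ k))
    partition-array zero (suc j) k =
      trans (layer-diagonal k 0 (suc j) 0) (cong (Λ n (n ∸ suc j)) (+-identityʳ k))
    partition-array (suc i) (suc j) k = trans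
      (down-cong (partition-array i (suc j)) (partition-array (suc i) j) (partition-array i j) k)
      (step (≤-<-connex n i) (≤-<-connex n j))
      where
      I = n ∸ suc i
      J = n ∸ suc j
      step : _ → _ → down (Λ (n ∸ i) J) (Λ I (n ∸ j)) (Λ (n ∸ i) (n ∸ j)) k ≡ Λ I J k
      step (inj₂ i<n) (inj₂ j<n) = trans
        (cong₂ (λ p q → down (Λ p J) (Λ I q) (Λ p q) k) (∸-lower i<n) (∸-lower j<n))
        (down-up (growth-≺ˡ I J) (growth-≺ʳ I J) (b I J) k)
      step (inj₁ n≤i) _ = trans
        (cong₂ (λ p q → down (Λ p J) (Λ q (n ∸ j)) (Λ p (n ∸ j)) k) (m≤n⇒m∸n≡0 n≤i) I≡0)
        (cong (λ p → Λ p J k) (sym I≡0))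
        where I≡0 = m≤n⇒m∸n≡0 (m≤n⇒m≤1+n n≤i)
      step (inj₂ _) (inj₁ n≤j) = trans
        (cong₂ (λ p q → down (Λ (n ∸ i) p) (Λ I q) (Λ (n ∸ i) q) k) J≡0 (m≤n⇒m∸n≡0 n≤j))
        (trans (down-cong {A′ = λ _ → 0} {B′ = λ _ → 0} {μ′ = λ _ → 0}
                 (growth-0 (n ∸ i)) (growth-0 I) (growth-0 (n ∸ i)) k)
          (trans (sym (growth-0 I k)) (cong (λ p → Λ I p k) (sym J≡0))))
        where J≡0 = m≤n⇒m∸n≡0 (m≤n⇒m≤1+n n≤j)

    matrix-array : ∀ i j → i < n → j < n → matrix array i j ≡ a i j
    matrix-array i j i<n j<n = trans
      (cong₂ _∸_ (partition-array i j 0)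
        (cong₂ _⊔_ (partition-array i (suc j) 0) (partition-array (suc i) j 0)))
      (trans (cong₂ (λ p q → Λ p q 0 ∸ (Λ p J 0 ⊔ Λ I q 0)) (∸-lower i<n) (∸-lower j<n))
        (trans (m+n∸m≡n (Λ (suc I) J 0 ⊔ Λ I (suc J) 0) (b I J))
          (cong₂ a (∸-involutive i<n) (∸-involutive j<n))))
      where
      I = n ∸ suc i
      J = n ∸ suc j

  matrix-injective : ∀ n {f g} →
    (∀ k i → f (suc i) k ≤ f i k) → (∀ k i → f k (suc i) ≤ f k i) → Supported n f →
    (∀ k i → g (suc i) k ≤ g i k) → (∀ k i → g k (suc i) ≤ g k i) → Supported n g →
    (∀ i j → i < n → j < n → matrix f i j ≡ matrix g i j) → ∀ i j → f i j ≡ g i j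
  matrix-injective n {f} {g} fc fr fs gc gr gs h = Uniqueness.boundary-injective n λ i j k → trans
    (Uniqueness.partition-cover n f fc fr fs i j k)
    (trans (growth-cong (n ∸ i) (n ∸ j) (λ i′ j′ p q →
              h _ _ (lower (≤-<-trans z≤n (<-≤-trans p (m∸n≤m n i))))
                    (lower (≤-<-trans z≤n (<-≤-trans q (m∸n≤m n j))))) k)
      (sym (Uniqueness.partition-cover n g gc gr gs i j k)))
    where
    lower : ∀ {i} → 0 < n → n ∸ suc i < n
    lower {i} (s≤s _) = s≤s (m∸n≤m _ i)

-- Multiplicity functions of given weight as elements of a finite type.

module Counting where
  open import Data.Nat using (ℕ; zero; suc; _+_; _*_; _∸_; _≤_; _<_; z≤n; s≤s; _≟_)
  open import Data.Nat.Properties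
  open import Data.Fin using (Fin; splitAt; _↑ˡ_; _↑ʳ_)
  open import Data.Fin.Properties using (splitAt-↑ˡ; splitAt-↑ʳ; splitAt⁻¹-↑ˡ; splitAt⁻¹-↑ʳ)
  open import Data.Product using (Σ; _,_; proj₁)
  open import Data.Sum using (inj₁; inj₂)
  open import Data.Empty using (⊥-elim)
  open import Relation.Nullary using (yes; no)
  open import Relation.Binary.PropositionalEquality hiding (J)
  open import Defs using (∑ℕ)
  open Sums
  open Shift

  module _ (f : ℕ → ℕ) where

    inject∑ : ∀ B j → j < B → Fin (f j) → Fin (∑ℕ B f)
    inject∑ (suc B) j j≤B x with j ≟ B
    ... | yes refl = ∑ℕ B f ↑ʳ x
    ... | no j≢B   = inject∑ B j (≤∧≢⇒< (≤-pred j≤B) j≢B) x ↑ˡ f B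

    project∑ : ∀ B → Fin (∑ℕ B f) → Σ ℕ (λ j → Fin (f j))
    project∑ (suc B) x with splitAt (∑ℕ B f) x
    ... | inj₁ y = project∑ B y
    ... | inj₂ z = B , z

    project∑-< : ∀ B x → proj₁ (project∑ B x) < B
    project∑-< (suc B) x with splitAt (∑ℕ B f) x
    ... | inj₁ y = m<n⇒m<1+n (project∑-< B y)
    ... | inj₂ z = ≤-refl

    project-inject : ∀ B j j<B x → project∑ B (inject∑ B j j<B x) ≡ (j , x)
    project-inject (suc B) j j≤B x with j ≟ B
    ... | yes refl rewrite splitAt-↑ʳ (∑ℕ B f) (f B) x = refl
    ... | no j≢B rewrite splitAt-↑ˡ (∑ℕ B f) (inject∑ B j (≤∧≢⇒< (≤-pred j≤B) j≢B) x) (f B) =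
      project-inject B j _ x

    project-injective : ∀ B x y → project∑ B x ≡ project∑ B y → x ≡ y
    project-injective (suc B) x y e with splitAt (∑ℕ B f) x in ex | splitAt (∑ℕ B f) y in ey
    ... | inj₁ u | inj₁ v = trans (sym (splitAt⁻¹-↑ˡ ex))
      (trans (cong (_↑ˡ f B) (project-injective B u v e)) (splitAt⁻¹-↑ˡ ey))
    ... | inj₂ u | inj₂ v with refl ← e = trans (sym (splitAt⁻¹-↑ʳ ex)) (splitAt⁻¹-↑ʳ ey)
    ... | inj₁ u | inj₂ v = ⊥-elim (<-irrefl (cong proj₁ e) (project∑-< B u))
    ... | inj₂ u | inj₁ v = ⊥-elim (<-irrefl (cong proj₁ (sym e)) (project∑-< B v))

  module _ (f : ℕ → ℕ) where

    unshift : ∀ k n → Fin (shift k f n) → Fin (f (n ∸ k))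
    unshift zero    n       x = x
    unshift (suc k) (suc n) x = unshift k n x

    unshift-≤ : ∀ k n → Fin (shift k f n) → k ≤ n
    unshift-≤ zero    n       x = z≤n
    unshift-≤ (suc k) (suc n) x = s≤s (unshift-≤ k n x)

    reshift : ∀ k n → k ≤ n → Fin (f (n ∸ k)) → Fin (shift k f n)
    reshift zero    n       _         x = x
    reshift (suc k) (suc n) (s≤s k≤n) x = reshift k n k≤n x

    unshift-reshift : ∀ k n k≤n x → unshift k n (reshift k n k≤n x) ≡ x
    unshift-reshift zero    n       _         x = refl
    unshift-reshift (suc k) (suc n) (s≤s k≤n) x = unshift-reshift k n k≤n x

    unshift-injective : ∀ k n x y → unshift k n x ≡ unshift k n y → x ≡ y
    unshift-injective zero    n       x y e = e
    unshift-injective (suc k) (suc n) x y e = unshift-injective k n x y e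

  extend : (ℕ → ℕ) → ℕ → ℕ → ℕ → ℕ
  extend g L v l with l ≟ L
  ... | yes _ = v
  ... | no _  = g l

  extend-at : ∀ g L v → extend g L v L ≡ v
  extend-at g L v with L ≟ L
  ... | yes _ = refl
  ... | no ne = ⊥-elim (ne refl)

  extend-off : ∀ g L v l → l < L → extend g L v l ≡ g l
  extend-off g L v l l<L with l ≟ L
  ... | yes refl = ⊥-elim (<-irrefl refl l<L)
  ... | no _     = refl

  module Parts (w : ℕ → ℕ) (B : ℕ) (1≤w : ∀ l → 1 ≤ w l) where

    weightOf : ℕ → (ℕ → ℕ) → ℕ
    weightOf L g = ∑ℕ L (λ l → g l * w l)

    private
      F : ℕ → ℕ → ℕ
      F = partsCount w B

      v≤v*w : ∀ v l → v ≤ v * w l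
      v≤v*w v l = ≤-trans (≤-reflexive (sym (*-identityʳ v))) (*-monoʳ-≤ v (1≤w l))

    -- The multiplicity `g L` of the last part picks the summand of `partsCount`, and the rest has
    -- weight `n ∸ g L * w L`. Positive part weights give `g L ≤ n < B`, within the truncation.
    encode : ∀ L n g → n < B → weightOf L g ≡ n → Fin (F L n)
    encode zero    .0 g _ refl = Fin.zero
    encode (suc L) n g n<B e = inject∑ (λ j → shift (j * w L) (F L) n) B (g L)
      (≤-<-trans (v≤v*w (g L) L) (≤-<-trans k≤n n<B))
      (reshift (F L) k n k≤n (encode L (n ∸ k) g (≤-<-trans (m∸n≤m n k) n<B)
        (trans (sym (m+n∸n≡m (weightOf L g) k)) (cong (_∸ k) e))))
      where
      k = g L * w L
      k≤n : k ≤ n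
      k≤n = ≤-trans (m≤n+m k (weightOf L g)) (≤-reflexive e)

    mutual
      decode : ∀ L n → Fin (F L n) → ℕ → ℕ
      decode zero    n x = λ _ → 0
      decode (suc L) n x = decodeStep L n (project∑ _ B x)

      decodeStep : ∀ L n → Σ ℕ (λ j → Fin (shift (j * w L) (F L) n)) → ℕ → ℕ
      decodeStep L n (j , x) = extend (decode L (n ∸ j * w L) (unshift (F L) (j * w L) n x)) L j

    weightOf-cong : ∀ L {g h} → (∀ l → l < L → g l ≡ h l) → weightOf L g ≡ weightOf L h
    weightOf-cong L h = ∑-cong< L (λ l l<L → cong (_* w l) (h l l<L))

    decode-weight : ∀ L n x → weightOf L (decode L n x) ≡ n
    decode-weight zero    zero    x = refl
    decode-weight (suc L) n       x = step (project∑ _ B x)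
      where
      step : ∀ s → weightOf (suc L) (decodeStep L n s) ≡ n
      step (j , y) = trans
        (cong₂ _+_ (trans (weightOf-cong L (λ l l<L → extend-off d L j l l<L)) (decode-weight L _ _))
                   (cong (_* w L) (extend-at d L j)))
        (m∸n+n≡m (unshift-≤ (F L) (j * w L) n y))
        where d = decode L (n ∸ j * w L) (unshift (F L) (j * w L) n y)

    decode-encode : ∀ L n g n<B e l → l < L → decode L n (encode L n g n<B e) l ≡ g l
    decode-encode (suc L) n g n<B e l l≤L = trans
      (cong (λ s → decodeStep L n s l) (project-inject _ B (g L) _ _))
      (step (l ≟ L))
      where
      step : _ → decodeStep L n (g L , _) l ≡ g l
      step (yes refl) = extend-at _ L (g L)
      step (no l≢L)   = trans (extend-off _ L (g L) l l<L)
        (trans (cong (λ x → decode L (n ∸ g L * w L) x l) (unshift-reshift (F L) (g L * w L) n _ _))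
          (decode-encode L _ g _ _ l l<L))
        where l<L = ≤∧≢⇒< (≤-pred l≤L) l≢L

    encode-injective : ∀ L n g h n<B e e′ → encode L n g n<B e ≡ encode L n h n<B e′ →
                       ∀ l → l < L → g l ≡ h l
    encode-injective L n g h n<B e e′ eq l l<L = trans (sym (decode-encode L n g n<B e l l<L))
      (trans (cong (λ x → decode L n x l) eq) (decode-encode L n h n<B e′ l l<L))

    decode-injective : ∀ L n x y → (∀ l → l < L → decode L n x l ≡ decode L n y l) → x ≡ y
    decode-injective zero    zero Fin.zero Fin.zero h = refl
    decode-injective (suc L) n x y h =
      project-injective _ B x y (step (project∑ _ B x) (project∑ _ B y) h)
      where
      step : ∀ s t → (∀ l → l < suc L → decodeStep L n s l ≡ decodeStep L n t l) → s ≡ t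
      step (j , x) (j′ , y) h
        with refl ← trans (sym (extend-at _ L j)) (trans (h L ≤-refl) (extend-at _ L j′)) =
        cong (j ,_) (unshift-injective (F L) (j * w L) n x y (decode-injective L _ _ _ (λ l l<L →
          trans (sym (extend-off _ L j l l<L)) (trans (h l (m<n⇒m<1+n l<L)) (extend-off _ L j l l<L)))))

-- MacMahon's product formula and the recurrence for `PL`.

module MacMahon where
  open import Data.Nat using (ℕ; suc; _+_; _*_; _≤_; _<_; z≤n; s≤s; _/_; _%_)
  open import Data.Nat.Properties
  open import Data.Nat.DivMod
  open import Data.Nat.Divisibility using (n∣m*n)
  open import Data.Fin using (Fin)
  open import Data.Fin.Properties using (injective⇒≤)
  open import Data.Product using (_,_)
  open import Function.Bundles using (Inverse)
  open import Relation.Binary.PropositionalEquality hiding (J)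
  open import Defs using (∑ℕ; ∑ℕ-cong; boxSum; PL; PL-cardinality; PlanePartition; module Enumerate)
  open Sums
  open Shift
  open Toggle
  open Counting
  open PlanePartition

  module _ (N′ : ℕ) where
    private
      N = suc N′

    -- Cell `(i , j)` of the square has number `i * N + j`, so quotient and remainder recover its
    -- coordinates.
    cellWeight : ℕ → ℕ
    cellWeight l = suc (l / N + l % N)

    index-/ : ∀ i {j} → j < N → (i * N + j) / N ≡ i
    index-/ i {j} j<N = trans (+-distrib-/-∣ˡ {i * N} j (n∣m*n i))
      (trans (cong₂ _+_ (m*n/n≡m i N) (m<n⇒m/n≡0 j<N)) (+-identityʳ i))

    index-% : ∀ i {j} → j < N → (i * N + j) % N ≡ j
    index-% i {j} j<N = trans (cong (_% N) (+-comm (i * N) j))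
      (trans ([m+kn]%n≡m%n j i N) (m<n⇒m%n≡m j<N))

    index-surjective : ∀ l → l / N * N + l % N ≡ l
    index-surjective l = trans (+-comm (l / N * N) (l % N)) (sym (m≡m%n+[m/n]*n l N))

    cellWeight-index : ∀ i {j} → j < N → cellWeight (i * N + j) ≡ suc (i + j)
    cellWeight-index i j<N = cong suc (cong₂ _+_ (index-/ i j<N) (index-% i j<N))

    index-< : ∀ {i j} → i < N → j < N → i * N + j < N * N
    index-< {i} {j} i<N j<N = <-≤-trans (+-monoʳ-< (i * N) j<N)
      (≤-trans (≤-reflexive (+-comm (i * N) N)) (*-monoˡ-≤ N i<N))

    flatten : (ℕ → ℕ → ℕ) → ℕ → ℕ
    flatten a l = a (l / N) (l % N)

    flatten-index : ∀ a i {j} → j < N → flatten a (i * N + j) ≡ a i j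
    flatten-index a i j<N = cong₂ a (index-/ i j<N) (index-% i j<N)

    ∑-cells : ∀ (g : ℕ → ℕ) (h : ℕ → ℕ → ℕ) → (∀ i j → i < N → j < N → g (i * N + j) ≡ h i j) →
              ∑ℕ (N * N) g ≡ ∑ℕ N (λ i → ∑ℕ N (h i))
    ∑-cells g h e = trans (∑-block N N g)
      (∑-cong< N (λ i i<N → ∑-cong< N (λ j j<N → e i j i<N j<N)))

    module _ (B : ℕ) where
      open Parts cellWeight B (λ _ → s≤s z≤n)

      module _ (n : ℕ) (n<B : n < B) (n≤N : n ≤ N) where
        private
          open Inverse (PL-cardinality n)

          column-step : ∀ (P : PlanePartition n) k i → entry P (suc i) k ≤ entry P i k
          column-step P k i = columns-mono P k (n≤1+n i)

          row-step : ∀ (P : PlanePartition n) k i → entry P k (suc i) ≤ entry P k i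
          row-step P k i = rows-mono P k (n≤1+n i)

          supported : ∀ (P : PlanePartition n) → Enumerate.Supported N (entry P)
          supported P .Enumerate.Supported.below i j N≤i =
            Enumerate.Supported.below (Enumerate.supported n P) i j (≤-trans n≤N N≤i)
          supported P .Enumerate.Supported.right i j N≤j =
            Enumerate.Supported.right (Enumerate.supported n P) i j (≤-trans n≤N N≤j)

          boxSum-N : ∀ (P : PlanePartition n) → boxSum N (entry P) ≡ n
          boxSum-N P = let (m₀ , h) = total P in
            trans (sym (Enumerate.boxSum-stable N (supported P) (N + m₀) (m≤m+n N m₀)))
                  (h (N + m₀) (m≤n+m m₀ N))

          cells : PlanePartition n → ℕ → ℕ
          cells P = flatten (matrix (entry P))

          cells-weight : ∀ P → weightOf (N * N) (cells P) ≡ n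
          cells-weight P = trans
            (∑-cells _ (λ i j → suc (i + j) * matrix (entry P) i j) (λ i j i<N j<N →
              trans (cong₂ _*_ (flatten-index (matrix (entry P)) i j<N) (cellWeight-index i j<N))
                    (*-comm (matrix (entry P) i j) (suc (i + j)))))
            (trans (sym (Forward.boxSum-weight (entry P) (column-step P) (row-step P) N (supported P)))
                   (boxSum-N P))

          code : PlanePartition n → Fin (partsCount cellWeight B (N * N) n)
          code P = encode (N * N) n (cells P) n<B (cells-weight P)

          code-injective : ∀ P Q → code P ≡ code Q → ∀ i j → entry P i j ≡ entry Q i j
          code-injective P Q e = matrix-injective N
            (column-step P) (row-step P) (supported P) (column-step Q) (row-step Q) (supported Q)
            (λ i j i<N j<N → trans (sym (flatten-index (matrix (entry P)) i j<N))
              (trans (encode-injective (N * N) n (cells P) (cells Q) n<B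
                        (cells-weight P) (cells-weight Q) e _ (index-< i<N j<N))
                     (flatten-index (matrix (entry Q)) i j<N)))

          module _ (x : Fin (partsCount cellWeight B (N * N) n)) where
            values : ℕ → ℕ → ℕ
            values i j = decode (N * N) n x (i * N + j)
            open Backward N values

            plane : PlanePartition n
            plane = record
              { entry        = array
              ; columns-mono = λ k → Enumerate.antitone N (λ i → array i k) (array-column k)
              ; rows-mono    = λ k → Enumerate.antitone N (array k) (array-row k)
              ; total        = N , λ m N≤m → trans (Enumerate.boxSum-stable N array-supported m N≤m)
                  (trans (Forward.boxSum-weight array array-column array-row N array-supported)
                    (trans (sym (∑-cells _ _ λ i j i<N j<N →
                        trans (*-comm (decode (N * N) n x (i * N + j)) _)
                          (cong₂ _*_ (cellWeight-index i j<N) (sym (matrix-array i j i<N j<N)))))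
                      (decode-weight (N * N) n x)))
              }

          plane-injective : ∀ x y → (∀ i j → entry (plane x) i j ≡ entry (plane y) i j) → x ≡ y
          plane-injective x y e = decode-injective (N * N) n x y λ l l<NN →
            let i<N = m<n*o⇒m/o<n {l} {N} {N} l<NN
                j<N = m%n<n l N
            in subst (λ l → decode (N * N) n x l ≡ decode (N * N) n y l) (index-surjective l)
                 (trans (sym (Backward.matrix-array N (values x) _ _ i<N j<N))
                   (trans (matrix-cong e (l / N) (l % N))
                     (Backward.matrix-array N (values y) _ _ i<N j<N)))

        -- Finite types that inject into each other have equal size. `N` and `B` may exceed `n`,
        -- because the recurrence at `n` compares `PL k` for all `k ≤ n` with one and the same
        -- product.
        PL≡partsCount : PL n ≡ partsCount cellWeight B (N * N) n
        PL≡partsCount = ≤-antisym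
          (injective⇒≤ {f = λ i → code (from i)} λ {i} {j} e →
            trans (sym (strictlyInverseˡ i))
              (trans (to-cong (code-injective (from i) (from j) e)) (strictlyInverseˡ j)))
          (injective⇒≤ {f = λ x → to (plane x)} λ {x} {y} e →
            plane-injective x y λ i j →
              trans (sym (strictlyInverseʳ (plane x) i j))
                (trans (from-cong e i j) (strictlyInverseʳ (plane y) i j)))

  -- An antidiagonal contributes `suc d` cells of weight `suc d`, and the derivative brings down
  -- that weight once more: hence the square.
  PL-recurrence : ∀ n → n * PL n ≡
    ∑ℕ (suc n) (λ d → suc d * (suc d * ∑ℕ (suc n) (λ m → shift (suc m * suc d) PL n)))
  PL-recurrence n = begin
    n * PL n
      ≡⟨ cong (n *_) (PL≡F n ≤-refl) ⟩
    n * F n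
      ≡⟨ partsCount-recurrence (cellWeight n) (suc n) (λ _ → s≤s z≤n) (suc n * suc n) n ≤-refl ⟩
    ∑ℕ (suc n * suc n) (λ l → cellWeight n l * ∑ℕ (suc n) (λ m → shift (suc m * cellWeight n l) F n))
      ≡⟨ ∑-cells n _ (λ i j → h (i + j)) (λ i j i<N j<N →
           trans (cong (λ w → w * ∑ℕ (suc n) (λ m → shift (suc m * w) F n)) (cellWeight-index n i j<N))
             (cong (suc (i + j) *_) (∑ℕ-cong (suc n) (λ m →
               shift-cong (suc m * suc (i + j)) n (λ k k≤n → sym (PL≡F k k≤n)))))) ⟩
    ∑ℕ (suc n) (λ i → ∑ℕ (suc n) (λ j → h (i + j)))
      ≡⟨ ∑-antidiagonal (suc n) h (λ d n<d → trans
           (cong (suc d *_) (∑-zero< (suc n) (λ m _ → shift-> (suc m * suc d) PL n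
             (≤-trans n<d (≤-trans (n≤1+n d) (m≤m+n (suc d) (m * suc d)))))))
           (*-zeroʳ (suc d))) ⟩
    ∑ℕ (suc n) (λ d → suc d * h d) ∎
    where
    open ≡-Reasoning
    F : ℕ → ℕ
    F = partsCount (cellWeight n) (suc n) (suc n * suc n)
    h : ℕ → ℕ
    h d = suc d * ∑ℕ (suc n) (λ m → shift (suc m * suc d) PL n)
    PL≡F : ∀ k → k ≤ n → PL k ≡ F k
    PL≡F k k≤n = PL≡partsCount n (suc n) k (s≤s k≤n) (m≤n⇒m≤1+n k≤n)

-- Rational arithmetic: embedding of the naturals, sums and powers.

module Rational where
  open import Data.Nat as ℕ using (ℕ; zero; suc)
  import Data.Nat.Properties as ℕₚ
  import Data.Integer as ℤ
  open import Data.Rational as ℚ using (ℚ; 0ℚ; 1ℚ; _+_; _*_; _-_; -_; _≤_; _<_; _/_; positive; nonNegative)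
  open import Data.Rational.Properties
  open import Data.Rational.Solver using (module +-*-Solver)
  open import Algebra.Definitions.RawSemiring ℚ.+-*-rawSemiring using () renaming (_^_ to _^ℚ_)
  open import Data.Product using (∃-syntax; _×_; _,_)
  open import Data.Empty using (⊥-elim)
  open import Relation.Nullary using (yes; no)
  open import Relation.Binary.PropositionalEquality
  open import Defs using (/-+-/; /-*-/; /-≤; ∑ℚ; ∑ℚ-+; *-mono-≤-nonNeg; ^-nonNeg; 1/suc_; 1/suc-pos;
    module RootCauchy)
  open +-*-Solver using (solve; _:+_; _:*_; _:=_)

  opaque
    ι : ℕ → ℚ
    ι n = ℤ.+ n / 1

    ι≡ : ∀ n → ι n ≡ ℤ.+ n / 1
    ι≡ n = refl

    ι-+ : ∀ m n → ι (m ℕ.+ n) ≡ ι m + ι n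
    ι-+ m n = sym (/-+-/ m n 1)

    ι-* : ∀ m n → ι (m ℕ.* n) ≡ ι m * ι n
    ι-* m n = sym (/-*-/ m 1 n 1 (m ℕ.* n) 1 refl)

    ι-mono : ∀ {m n} → m ℕ.≤ n → ι m ≤ ι n
    ι-mono {m} {n} m≤n = /-≤ m 1 n 1 (ℕₚ.*-monoˡ-≤ 1 m≤n)

    ι*1/suc : ∀ n → ι (suc n) * (1/suc n) ≡ 1ℚ
    ι*1/suc n = /-*-/ (suc n) 1 1 (suc n) 1 1 (trans (ℕₚ.*-identityʳ _)
      (trans (ℕₚ.*-identityʳ (suc n)) (sym (trans (ℕₚ.*-identityˡ _) (ℕₚ.*-identityˡ _)))))

    ≤ι : ∀ q → ∃[ n ] q < ι n
    ≤ι q = suc ℤ.∣ ℚ.↥ q ∣ , RootCauchy.<1+∣↥∣ 0 q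

  ι-0 : ι 0 ≡ 0ℚ
  ι-0 = ι≡ 0

  ι-1 : ι 1 ≡ 1ℚ
  ι-1 = ι≡ 1

  ι-suc : ∀ n → ι (suc n) ≡ 1ℚ + ι n
  ι-suc n = trans (ι-+ 1 n) (cong (_+ ι n) ι-1)

  0≤ι : ∀ n → 0ℚ ≤ ι n
  0≤ι n = subst (_≤ ι n) ι-0 (ι-mono ℕ.z≤n)

  0<1 : 0ℚ < 1ℚ
  0<1 = positive⁻¹ 1ℚ

  0<ι : ∀ n → 0ℚ < ι (suc n)
  0<ι n = <-≤-trans 0<1 (subst (_≤ ι (suc n)) ι-1 (ι-mono (ℕ.s≤s ℕ.z≤n)))

  ι-mono-< : ∀ {m n} → m ℕ.< n → ι m < ι n
  ι-mono-< {m} {n} m<n = <-≤-trans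
    (subst₂ _<_ (+-identityˡ (ι m)) (sym (ι-suc m)) (+-monoˡ-< (ι m) 0<1)) (ι-mono m<n)

  ι-cancel : ∀ {m n} → ι m ≤ ι n → m ℕ.≤ n
  ι-cancel {m} {n} le with m ℕ.≤? n
  ... | yes m≤n = m≤n
  ... | no m≰n  = ⊥-elim (<-irrefl refl (<-≤-trans (ι-mono-< (ℕₚ.≰⇒> m≰n)) le))

  ι-cancel-< : ∀ {m n} → ι m < ι n → m ℕ.< n
  ι-cancel-< {m} {n} lt with m ℕ.<? n
  ... | yes m<n = m<n
  ... | no m≮n  = ⊥-elim (<-irrefl refl (<-≤-trans lt (ι-mono (ℕₚ.≮⇒≥ m≮n))))

  infixl 6 _⊕_
  infixl 7 _⊗_
  _⊕_ : ∀ {p q} → 0ℚ ≤ p → 0ℚ ≤ q → 0ℚ ≤ p + q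
  _⊕_ = +-mono-≤

  _⊗_ : ∀ {p q} → 0ℚ ≤ p → 0ℚ ≤ q → 0ℚ ≤ p * q
  _⊗_ {p} {q} a b = subst (_≤ p * q) (*-zeroˡ 0ℚ) (*-mono-≤-nonNeg ≤-refl a ≤-refl b)

  -- Polynomial inequalities are certified by an explicit nonnegative difference, which leaves a
  -- ring identity to check.
  ≤-by : ∀ {p q} r → 0ℚ ≤ r → p + r ≡ q → p ≤ q
  ≤-by {p} r 0≤r e = subst₂ _≤_ (+-identityʳ p) e (+-monoʳ-≤ p 0≤r)

  ≤⇒0≤- : ∀ {p q} → p ≤ q → 0ℚ ≤ q - p
  ≤⇒0≤- {p} {q} le = subst (_≤ q - p) (+-inverseʳ p) (+-monoˡ-≤ (- p) le)

  *-monoʳ : ∀ {p q r} → 0ℚ ≤ r → p ≤ q → p * r ≤ q * r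
  *-monoʳ {r = r} 0≤r = *-monoʳ-≤-nonNeg r {{nonNegative 0≤r}}

  *-monoˡ : ∀ {p q r} → 0ℚ ≤ r → p ≤ q → r * p ≤ r * q
  *-monoˡ {r = r} 0≤r = *-monoˡ-≤-nonNeg r {{nonNegative 0≤r}}

  *-cancelʳ : ∀ {p q r} → 0ℚ < r → p * r ≤ q * r → p ≤ q
  *-cancelʳ {r = r} 0<r = *-cancelʳ-≤-pos r {{positive 0<r}}

  0≤1/suc : ∀ n → 0ℚ ≤ 1/suc n
  0≤1/suc n = <⇒≤ (1/suc-pos n)

  floor : ∀ {q} → 0ℚ ≤ q → ∃[ n ] (ι n ≤ q × q < ι (suc n))
  floor {q} 0≤q = let (B , q<B) = ≤ι q in go B q<B
    where
    go : ∀ B → q < ι B → ∃[ n ] (ι n ≤ q × q < ι (suc n))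
    go zero    q<0 = ⊥-elim (<-irrefl (sym ι-0) (≤-<-trans 0≤q q<0))
    go (suc B) q<B with ι B ≤? q
    ... | yes B≤q = B , B≤q , q<B
    ... | no B≰q  = go B (≰⇒> B≰q)

  ∑ℚ-cong< : ∀ m {f g} → (∀ i → i ℕ.< m → f i ≡ g i) → ∑ℚ m f ≡ ∑ℚ m g
  ∑ℚ-cong< zero    h = refl
  ∑ℚ-cong< (suc m) h = cong₂ _+_ (∑ℚ-cong< m (λ i i<m → h i (ℕₚ.m<n⇒m<1+n i<m))) (h m ℕₚ.≤-refl)

  ∑ℚ-mono : ∀ m {f g} → (∀ i → i ℕ.< m → f i ≤ g i) → ∑ℚ m f ≤ ∑ℚ m g
  ∑ℚ-mono zero    h = ≤-refl
  ∑ℚ-mono (suc m) h = +-mono-≤ (∑ℚ-mono m (λ i i<m → h i (ℕₚ.m<n⇒m<1+n i<m))) (h m ℕₚ.≤-refl)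

  0≤∑ℚ : ∀ m {f} → (∀ i → i ℕ.< m → 0ℚ ≤ f i) → 0ℚ ≤ ∑ℚ m f
  0≤∑ℚ zero    h = ≤-refl
  0≤∑ℚ (suc m) h = 0≤∑ℚ m (λ i i<m → h i (ℕₚ.m<n⇒m<1+n i<m)) ⊕ h m ℕₚ.≤-refl

  ∑ℚ-range : ∀ m n {f} → m ℕ.≤ n → (∀ i → 0ℚ ≤ f i) → ∑ℚ m f ≤ ∑ℚ n f
  ∑ℚ-range m n {f} m≤n h = subst (λ n → ∑ℚ m f ≤ ∑ℚ n f) (ℕₚ.m+[n∸m]≡n m≤n)
    (≤-by _ (0≤∑ℚ (n ℕ.∸ m) (λ i _ → h (m ℕ.+ i))) (sym (∑ℚ-+ m (n ℕ.∸ m) f)))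

  ∑ℚ-distribˡ : ∀ m c f → ∑ℚ m (λ i → c * f i) ≡ c * ∑ℚ m f
  ∑ℚ-distribˡ zero    c f = sym (*-zeroʳ c)
  ∑ℚ-distribˡ (suc m) c f = trans (cong (_+ c * f m) (∑ℚ-distribˡ m c f))
    (sym (*-distribˡ-+ c (∑ℚ m f) (f m)))

  ∑ℚ-distrib-+ : ∀ m f g → ∑ℚ m (λ i → f i + g i) ≡ ∑ℚ m f + ∑ℚ m g
  ∑ℚ-distrib-+ zero    f g = refl
  ∑ℚ-distrib-+ (suc m) f g = trans (cong (_+ (f m + g m)) (∑ℚ-distrib-+ m f g))
    (solve 4 (λ a b c d → (a :+ b) :+ (c :+ d) := (a :+ c) :+ (b :+ d)) refl (∑ℚ m f) (∑ℚ m g) (f m) (g m))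

  ^-+ : ∀ a m n → a ^ℚ (m ℕ.+ n) ≡ a ^ℚ m * a ^ℚ n
  ^-+ a zero    n = sym (*-identityˡ _)
  ^-+ a (suc m) n = trans (cong (a *_) (^-+ a m n)) (sym (*-assoc a _ _))

  ^-* : ∀ a m n → a ^ℚ (n ℕ.* m) ≡ (a ^ℚ m) ^ℚ n
  ^-* a m zero    = refl
  ^-* a m (suc n) = trans (^-+ a m (n ℕ.* m)) (cong (a ^ℚ m *_) (^-* a m n))

  *-^ : ∀ a b n → (a * b) ^ℚ n ≡ a ^ℚ n * b ^ℚ n
  *-^ a b zero    = refl
  *-^ a b (suc n) = trans (cong (a * b *_) (*-^ a b n))
    (solve 4 (λ a b c d → a :* b :* (c :* d) := (a :* c) :* (b :* d)) refl a b (a ^ℚ n) (b ^ℚ n))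

  1^ : ∀ n → 1ℚ ^ℚ n ≡ 1ℚ
  1^ zero    = refl
  1^ (suc n) = trans (*-identityˡ _) (1^ n)

  ^≤1 : ∀ {a} → 0ℚ ≤ a → a ≤ 1ℚ → ∀ n → a ^ℚ n ≤ 1ℚ
  ^≤1 0≤a a≤1 zero    = ≤-refl
  ^≤1 0≤a a≤1 (suc n) = *-mono-≤-nonNeg 0≤a a≤1 (^-nonNeg 0≤a n) (^≤1 0≤a a≤1 n)

-- Bounds for `log` from rational certificates.

module Logarithm where
  open import Data.Nat as ℕ using (ℕ; zero; suc)
  import Data.Nat.Properties as ℕₚ
  import Data.Integer as ℤ
  open import Data.Rational as ℚ using (ℚ; 0ℚ; 1ℚ; ½; _+_; _*_; _-_; -_; _≤_; _<_; _/_)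
  open import Data.Rational.Properties
  open import Data.Rational.Solver using (module +-*-Solver)
  open import Algebra.Definitions.RawSemiring ℚ.+-*-rawSemiring using () renaming (_^_ to _^ℚ_)
  open import Data.Product using (∃-syntax; _,_)
  open import Relation.Binary.PropositionalEquality
  open import Defs using (/-*-/; /-≤; ∑ℚ; ∑ℚ-+; *-mono-≤-nonNeg; 1/suc_; 1/suc-antitone; halves; half-pos;
    logSeq; log; ℝ; const≤∑ℚ; ∑ℚ≤const; p≤∣p∣; ^-nonNeg)
  open +-*-Solver using (solve; _:+_; _:*_; _:-_; :-_; _:=_; con)
  open Rational

  -- s ≲ t compares the limits of s and t.
  infix 4 _≲_
  record _≲_ (s t : ℕ → ℚ) : Set where
    constructor mk≲
    field
      within : ∀ ε → 0ℚ < ε → ∃[ K ] (∀ k → K ℕ.≤ k → s k ≤ t k + ε)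
  open _≲_ public

  ≤⇒≲ : ∀ {s t : ℕ → ℚ} → (∀ k → s k ≤ t k) → s ≲ t
  ≤⇒≲ {s} {t} h = mk≲ λ ε 0<ε → 0 , λ k _ → ≤-by _ (≤⇒0≤- (h k) ⊕ <⇒≤ 0<ε)
    (solve 3 (λ s t e → s :+ ((t :- s) :+ e) := t :+ e) refl (s k) (t k) ε)

  ≲-trans : ∀ {s t u} → s ≲ t → t ≲ u → s ≲ u
  ≲-trans {s} {t} {u} a b = mk≲ λ ε 0<ε →
    let (K , h) = within a (½ * ε) (half-pos 0<ε) ; (L , g) = within b (½ * ε) (half-pos 0<ε) in
    K ℕ.+ L , λ k K+L≤k → ≤-trans (h k (ℕₚ.m+n≤o⇒m≤o K K+L≤k))
      (≤-trans (+-monoˡ-≤ (½ * ε) (g k (ℕₚ.m+n≤o⇒n≤o K K+L≤k)))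
        (≤-reflexive (trans (+-assoc (u k) _ _) (cong (u k +_) (halves ε)))))

  ≲-+ : ∀ {s t s′ t′} → s ≲ t → s′ ≲ t′ → (λ k → s k + s′ k) ≲ (λ k → t k + t′ k)
  ≲-+ {s} {t} {s′} {t′} a b = mk≲ λ ε 0<ε →
    let (K , h) = within a (½ * ε) (half-pos 0<ε) ; (L , g) = within b (½ * ε) (half-pos 0<ε) in
    K ℕ.+ L , λ k K+L≤k → ≤-trans
      (+-mono-≤ (h k (ℕₚ.m+n≤o⇒m≤o K K+L≤k)) (g k (ℕₚ.m+n≤o⇒n≤o K K+L≤k)))
      (≤-reflexive (trans
        (solve 3 (λ x y e → (x :+ e) :+ (y :+ e) := (x :+ y) :+ (e :+ e)) refl (t k) (t′ k) (½ * ε))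
        (cong (t k + t′ k +_) (halves ε))))

  ≲-cancelʳ : ∀ {s t} (u : ℕ → ℚ) → (λ k → s k + u k) ≲ (λ k → t k + u k) → s ≲ t
  ≲-cancelʳ {s} {t} u a = mk≲ λ ε 0<ε → let (K , h) = within a ε 0<ε in
    K , λ k K≤k → ≤-by _ (≤⇒0≤- (h k K≤k))
      (solve 4 (λ s t u e → s :+ (((t :+ u) :+ e) :- (s :+ u)) := t :+ e) refl (s k) (t k) (u k) ε)

  logSeq-mono : ∀ {a b} → a ℕ.≤ b → ∀ k → logSeq a k ≤ logSeq b k
  logSeq-mono a≤b k = ∑ℚ-range _ _ (ℕₚ.*-monoʳ-≤ (suc k) (ℕₚ.pred-mono-≤ a≤b)) (λ i → 0≤1/suc (suc k ℕ.+ i))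

  logSeq-1 : ∀ k → logSeq 1 k ≡ 0ℚ
  logSeq-1 k = cong (λ m → ∑ℚ m (λ j → 1/suc (suc k ℕ.+ j))) (ℕₚ.*-zeroʳ (suc k))

  -- For factors A and B the integral up to A B splits at A, and rescaling by A turns mesh 1/M on
  -- [A , A B] into mesh 1/(M A) on [1 , B]. The identity is exact, with the second Riemann sum
  -- taken at a finer level.
  logSeq-* : ∀ a b k →
    logSeq (suc a ℕ.* suc b) k ≡ logSeq (suc a) k + logSeq (suc b) (a ℕ.+ k ℕ.* suc a)
  logSeq-* a b k = trans
    (cong (λ n → ∑ℚ n g) (trans (cong (suc k ℕ.*_) (ℕₚ.+-comm b (a ℕ.* suc b)))
      (trans (cong (λ c → suc k ℕ.* (c ℕ.+ b)) (ℕₚ.*-suc a b))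
        (trans (cong (suc k ℕ.*_) (ℕₚ.+-assoc a (a ℕ.* b) b))
          (trans (ℕₚ.*-distribˡ-+ (suc k) a (a ℕ.* b ℕ.+ b))
            (cong (suc k ℕ.* a ℕ.+_) (trans (cong (suc k ℕ.*_) (ℕₚ.+-comm (a ℕ.* b) b))
              (sym (ℕₚ.*-assoc (suc k) (suc a) b)))))))))
    (trans (∑ℚ-+ (suc k ℕ.* a) (suc k ℕ.* suc a ℕ.* b) g)
      (cong (logSeq (suc a) k +_) (∑ℚ-cong< (suc k ℕ.* suc a ℕ.* b) (λ i _ →
        cong 1/suc_ (trans (sym (ℕₚ.+-assoc (suc k) (suc k ℕ.* a) i))
          (cong (ℕ._+ i) (sym (ℕₚ.*-suc (suc k) a))))))))
    where
    g : ℕ → ℚ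
    g j = 1/suc (suc k ℕ.+ j)

  private
    close : ∀ b ε → 0ℚ < ε → ∃[ K ] (∀ k l → K ℕ.≤ k → K ℕ.≤ l →
            logSeq (suc b) k ≤ logSeq (suc b) l + ε)
    close b ε 0<ε = let (K , h) = ℝ.cauchy (log (suc b)) ε 0<ε in
      K , λ k l K≤k K≤l → ≤-by _ (≤⇒0≤- (≤-trans (p≤∣p∣ _) (<⇒≤ (h k l K≤k K≤l))))
        (solve 3 (λ x y e → x :+ (e :- (x :- y)) := y :+ e) refl (logSeq (suc b) k) (logSeq (suc b) l) ε)

    later : ∀ a k → k ℕ.≤ a ℕ.+ k ℕ.* suc a
    later a k = ℕₚ.≤-trans (ℕₚ.m≤m*n k (suc a)) (ℕₚ.m≤n+m _ a)

  log-*-≲ : ∀ a b → logSeq (suc a ℕ.* suc b) ≲ (λ k → logSeq (suc a) k + logSeq (suc b) k)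
  log-*-≲ a b = mk≲ λ ε 0<ε → let (K , h) = close b ε 0<ε in
    K , λ k K≤k → ≤-trans (≤-reflexive (logSeq-* a b k))
      (≤-trans (+-monoʳ-≤ (logSeq (suc a) k) (h _ k (ℕₚ.≤-trans K≤k (later a k)) K≤k))
        (≤-reflexive (sym (+-assoc (logSeq (suc a) k) _ ε))))

  log-*-≳ : ∀ a b → (λ k → logSeq (suc a) k + logSeq (suc b) k) ≲ logSeq (suc a ℕ.* suc b)
  log-*-≳ a b = mk≲ λ ε 0<ε → let (K , h) = close b ε 0<ε in
    K , λ k K≤k → ≤-trans
      (+-monoʳ-≤ (logSeq (suc a) k) (h k _ K≤k (ℕₚ.≤-trans K≤k (later a k))))
      (≤-reflexive (trans (sym (+-assoc (logSeq (suc a) k) _ ε)) (cong (_+ ε) (sym (logSeq-* a b k)))))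

  private
    scale : ∀ k n → (ℤ.+ suc k / 1) * (ℤ.+ 1 / (suc k ℕ.* suc n)) ≡ 1/suc n
    scale k n = /-*-/ (suc k) 1 1 (suc k ℕ.* suc n) 1 (suc n)
      (trans (cong (ℕ._* suc n) (ℕₚ.*-identityʳ (suc k)))
        (sym (trans (ℕₚ.*-identityˡ _) (ℕₚ.*-identityˡ _))))

    extra : ℕ → ℕ → ℚ
    extra n k = ∑ℚ (suc k) (λ i → 1/suc (suc k ℕ.* suc n ℕ.+ i))

    logSeq-suc : ∀ n k → logSeq (suc (suc n)) k ≡ logSeq (suc n) k + extra n k
    logSeq-suc n k = trans
      (cong (λ m → ∑ℚ m g) (trans (ℕₚ.*-suc (suc k) n) (ℕₚ.+-comm (suc k) _)))
      (trans (∑ℚ-+ (suc k ℕ.* n) (suc k) g)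
        (cong (logSeq (suc n) k +_) (∑ℚ-cong< (suc k) (λ i _ → cong 1/suc_
          (trans (sym (ℕₚ.+-assoc (suc k) (suc k ℕ.* n) i))
            (cong (ℕ._+ i) (sym (ℕₚ.*-suc (suc k) n))))))))
      where
      g : ℕ → ℚ
      g j = 1/suc (suc k ℕ.+ j)

  -- The unit interval added to the integral contributes `suc k` summands, each at most
  -- `1/(suc k * suc n)`.
  log-suc-≤ : ∀ n k → logSeq (suc (suc n)) k ≤ logSeq (suc n) k + 1/suc n
  log-suc-≤ n k = ≤-trans (≤-reflexive (logSeq-suc n k)) (+-monoʳ-≤ (logSeq (suc n) k)
    (≤-trans (∑ℚ≤const (suc k) _ (ℤ.+ 1 / (suc k ℕ.* suc n)) (λ i _ →
        /-≤ 1 (suc (suc k ℕ.* suc n ℕ.+ i)) 1 (suc k ℕ.* suc n)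
          (ℕₚ.*-monoʳ-≤ 1 (ℕₚ.m≤n⇒m≤1+n (ℕₚ.m≤m+n _ i)))))
      (≤-reflexive (scale k n))))

  log-suc-≥ : ∀ n k → logSeq (suc n) k + 1/suc (suc n) ≤ logSeq (suc (suc n)) k
  log-suc-≥ n k = ≤-trans (+-monoʳ-≤ (logSeq (suc n) k)
    (≤-trans (≤-reflexive (sym (scale k (suc n))))
      (const≤∑ℚ (suc k) _ (ℤ.+ 1 / (suc k ℕ.* suc (suc n))) (λ i i≤k →
        /-≤ 1 (suc k ℕ.* suc (suc n)) 1 (suc (suc k ℕ.* suc n ℕ.+ i))
          (ℕₚ.*-monoʳ-≤ 1 (ℕₚ.≤-trans (ℕₚ.≤-reflexive (sym (ℕₚ.+-suc (suc k ℕ.* suc n) i)))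
            (ℕₚ.≤-trans (ℕₚ.+-monoʳ-≤ (suc k ℕ.* suc n) i≤k)
              (ℕₚ.≤-reflexive (trans (ℕₚ.+-comm (suc k ℕ.* suc n) (suc k))
                (sym (ℕₚ.*-suc (suc k) (suc n))))))))))))
    (≤-reflexive (sym (logSeq-suc n k)))

  -- log q ≤ u, witnessed by a fraction above q.
  record Log≤ (q u : ℚ) : Set where
    field
      num den  : ℕ
      fraction : q * ι (suc den) ≤ ι (suc num)
      bound    : logSeq (suc num) ≲ (λ k → logSeq (suc den) k + u)
  open Log≤

  Log≤-1 : Log≤ 1ℚ 0ℚ
  Log≤-1 = record
    { num = 0 ; den = 0 ; fraction = ≤-reflexive (*-identityˡ (ι 1))
    ; bound = ≤⇒≲ (λ k → ≤-reflexive (sym (+-identityʳ _))) }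

  -- Numerators and denominators multiply, and `log` is additive in the limit. So the constants of
  -- the inductions, products of powers of explicit fractions, have computable logarithmic bounds.
  Log≤-* : ∀ {q r u v} → 0ℚ ≤ q → 0ℚ ≤ r → Log≤ q u → Log≤ r v → Log≤ (q * r) (u + v)
  Log≤-* {q} {r} {u} {v} 0≤q 0≤r Q R = record
    { num = num R ℕ.+ num Q ℕ.* suc (num R)
    ; den = den R ℕ.+ den Q ℕ.* suc (den R)
    ; fraction = subst₂ _≤_
        (trans (solve 4 (λ q a r b → (q :* a) :* (r :* b) := (q :* r) :* (a :* b)) refl
                 q (ι (suc (den Q))) r (ι (suc (den R))))
          (cong (q * r *_) (sym (ι-* (suc (den Q)) (suc (den R))))))
        (sym (ι-* (suc (num Q)) (suc (num R))))
        (*-mono-≤-nonNeg (0≤q ⊗ 0≤ι _) (fraction Q) (0≤r ⊗ 0≤ι _) (fraction R))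
    ; bound = ≲-trans (log-*-≲ (num Q) (num R)) (≲-trans (≲-+ (bound Q) (bound R))
        (≲-trans (≤⇒≲ (λ k → ≤-reflexive
            (solve 4 (λ a u b v → (a :+ u) :+ (b :+ v) := (a :+ b) :+ (u :+ v)) refl
              (logSeq (suc (den Q)) k) u (logSeq (suc (den R)) k) v)))
          (≲-+ (log-*-≳ (den Q) (den R)) (≤⇒≲ (λ _ → ≤-refl)))))
    }

  Log≤-weaken : ∀ {q q′ u u′} → q′ ≤ q → u ≤ u′ → Log≤ q u → Log≤ q′ u′
  Log≤-weaken q′≤q u≤u′ Q = record
    { num = num Q ; den = den Q
    ; fraction = ≤-trans (*-monoʳ (0≤ι (suc (den Q))) q′≤q) (fraction Q)
    ; bound = ≲-trans (bound Q) (≤⇒≲ (λ k → +-monoʳ-≤ (logSeq (suc (den Q)) k) u≤u′)) }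

  Log≤-^ : ∀ {q u} → 0ℚ ≤ q → Log≤ q u → ∀ k → Log≤ (q ^ℚ k) (ι k * u)
  Log≤-^ {u = u} 0≤q Q zero    = Log≤-weaken ≤-refl
    (≤-reflexive (sym (trans (cong (_* u) ι-0) (*-zeroˡ u)))) Log≤-1
  Log≤-^ {u = u} 0≤q Q (suc k) = Log≤-weaken ≤-refl
    (≤-reflexive (trans (solve 2 (λ k u → u :+ k :* u := (con 1ℚ :+ k) :* u) refl (ι k) u)
      (cong (_* u) (sym (ι-suc k)))))
    (Log≤-* 0≤q (^-nonNeg 0≤q k) Q (Log≤-^ 0≤q Q k))

  Log≤-1+ : ∀ n → Log≤ (1ℚ + 1/suc n) (1/suc n)
  Log≤-1+ n = record
    { num = suc n ; den = n
    ; fraction = ≤-reflexive (trans (*-distribʳ-+ (ι (suc n)) 1ℚ (1/suc n))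
        (trans (cong₂ _+_ (*-identityˡ (ι (suc n))) (trans (*-comm (1/suc n) (ι (suc n))) (ι*1/suc n)))
          (trans (+-comm (ι (suc n)) 1ℚ) (sym (ι-suc (suc n))))))
    ; bound = ≤⇒≲ (log-suc-≤ n) }

  Log≤-1- : ∀ n → Log≤ (1ℚ - 1/suc (suc n)) (- (1/suc (suc n)))
  Log≤-1- n = record
    { num = n ; den = suc n
    ; fraction = ≤-reflexive (trans
        (solve 2 (λ i a → (con 1ℚ :- i) :* a := a :- a :* i) refl (1/suc (suc n)) (ι (suc (suc n))))
        (trans (cong₂ _-_ (ι-suc (suc n)) (ι*1/suc (suc n)))
          (solve 1 (λ a → (con 1ℚ :+ a) :- con 1ℚ := a) refl (ι (suc n)))))
    ; bound = ≤⇒≲ (λ k → ≤-by _ (≤⇒0≤- (log-suc-≥ n k))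
        (solve 3 (λ a b i → a :+ (b :- (a :+ i)) := b :+ (:- i)) refl
          (logSeq (suc n) k) (logSeq (suc (suc n)) k) (1/suc (suc n)))) }

  -- Every summand of the Riemann sum is at most `1/suc k`. Crude, but it serves only for the
  -- constant that starts the upper induction.
  Log≤-ι : ∀ n → Log≤ (ι (suc n)) (ι n)
  Log≤-ι n = record
    { num = n ; den = 0 ; fraction = ≤-reflexive (trans (cong (ι (suc n) *_) ι-1) (*-identityʳ _))
    ; bound = ≤⇒≲ (λ k → ≤-trans (∑ℚ≤const (suc k ℕ.* n) _ (1/suc k) (λ i _ →
          1/suc-antitone (ℕₚ.≤-trans (ℕₚ.n≤1+n k) (ℕₚ.m≤m+n (suc k) i))))
        (≤-reflexive (trans (cong (_* (1/suc k)) (trans (sym (ι≡ (suc k ℕ.* n))) (ι-* (suc k) n)))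
          (trans (solve 3 (λ a b c → (a :* b) :* c := (a :* c) :* b) refl (ι (suc k)) (ι n) (1/suc k))
            (trans (cong (_* ι n) (ι*1/suc k))
              (trans (*-identityˡ (ι n)) (trans (sym (+-identityˡ (ι n)))
                (cong (_+ ι n) (sym (logSeq-1 k)))))))))) }

  log-upper : ∀ {p q u} → ι (suc p) ≤ q → Log≤ q u → logSeq (suc p) ≲ (λ _ → u)
  log-upper {p} {q} {u} p≤q Q = ≲-cancelʳ (logSeq (suc (den Q)))
    (≲-trans (log-*-≳ p (den Q)) (≲-trans (≤⇒≲ (logSeq-mono le))
      (≲-trans (bound Q) (≤⇒≲ (λ k → ≤-reflexive (+-comm _ u))))))
    where
    le : suc p ℕ.* suc (den Q) ℕ.≤ suc (num Q)
    le = ι-cancel (≤-trans (≤-reflexive (ι-* (suc p) (suc (den Q))))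
           (≤-trans (*-monoʳ (0≤ι (suc (den Q))) p≤q) (fraction Q)))

  -- `q` is at least the reciprocal of `suc p`, so an upper bound for its logarithm is a lower bound
  -- for that of `suc p`: the one-sided `Log≤` serves both directions.
  log-lower : ∀ {p q u} → 1ℚ ≤ ι (suc p) * q → Log≤ q u → (λ _ → - u) ≲ logSeq (suc p)
  log-lower {p} {q} {u} 1≤ Q = ≲-cancelʳ (λ k → logSeq (suc (den Q)) k + u)
    (≲-trans (≤⇒≲ (λ k → ≤-reflexive
        (solve 2 (λ a u → (:- u) :+ (a :+ u) := a) refl (logSeq (suc (den Q)) k) u)))
      (≲-trans (≤⇒≲ (logSeq-mono le)) (≲-trans (log-*-≲ p (num Q))
        (≲-+ {logSeq (suc p)} (≤⇒≲ (λ _ → ≤-refl)) (bound Q)))))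
    where
    D = ι (suc (den Q))
    le : suc (den Q) ℕ.≤ suc p ℕ.* suc (num Q)
    le = ι-cancel (≤-trans (≤-reflexive (sym (*-identityˡ D)))
      (≤-trans (*-monoʳ (0≤ι (suc (den Q))) 1≤)
        (≤-trans (≤-reflexive (*-assoc (ι (suc p)) q D))
          (≤-trans (*-monoˡ (0≤ι (suc p)) (fraction Q)) (≤-reflexive (sym (ι-* (suc p) (suc (num Q)))))))))

-- Sums of squares against powers of `χ n`, from above.

module Geometric where
  open import Data.Nat as ℕ using (ℕ; zero; suc)
  import Data.Nat.Properties as ℕₚ
  import Data.Integer as ℤ
  open import Data.Rational as ℚ using (ℚ; 0ℚ; 1ℚ; ½; _+_; _*_; _-_; -_; _≤_; _/_)
  open import Data.Rational.Properties
  open import Data.Rational.Solver using (module +-*-Solver)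
  open import Algebra.Definitions.RawSemiring ℚ.+-*-rawSemiring using () renaming (_^_ to _^ℚ_)
  open import Data.Sum using (inj₁; inj₂)
  open import Relation.Binary.PropositionalEquality
  open import Defs using (∑ℚ; *-mono-≤-nonNeg; 1/suc_; 1/suc-antitone; ^-nonNeg)
  open +-*-Solver using (solve; _:+_; _:*_; _:-_; :-_; _:=_; con)
  open Rational

  2ℚ = ℤ.+ 2 / 1
  3ℚ = ℤ.+ 3 / 1

  -- Σ_{d≥1} (D + d)² y^d for y = r / (1 + r).
  tail : ℚ → ℚ → ℚ
  tail r D = D * D * r + 2ℚ * D * (r * (1ℚ + r)) + r * (1ℚ + r) * (1ℚ + 2ℚ * r)

  squares : ℚ → ℕ → ℚ
  squares y D = ∑ℚ D (λ d → ι (suc d) * ι (suc d) * y ^ℚ suc d)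

  private
    -- The common factor in `tail r D = r * cofactor r D` and `(D + 1)² + tail r (D + 1) = (1 + r) *
    -- cofactor r D`. Hence the sign of `y (1 + r) - r` decides which way `squares y D + y^D * tail
    -- r D` moves with `D`.
    cofactor : ℚ → ℚ → ℚ
    cofactor r D = (1ℚ + D) * (1ℚ + D) + 2ℚ * (1ℚ + D) * r + r * (1ℚ + 2ℚ * r)

    0≤cofactor : ∀ {r D} → 0ℚ ≤ r → 0ℚ ≤ D → 0ℚ ≤ cofactor r D
    0≤cofactor 0≤r 0≤D = (0≤1+D ⊗ 0≤1+D) ⊕ (nonNegative⁻¹ 2ℚ ⊗ 0≤1+D ⊗ 0≤r)
                       ⊕ (0≤r ⊗ (<⇒≤ 0<1 ⊕ nonNegative⁻¹ 2ℚ ⊗ 0≤r))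
      where 0≤1+D = <⇒≤ 0<1 ⊕ 0≤D

    tail-left : ∀ y r D Y → (1ℚ + D) * (1ℚ + D) * (y * Y) + y * Y * tail r (1ℚ + D)
                          ≡ y * (1ℚ + r) * (Y * cofactor r D)
    tail-left = solve 4 (λ y r D Y → let E = con 1ℚ :+ D in
      E :* E :* (y :* Y) :+ y :* Y :* (E :* E :* r :+ con 2ℚ :* E :* (r :* (con 1ℚ :+ r))
        :+ r :* (con 1ℚ :+ r) :* (con 1ℚ :+ con 2ℚ :* r))
      := y :* (con 1ℚ :+ r) :* (Y :* (E :* E :+ con 2ℚ :* E :* r :+ r :* (con 1ℚ :+ con 2ℚ :* r)))) refl

    tail-right : ∀ r D Y → r * (Y * cofactor r D) ≡ Y * tail r D
    tail-right = solve 3 (λ r D Y → let E = con 1ℚ :+ D in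
      r :* (Y :* (E :* E :+ con 2ℚ :* E :* r :+ r :* (con 1ℚ :+ con 2ℚ :* r)))
      := Y :* (D :* D :* r :+ con 2ℚ :* D :* (r :* (con 1ℚ :+ r))
        :+ r :* (con 1ℚ :+ r) :* (con 1ℚ :+ con 2ℚ :* r))) refl

    regroup : ∀ y r D → squares y (suc D) + y ^ℚ suc D * tail r (ι (suc D))
      ≡ squares y D + y * (1ℚ + r) * (y ^ℚ D * cofactor r (ι D))
    regroup y r D = trans (+-assoc (squares y D) _ _) (cong (squares y D +_)
      (trans (cong (λ e → e * e * y ^ℚ suc D + y ^ℚ suc D * tail r e) (ι-suc D))
        (tail-left y r (ι D) (y ^ℚ D))))

    start : ∀ r → 0ℚ + 1ℚ * tail r (ι 0) ≡ r * (1ℚ + r) * (1ℚ + 2ℚ * r)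
    start r = trans (cong (λ z → 0ℚ + 1ℚ * tail r z) ι-0)
      (solve 1 (λ r → con 0ℚ :+ con 1ℚ :* (con 0ℚ :* con 0ℚ :* r
          :+ con 2ℚ :* con 0ℚ :* (r :* (con 1ℚ :+ r)) :+ r :* (con 1ℚ :+ r) :* (con 1ℚ :+ con 2ℚ :* r))
        := r :* (con 1ℚ :+ r) :* (con 1ℚ :+ con 2ℚ :* r)) refl r)

  0≤tail : ∀ {r D} → 0ℚ ≤ r → 0ℚ ≤ D → 0ℚ ≤ tail r D
  0≤tail 0≤r 0≤D = 0≤D ⊗ 0≤D ⊗ 0≤r ⊕ nonNegative⁻¹ 2ℚ ⊗ 0≤D ⊗ (0≤r ⊗ 0≤1+r)
                 ⊕ 0≤r ⊗ 0≤1+r ⊗ (<⇒≤ 0<1 ⊕ nonNegative⁻¹ 2ℚ ⊗ 0≤r)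
    where 0≤1+r = <⇒≤ 0<1 ⊕ 0≤r

  module _ {y r : ℚ} (0≤y : 0ℚ ≤ y) (0≤r : 0ℚ ≤ r) where
    private
      0≤yc : ∀ D → 0ℚ ≤ y ^ℚ D * cofactor r (ι D)
      0≤yc D = ^-nonNeg 0≤y D ⊗ 0≤cofactor 0≤r (0≤ι D)

    -- `squares y D + y^D * tail r D` does not increase with `D`, and the right-hand side is its
    -- value at `0`.
    squares-upper : y * (1ℚ + r) ≤ r → ∀ D → squares y D ≤ r * (1ℚ + r) * (1ℚ + 2ℚ * r)
    squares-upper h D = ≤-trans (≤-by _ (^-nonNeg 0≤y D ⊗ 0≤tail 0≤r (0≤ι D)) refl) (go D)
      where
      go : ∀ D → squares y D + y ^ℚ D * tail r (ι D) ≤ r * (1ℚ + r) * (1ℚ + 2ℚ * r)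
      go zero    = ≤-reflexive (start r)
      go (suc D) = ≤-trans (≤-reflexive (regroup y r D))
        (≤-trans (+-monoʳ-≤ (squares y D) (≤-trans (*-monoʳ (0≤yc D) h)
          (≤-reflexive (tail-right r (ι D) (y ^ℚ D))))) (go D))

    -- The same quantity, now non-decreasing in `D`; the tail has to stay in the statement until it
    -- is known to be small.
    squares-lower : r ≤ y * (1ℚ + r) → ∀ D →
      r * (1ℚ + r) * (1ℚ + 2ℚ * r) ≤ squares y D + y ^ℚ D * tail r (ι D)
    squares-lower h zero    = ≤-reflexive (sym (start r))
    squares-lower h (suc D) = ≤-trans (squares-lower h D)
      (≤-trans (+-monoʳ-≤ (squares y D) (≤-trans (≤-reflexive (sym (tail-right r (ι D) (y ^ℚ D))))
        (*-monoʳ (0≤yc D) h))) (≤-reflexive (sym (regroup y r D))))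

  1/suc-difference : ∀ n → 1/suc n ≡ (1/suc (suc n)) + (1/suc n) * (1/suc (suc n))
  1/suc-difference n = begin
    a                      ≡⟨ sym (*-identityʳ a) ⟩
    a * 1ℚ                 ≡⟨ cong (a *_) (sym (trans (sym (cong (_* b) (ι-suc (suc n)))) (ι*1/suc (suc n)))) ⟩
    a * ((1ℚ + A) * b)     ≡⟨ solve 3 (λ a b A → a :* ((con 1ℚ :+ A) :* b) := (A :* a) :* b :+ a :* b) refl a b A ⟩
    (A * a) * b + a * b    ≡⟨ cong (λ t → t * b + a * b) (ι*1/suc n) ⟩
    1ℚ * b + a * b         ≡⟨ cong (_+ a * b) (*-identityˡ b) ⟩
    b + a * b              ∎
    where
    open ≡-Reasoning
    a = 1/suc n
    b = 1/suc (suc n)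
    A = ι (suc n)

  -- For N = n + 1: ρ n = (N + 1) / N and χ n = N / (N + 1).
  ρ χ : ℕ → ℚ
  ρ n = 1ℚ + 1/suc n
  χ n = 1ℚ - 1/suc (suc n)

  χ*ρ : ∀ n → χ n * ρ n ≡ 1ℚ
  χ*ρ n = trans (solve 2 (λ a b → (con 1ℚ :- b) :* (con 1ℚ :+ a) := con 1ℚ :+ (a :- (b :+ a :* b))) refl a b)
    (trans (cong (λ t → 1ℚ + (a - t)) (sym (1/suc-difference n)))
      (trans (cong (1ℚ +_) (+-inverseʳ a)) (+-identityʳ 1ℚ)))
    where
    a = 1/suc n
    b = 1/suc (suc n)

  1/suc≤1 : ∀ n → 1/suc n ≤ 1ℚ
  1/suc≤1 n = 1/suc-antitone {0} {n} ℕ.z≤n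

  0≤ρ : ∀ n → 0ℚ ≤ ρ n
  0≤ρ n = <⇒≤ 0<1 ⊕ 0≤1/suc n

  0≤χ : ∀ n → 0ℚ ≤ χ n
  0≤χ n = ≤⇒0≤- (1/suc≤1 (suc n))

  χ≤1 : ∀ n → χ n ≤ 1ℚ
  χ≤1 n = ≤-by _ (0≤1/suc (suc n)) (solve 1 (λ b → (con 1ℚ :- b) :+ b := con 1ℚ) refl (1/suc (suc n)))

  χ^*ρ^ : ∀ n k → χ n ^ℚ k * ρ n ^ℚ k ≡ 1ℚ
  χ^*ρ^ n k = trans (sym (*-^ (χ n) (ρ n) k)) (trans (cong (_^ℚ k) (χ*ρ n)) (1^ k))

  -- step n + 1 = N (N + 2), since (N + 1) / N = (1 + 1 / (N (N + 2))) (N + 2) / (N + 1).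
  step : ℕ → ℕ
  step n = suc (suc n) ℕ.+ n ℕ.* suc (suc (suc n))

  1/step : ∀ n → 1/suc (step n) ≡ (1/suc n) * (1/suc (suc (suc n)))
  1/step n = sym (trans (sym (*-identityʳ _)) (trans (cong (a * e *_) (sym (ι*1/suc (step n))))
    (trans (cong (λ t → a * e * (t * c)) (ι-* (suc n) (suc (suc (suc n)))))
      (trans (solve 5 (λ a e A E c → a :* e :* (A :* E :* c) := (A :* a) :* (E :* e) :* c) refl
               a e (ι (suc n)) (ι (suc (suc (suc n)))) c)
        (trans (cong₂ (λ s t → s * t * c) (ι*1/suc n) (ι*1/suc (suc (suc n))))
          (trans (cong (_* c) (*-identityˡ 1ℚ)) (*-identityˡ c)))))))
    where
    a = 1/suc n
    e = 1/suc (suc (suc n))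
    c = 1/suc (step n)

  ρ-step : ∀ n → ρ n ≡ (1ℚ + 1/suc (step n)) * ρ (suc n)
  ρ-step n = sym (begin
    (1ℚ + 1/suc (step n)) * (1ℚ + b)
      ≡⟨ cong (λ c → (1ℚ + c) * (1ℚ + b)) (1/step n) ⟩
    (1ℚ + a * e) * (1ℚ + b)
      ≡⟨ solve 3 (λ a b e → (con 1ℚ :+ a :* e) :* (con 1ℚ :+ b) := con 1ℚ :+ (b :+ a :* (e :+ b :* e))) refl a b e ⟩
    1ℚ + (b + a * (e + b * e))
      ≡⟨ cong (λ t → 1ℚ + (b + a * t)) (sym (1/suc-difference (suc n))) ⟩
    1ℚ + (b + a * b)
      ≡⟨ cong (1ℚ +_) (sym (1/suc-difference n)) ⟩
    1ℚ + a ∎)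
    where
    open ≡-Reasoning
    a = 1/suc n
    b = 1/suc (suc n)
    e = 1/suc (suc (suc n))

  ι≤ι² : ∀ m → ι m ≤ ι m * ι m
  ι≤ι² m = ≤-trans (ι-mono (m≤m² m)) (≤-reflexive (ι-* m m))
    where
    m≤m² : ∀ m → m ℕ.≤ m ℕ.* m
    m≤m² zero    = ℕ.z≤n
    m≤m² (suc m) = ℕₚ.m≤m+n (suc m) (m ℕ.* suc m)

  binomial-lower : ∀ {a} → 0ℚ ≤ a → ∀ m →
    1ℚ + ι m * a + ½ * (ι m * ι m - ι m) * (a * a) ≤ (1ℚ + a) ^ℚ m
  binomial-lower {a} 0≤a zero = ≤-reflexive (trans
    (cong (λ z → 1ℚ + z * a + ½ * (z * z - z) * (a * a)) ι-0)
    (solve 1 (λ a → con 1ℚ :+ con 0ℚ :* a :+ con ½ :* (con 0ℚ :* con 0ℚ :- con 0ℚ) :* (a :* a) := con 1ℚ) refl a))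
  binomial-lower {a} 0≤a (suc m) = ≤-trans
    (≤-by (½ * (M * M - M) * (a * a) * a)
      (nonNegative⁻¹ ½ ⊗ ≤⇒0≤- (ι≤ι² m) ⊗ (0≤a ⊗ 0≤a) ⊗ 0≤a)
      (trans (cong (λ z → 1ℚ + z * a + ½ * (z * z - z) * (a * a) + ½ * (M * M - M) * (a * a) * a) (ι-suc m))
        (solve 2 (λ a M → let S = con 1ℚ :+ M in
          con 1ℚ :+ S :* a :+ con ½ :* (S :* S :- S) :* (a :* a) :+ con ½ :* (M :* M :- M) :* (a :* a) :* a
          := (con 1ℚ :+ a) :* (con 1ℚ :+ M :* a :+ con ½ :* (M :* M :- M) :* (a :* a))) refl a M)))
    (*-monoˡ (<⇒≤ 0<1 ⊕ 0≤a) (binomial-lower 0≤a m))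
    where M = ι m

  -- Converts a lower bound for a power of `ρ n`, such as the binomial expansion gives, into the
  -- hypothesis of `squares-upper`.
  χ-ratio-≤ : ∀ n m {r} → 0ℚ ≤ r → 1ℚ + r ≤ r * ρ n ^ℚ m → χ n ^ℚ m * (1ℚ + r) ≤ r
  χ-ratio-≤ n m {r} 0≤r h = ≤-trans (*-monoˡ (^-nonNeg (0≤χ n) m) h)
    (≤-reflexive (trans (solve 3 (λ x r p → x :* (r :* p) := (x :* p) :* r) refl (χ n ^ℚ m) r (ρ n ^ℚ m))
      (trans (cong (_* r) (χ^*ρ^ n m)) (*-identityˡ r))))

  cube : ℚ → ℚ
  cube q = q * (q * q)

  zeta₃ : ℕ → ℚ
  zeta₃ M = ∑ℚ M (λ k → cube (1/suc k))

  90ℚ = ℤ.+ 90 / 1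

  -- The error must be O(N²) after summation over `m`, and `1/((m + 1) (m + 2))` telescopes. For
  -- `m + 1 ≤ N` the linear binomial term suffices, with `r = N/(m + 1)`. For larger `m` it would
  -- leave a harmonic series, so the quadratic term is used, with `r = 2 N²/(m (m + 1))`.
  squares-χ : ∀ n m D → squares (χ n ^ℚ suc m) D ≤
    2ℚ * cube (ι (suc n)) * cube (1/suc m) + 90ℚ * (ι (suc n) * ι (suc n)) * ((1/suc m) * (1/suc (suc m)))
  squares-χ n m D with ℕₚ.≤-<-connex m n
  ... | inj₁ m≤n = ≤-trans (squares-upper (^-nonNeg (0≤χ n) (suc m)) 0≤r (χ-ratio-≤ n (suc m) 0≤r ratio) D)
    -- `r (1 + r) (1 + 2 r)` is `2 r³ + 3 r² + r`, and `r ≤ r²`.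
    (≤-trans (≤-by (r * r - r) (≤⇒0≤- (≤-trans (≤-reflexive (sym (*-identityʳ r))) (*-monoˡ 0≤r 1≤r)))
        (solve 1 (λ r → r :* (con 1ℚ :+ r) :* (con 1ℚ :+ con 2ℚ :* r) :+ (r :* r :- r)
                     := con 2ℚ :* (r :* (r :* r)) :+ con 4ℚ :* (r :* r)) refl r))
      (≤-by (N * N * i * (4ℚ * (2ℚ * k - i) + 82ℚ * k))
        (0≤ι (suc n) ⊗ 0≤ι (suc n) ⊗ 0≤1/suc m ⊗ (nonNegative⁻¹ 4ℚ ⊗ ≤⇒0≤- i≤2k ⊕ nonNegative⁻¹ 82ℚ ⊗ 0≤1/suc (suc m)))
        (solve 3 (λ N i k → let r = N :* i in con 2ℚ :* (r :* (r :* r)) :+ con 4ℚ :* (r :* r)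
             :+ N :* N :* i :* (con 4ℚ :* (con 2ℚ :* k :- i) :+ con 82ℚ :* k)
          := con 2ℚ :* (N :* (N :* N)) :* (i :* (i :* i)) :+ con 90ℚ :* (N :* N) :* (i :* k)) refl N i k)))
    where
    4ℚ = ℤ.+ 4 / 1
    82ℚ = ℤ.+ 82 / 1
    N = ι (suc n)
    a = 1/suc n
    i = 1/suc m
    k = 1/suc (suc m)
    r = N * i
    0≤r : 0ℚ ≤ r
    0≤r = 0≤ι (suc n) ⊗ 0≤1/suc m
    1≤r : 1ℚ ≤ r
    1≤r = ≤-trans (≤-reflexive (sym (ι*1/suc m))) (*-monoʳ (0≤1/suc m) (ι-mono (ℕ.s≤s m≤n)))
    i≤2k : i ≤ 2ℚ * k
    i≤2k = ≤-by (k * (1ℚ - i)) (0≤1/suc (suc m) ⊗ ≤⇒0≤- (1/suc≤1 m))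
      (trans (cong (_+ k * (1ℚ - i)) (1/suc-difference m))
        (solve 2 (λ i k → (k :+ i :* k) :+ k :* (con 1ℚ :- i) := con 2ℚ :* k) refl i k))
    ratio : 1ℚ + r ≤ r * ρ n ^ℚ suc m
    ratio = ≤-trans (≤-reflexive (trans (+-comm 1ℚ r)
        (trans (cong (r +_) (sym (trans
            (solve 4 (λ N i M a → N :* i :* (M :* a) := (M :* i) :* (N :* a)) refl N i (ι (suc m)) a)
            (trans (cong₂ _*_ (ι*1/suc m) (ι*1/suc n)) (*-identityˡ 1ℚ)))))
          (solve 2 (λ r t → r :+ r :* t := r :* (con 1ℚ :+ t)) refl r (ι (suc m) * a)))))
      (*-monoˡ 0≤r (≤-trans (≤-by _ (nonNegative⁻¹ ½ ⊗ ≤⇒0≤- (ι≤ι² (suc m)) ⊗ (0≤1/suc n ⊗ 0≤1/suc n)) refl)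
        (binomial-lower (0≤1/suc n) (suc m))))
  ... | inj₂ (ℕ.s≤s {n = m′} n≤m′) = ≤-trans
    (squares-upper (^-nonNeg (0≤χ n) (suc m)) 0≤r (χ-ratio-≤ n (suc m) 0≤r ratio) D)
    -- `r ≤ 2` gives `(1 + r) (1 + 2 r) ≤ 15`, and `1/m ≤ 3/(m + 2)` then bounds `15 r` by
    -- `90 N²/((m + 1) (m + 2))`; this is the origin of `90`.
    (≤-trans (≤-by (r * ((2ℚ - r) * (7ℚ + 2ℚ * r))) (0≤r ⊗ (≤⇒0≤- r≤2 ⊗ (nonNegative⁻¹ 7ℚ ⊕ nonNegative⁻¹ 2ℚ ⊗ 0≤r)))
        (solve 1 (λ r → r :* (con 1ℚ :+ r) :* (con 1ℚ :+ con 2ℚ :* r) :+ r :* ((con 2ℚ :- r) :* (con 7ℚ :+ con 2ℚ :* r))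
                     := con 15ℚ :* r) refl r))
      (≤-by (2ℚ * cube N * cube i + 30ℚ * (N * N) * i * (3ℚ * k - j))
        (nonNegative⁻¹ 2ℚ ⊗ (0≤ι (suc n) ⊗ (0≤ι (suc n) ⊗ 0≤ι (suc n))) ⊗ (0≤1/suc m ⊗ (0≤1/suc m ⊗ 0≤1/suc m))
          ⊕ nonNegative⁻¹ 30ℚ ⊗ (0≤ι (suc n) ⊗ 0≤ι (suc n)) ⊗ 0≤1/suc m ⊗ ≤⇒0≤- j≤3k)
        (solve 4 (λ N i j k → con 15ℚ :* (con 2ℚ :* (N :* i) :* (N :* j))
             :+ (con 2ℚ :* (N :* (N :* N)) :* (i :* (i :* i)) :+ con 30ℚ :* (N :* N) :* i :* (con 3ℚ :* k :- j))
          := con 2ℚ :* (N :* (N :* N)) :* (i :* (i :* i)) :+ con 90ℚ :* (N :* N) :* (i :* k)) refl N i j k)))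
    where
    7ℚ = ℤ.+ 7 / 1
    15ℚ = ℤ.+ 15 / 1
    30ℚ = ℤ.+ 30 / 1
    N = ι (suc n)
    a = 1/suc n
    i = 1/suc m
    j = 1/suc m′
    k = 1/suc (suc m)
    r = 2ℚ * (N * i) * (N * j)
    0≤N = 0≤ι (suc n)
    0≤r : 0ℚ ≤ r
    0≤r = nonNegative⁻¹ 2ℚ ⊗ (0≤N ⊗ 0≤1/suc m) ⊗ (0≤N ⊗ 0≤1/suc m′)
    Ni≤1 : N * i ≤ 1ℚ
    Ni≤1 = ≤-trans (*-monoʳ (0≤1/suc m) (ι-mono (ℕ.s≤s (ℕₚ.≤-trans n≤m′ (ℕₚ.n≤1+n m′))))) (≤-reflexive (ι*1/suc m))
    Nj≤1 : N * j ≤ 1ℚ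
    Nj≤1 = ≤-trans (*-monoʳ (0≤1/suc m′) (ι-mono (ℕ.s≤s n≤m′))) (≤-reflexive (ι*1/suc m′))
    r≤2 : r ≤ 2ℚ
    r≤2 = ≤-trans (≤-reflexive (*-assoc 2ℚ (N * i) (N * j)))
      (≤-trans (*-monoˡ (nonNegative⁻¹ 2ℚ) (*-mono-≤-nonNeg (0≤N ⊗ 0≤1/suc m) Ni≤1 (0≤N ⊗ 0≤1/suc m′) Nj≤1))
        ≤-refl)
    j≤3k : j ≤ 3ℚ * k
    j≤3k = ≤-by ((k + i * k) * (1ℚ - j) + k * (1ℚ - 2ℚ * i))
      ((0≤1/suc (suc m) ⊕ 0≤1/suc m ⊗ 0≤1/suc (suc m)) ⊗ ≤⇒0≤- (1/suc≤1 m′)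
        ⊕ 0≤1/suc (suc m) ⊗ ≤⇒0≤- 2i≤1)
      (trans (cong (_+ ((k + i * k) * (1ℚ - j) + k * (1ℚ - 2ℚ * i))) (trans (1/suc-difference m′)
          (cong (λ t → t + j * t) (1/suc-difference m))))
        (solve 3 (λ i j k → ((k :+ i :* k) :+ j :* (k :+ i :* k))
            :+ ((k :+ i :* k) :* (con 1ℚ :- j) :+ k :* (con 1ℚ :- con 2ℚ :* i)) := con 3ℚ :* k) refl i j k))
      where
      2i≤1 : 2ℚ * i ≤ 1ℚ
      2i≤1 = ≤-trans (*-monoˡ (nonNegative⁻¹ 2ℚ) (1/suc-antitone {1} {m} (ℕ.s≤s ℕ.z≤n))) ≤-refl
    unit : r * (½ * (ι (suc m) * ι (suc m) - ι (suc m)) * (a * a)) ≡ 1ℚ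
    unit = trans (cong (λ M → r * (½ * (M * M - M) * (a * a))) (ι-suc m))
      (trans (solve 5 (λ N i j a M → con 2ℚ :* (N :* i) :* (N :* j) :*
            (con ½ :* ((con 1ℚ :+ M) :* (con 1ℚ :+ M) :- (con 1ℚ :+ M)) :* (a :* a))
          := (N :* a) :* (N :* a) :* (((con 1ℚ :+ M) :* i) :* (M :* j))) refl N i j a (ι m))
        (trans (cong₂ (λ s t → s * s * (t * (ι m * j))) (ι*1/suc n)
                 (trans (cong (_* i) (sym (ι-suc m))) (ι*1/suc m)))
          (trans (cong (λ t → 1ℚ * 1ℚ * (1ℚ * t)) (ι*1/suc m′)) refl)))
    ratio : 1ℚ + r ≤ r * ρ n ^ℚ suc m
    ratio = ≤-trans (≤-reflexive (trans (+-comm 1ℚ r) (cong (r +_) (sym unit))))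
      (≤-trans (≤-by (r * (ι (suc m) * a)) (0≤r ⊗ (0≤ι (suc m) ⊗ 0≤1/suc n))
          (solve 3 (λ r s t → (r :+ r :* s) :+ r :* t := r :* ((con 1ℚ :+ t) :+ s)) refl r
            (½ * (ι (suc m) * ι (suc m) - ι (suc m)) * (a * a)) (ι (suc m) * a)))
        (*-monoˡ 0≤r (binomial-lower (0≤1/suc n) (suc m))))

  ∑-telescope : ∀ M → ∑ℚ M (λ m → (1/suc m) * (1/suc (suc m))) + 1/suc M ≡ 1ℚ
  ∑-telescope zero    = refl
  ∑-telescope (suc M) = trans (solve 3 (λ s t u → (s :+ t) :+ u := s :+ (u :+ t)) refl
      (∑ℚ M (λ m → (1/suc m) * (1/suc (suc m)))) ((1/suc M) * (1/suc (suc M))) (1/suc (suc M)))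
    (trans (cong (∑ℚ M (λ m → (1/suc m) * (1/suc (suc m))) +_) (sym (1/suc-difference M))) (∑-telescope M))

  ∑-squares-χ : ∀ {Z} → (∀ M → zeta₃ M ≤ Z) → ∀ n M D →
    ∑ℚ M (λ m → squares (χ n ^ℚ suc m) D) ≤ 2ℚ * Z * cube (ι (suc n)) + 90ℚ * (ι (suc n) * ι (suc n))
  ∑-squares-χ {Z} h n M D = ≤-trans (∑ℚ-mono M (λ m _ → squares-χ n m D))
    (≤-trans (≤-reflexive (trans (∑ℚ-distrib-+ M (λ m → c₁ * f₁ m) (λ m → c₂ * f₂ m))
        (cong₂ _+_ (∑ℚ-distribˡ M c₁ f₁) (∑ℚ-distribˡ M c₂ f₂))))
      (+-mono-≤
        (≤-trans (*-monoˡ (nonNegative⁻¹ 2ℚ ⊗ (0≤N ⊗ (0≤N ⊗ 0≤N))) (h M))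
          (≤-reflexive (solve 3 (λ t c z → t :* c :* z := t :* z :* c) refl 2ℚ (cube (ι (suc n))) Z)))
        (≤-trans (*-monoˡ (nonNegative⁻¹ 90ℚ ⊗ (0≤N ⊗ 0≤N)) (≤-by {p = ∑ℚ M f₂} _ (0≤1/suc M) (∑-telescope M)))
          (≤-reflexive (*-identityʳ c₂)))))
    where
    0≤N = 0≤ι (suc n)
    c₁ = 2ℚ * cube (ι (suc n))
    c₂ = 90ℚ * (ι (suc n) * ι (suc n))
    f₁ f₂ : ℕ → ℚ
    f₁ m = cube (1/suc m)
    f₂ m = (1/suc m) * (1/suc (suc m))

-- The upper bound: propagating growth rates by the recurrence.

module Upper where
  open import Data.Nat as ℕ using (ℕ; zero; suc)
  import Data.Nat.Properties as ℕₚ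
  open import Data.Nat.Induction using (<-rec)
  import Data.Integer as ℤ
  open import Data.Rational as ℚ using (ℚ; 0ℚ; 1ℚ; _+_; _*_; _≤_; _<_; _/_)
  open import Data.Rational.Properties
  open import Data.Rational.Solver using (module +-*-Solver)
  open import Algebra.Definitions.RawSemiring ℚ.+-*-rawSemiring using () renaming (_^_ to _^ℚ_)
  open import Data.Product using (∃-syntax; _×_; _,_; proj₁; proj₂)
  open import Data.Sum using (inj₁; inj₂)
  open import Relation.Binary.PropositionalEquality
  open import Defs using (∑ℚ; ∑ℕ; ∑ℕ-cong; term≤∑ℕ; 1≤^; 1/suc_; ^-nonNeg; logSeq)
  open +-*-Solver using (solve; _:+_; _:*_; _:=_; con)
  open Sums
  open Shift
  open Rational
  open Logarithm
  open Geometric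

  Recurrence : (ℕ → ℕ) → Set
  Recurrence p = ∀ n → n ℕ.* p n ≡
    ∑ℕ (suc n) (λ d → suc d ℕ.* (suc d ℕ.* ∑ℕ (suc n) (λ m → shift (suc m ℕ.* suc d) p n)))

  ι-∑ : ∀ m f → ι (∑ℕ m f) ≡ ∑ℚ m (λ i → ι (f i))
  ι-∑ zero    f = ι-0
  ι-∑ (suc m) f = trans (ι-+ (∑ℕ m f) (f m)) (cong (_+ ι (f m)) (ι-∑ m f))

  double : (ℕ → ℕ) → ℕ → ℕ → ℕ → ℚ
  double p n M D = ∑ℚ M (λ m → ∑ℚ D (λ d → ι (suc d) * ι (suc d) * ι (shift (suc m ℕ.* suc d) p n)))

  -- The sum over `m` is moved outside, because for fixed `m` and geometric growth the sum over `d`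
  -- has the form `squares`.
  recurrence-ℚ : ∀ {p} → Recurrence p → ∀ n → ι n * ι (p n) ≡ double p n (suc n) (suc n)
  recurrence-ℚ {p} rec n = begin
    ι n * ι (p n)
      ≡⟨ sym (ι-* n (p n)) ⟩
    ι (n ℕ.* p n)
      ≡⟨ cong ι (trans (rec n) (trans
           (∑ℕ-cong (suc n) (λ d → trans (sym (ℕₚ.*-assoc (suc d) (suc d) _))
             (sym (∑-distribˡ-* (suc n) (suc d ℕ.* suc d) (λ m → shift (suc m ℕ.* suc d) p n)))))
           (∑-swap (suc n) (suc n) (λ d m → suc d ℕ.* suc d ℕ.* shift (suc m ℕ.* suc d) p n)))) ⟩
    ι (∑ℕ (suc n) (λ m → ∑ℕ (suc n) (λ d → suc d ℕ.* suc d ℕ.* shift (suc m ℕ.* suc d) p n)))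
      ≡⟨ trans (ι-∑ (suc n) _) (∑ℚ-cong< (suc n) (λ m _ → trans (ι-∑ (suc n) _)
           (∑ℚ-cong< (suc n) (λ d _ → trans (ι-* (suc d ℕ.* suc d) (shift (suc m ℕ.* suc d) p n))
             (cong (_* ι (shift (suc m ℕ.* suc d) p n)) (ι-* (suc d) (suc d))))))) ⟩
    double p n (suc n) (suc n) ∎
    where open ≡-Reasoning

  ρ^-split : ∀ n {j k} → j ℕ.≤ k → ρ n ^ℚ (k ℕ.∸ j) ≡ ρ n ^ℚ k * χ n ^ℚ j
  ρ^-split n {j} {k} j≤k = sym (trans
    (cong (λ k → ρ n ^ℚ k * χ n ^ℚ j) (sym (ℕₚ.m∸n+n≡m j≤k)))
    (trans (cong (_* χ n ^ℚ j) (^-+ (ρ n) (k ℕ.∸ j) j))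
      (trans (solve 3 (λ a b c → (a :* b) :* c := a :* (c :* b)) refl (ρ n ^ℚ (k ℕ.∸ j)) (ρ n ^ℚ j) (χ n ^ℚ j))
        (trans (cong (ρ n ^ℚ (k ℕ.∸ j) *_) (χ^*ρ^ n j)) (*-identityʳ _)))))

  χ^-product : ∀ n m d → χ n ^ℚ (suc m ℕ.* suc d) ≡ (χ n ^ℚ suc m) ^ℚ suc d
  χ^-product n m d = trans (cong (χ n ^ℚ_) (ℕₚ.*-comm (suc m) (suc d))) (^-* (χ n) (suc m) (suc d))

  ∑-factor : ∀ c n M D →
    ∑ℚ M (λ m → ∑ℚ D (λ d → ι (suc d) * ι (suc d) * (c * χ n ^ℚ (suc m ℕ.* suc d))))
    ≡ c * ∑ℚ M (λ m → squares (χ n ^ℚ suc m) D)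
  ∑-factor c n M D = trans
    (∑ℚ-cong< M (λ m _ → trans
      (∑ℚ-cong< D (λ d _ → trans (cong (λ t → ι (suc d) * ι (suc d) * (c * t)) (χ^-product n m d))
        (solve 3 (λ s c t → s :* (c :* t) := c :* (s :* t)) refl (ι (suc d) * ι (suc d)) c ((χ n ^ℚ suc m) ^ℚ suc d))))
      (∑ℚ-distribˡ D c (λ d → ι (suc d) * ι (suc d) * (χ n ^ℚ suc m) ^ℚ suc d))))
    (∑ℚ-distribˡ M c (λ m → squares (χ n ^ℚ suc m) D))

  module UpperBound (p : ℕ → ℕ) (rec : Recurrence p) (Z : ℚ) (zeta≤Z : ∀ M → zeta₃ M ≤ Z) where

    0≤Z : 0ℚ ≤ Z
    0≤Z = zeta≤Z 0

    -- Inserting `E ρ^j` for smaller arguments into the recurrence at `k` gives at most `E ρ^k`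
    -- times this number; from here on, division by `k` keeps the bound.
    threshold : ℕ → ℚ
    threshold n = 2ℚ * Z * cube (ι (suc n)) + 90ℚ * (ι (suc n) * ι (suc n))

    private
      module _ (n : ℕ) {E : ℚ} (0≤E : 0ℚ ≤ E) (k : ℕ)
               (below : ∀ j → j ℕ.< k → ι (p j) ≤ E * ρ n ^ℚ j) where

        shift-upper : ∀ j → ι (shift (suc j) p k) ≤ E * ρ n ^ℚ k * χ n ^ℚ suc j
        shift-upper j with ℕₚ.≤-<-connex (suc j) k
        ... | inj₁ j<k = ≤-trans (≤-reflexive (cong ι (shift-≤ (suc j) p k j<k)))
          (≤-trans (below (k ℕ.∸ suc j) (ℕₚ.∸-monoʳ-< (ℕ.s≤s ℕ.z≤n) j<k))
            (≤-reflexive (trans (cong (E *_) (ρ^-split n j<k)) (sym (*-assoc E _ _)))))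
        ... | inj₂ k≤j = ≤-trans (≤-reflexive (trans (cong ι (shift-> (suc j) p k k≤j)) ι-0))
          (0≤E ⊗ ^-nonNeg (0≤ρ n) k ⊗ ^-nonNeg (0≤χ n) (suc j))

        upper-step : threshold n ≤ ι k → 0ℚ < ι k → ι (p k) ≤ E * ρ n ^ℚ k
        upper-step le 0<k = *-cancelʳ 0<k (≤-trans
          (≤-reflexive (trans (*-comm (ι (p k)) (ι k)) (recurrence-ℚ rec k)))
          (≤-trans (∑ℚ-mono (suc k) (λ m _ → ∑ℚ-mono (suc k) (λ d _ →
              *-monoˡ (0≤ι (suc d) ⊗ 0≤ι (suc d)) (shift-upper (d ℕ.+ m ℕ.* suc d)))))
            (≤-trans (≤-reflexive (∑-factor (E * ρ n ^ℚ k) n (suc k) (suc k)))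
              (*-monoˡ (0≤E ⊗ ^-nonNeg (0≤ρ n) k) (≤-trans (∑-squares-χ zeta≤Z n (suc k) (suc k)) le)))))

    upper-extend : ∀ n {E} s → 0ℚ ≤ E → threshold n ≤ ι (suc s) →
                   (∀ k → k ℕ.≤ s → ι (p k) ≤ E * ρ n ^ℚ k) → ∀ k → ι (p k) ≤ E * ρ n ^ℚ k
    upper-extend n {E} s 0≤E le initial = <-rec _ go
      where
      go : ∀ k → (∀ {j} → j ℕ.< k → ι (p j) ≤ E * ρ n ^ℚ j) → ι (p k) ≤ E * ρ n ^ℚ k
      go k ih with ℕₚ.≤-<-connex k s
      ... | inj₁ k≤s = initial k k≤s
      ... | inj₂ s<k = upper-step n 0≤E k (λ j → ih) (≤-trans le (ι-mono s<k))
                         (<-≤-trans (0<ι s) (ι-mono s<k))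

    private
      0≤main : ∀ n → 0ℚ ≤ 2ℚ * Z * cube (ι (suc n))
      0≤main n = nonNegative⁻¹ 2ℚ ⊗ 0≤Z ⊗ (0≤ι (suc n) ⊗ (0≤ι (suc n) ⊗ 0≤ι (suc n)))

      cutoff : ∀ n → ∃[ s ] (threshold n ≤ ι (suc s) × ι s ≤ threshold n)
      cutoff n = let (f , f≤ , <f) = floor (0≤main n) in
        f ℕ.+ 90 ℕ.* (suc n ℕ.* suc n)
        , ≤-trans (+-monoˡ-≤ _ (<⇒≤ <f)) (≤-reflexive (sym (eq (suc f))))
        , ≤-trans (≤-reflexive (eq f)) (+-monoˡ-≤ _ f≤)
        where
        eq : ∀ f → ι (f ℕ.+ 90 ℕ.* (suc n ℕ.* suc n)) ≡ ι f + 90ℚ * (ι (suc n) * ι (suc n))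
        eq f = trans (ι-+ f _) (cong (ι f +_) (trans (ι-* 90 (suc n ℕ.* suc n))
                 (cong₂ _*_ (ι≡ 90) (ι-* (suc n) (suc n)))))

      180ℚ = ℤ.+ 180 / 1

      -- From `N` to `M = N + 1` this polynomial gains exactly `2 Z (M + 1) + 180`, the cost of one
      -- change of rate.
      budget : ℚ → ℚ → ℚ
      budget C N = C + Z * (N * (1ℚ + N)) + (2ℚ * Z + 180ℚ) * N

      record Bound (C : ℚ) (n : ℕ) : Set where
        field
          {E u} : ℚ
          0≤E   : 0ℚ ≤ E
          bound : ∀ k → ι (p k) ≤ E * ρ n ^ℚ k
          log-E : Log≤ E u
          u≤    : u ≤ budget C (ι (suc n))
      open Bound

      -- Rate `2`: up to the cutoff all values are bounded by one more than their sum, and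
      -- afterwards the recurrence takes over.
      first : ∃[ C ] (Bound C 0)
      first = C , record
        { 0≤E   = 0≤ι (suc C₀)
        ; bound = upper-extend 0 s (0≤ι (suc C₀)) le λ k k≤s → ≤-trans
            (ι-mono (ℕₚ.m≤n⇒m≤1+n (term≤∑ℕ (suc s) p (ℕ.s≤s k≤s))))
            (≤-trans (≤-reflexive (sym (*-identityʳ _)))
              (*-monoˡ (0≤ι (suc C₀)) (1≤^ (≤-by _ (0≤1/suc 0) refl) k)))
        ; log-E = Log≤-ι C₀
        ; u≤    = ≤-by _ (0≤Z ⊗ (0≤ι 1 ⊗ (<⇒≤ 0<1 ⊕ 0≤ι 1))
                          ⊕ (nonNegative⁻¹ 2ℚ ⊗ 0≤Z ⊕ nonNegative⁻¹ 180ℚ) ⊗ 0≤ι 1)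
                        (sym (+-assoc C _ _))
        }
        where
        s = proj₁ (cutoff 0)
        le = proj₁ (proj₂ (cutoff 0))
        C₀ = ∑ℕ (suc s) p
        C = ι C₀

      next : ∀ {C} n → Bound C n → Bound C (suc n)
      next {C} n b = record
        { E     = E b * (1ℚ + c) ^ℚ s
        ; 0≤E   = 0≤E b ⊗ ^-nonNeg 0≤1+c s
        ; bound = upper-extend (suc n) s (0≤E b ⊗ ^-nonNeg 0≤1+c s) le λ k k≤s →
            ≤-trans (bound b k) (≤-trans
              (≤-reflexive (trans (cong (λ r → E b * r ^ℚ k) (ρ-step n))
                (trans (cong (E b *_) (*-^ (1ℚ + c) (ρ (suc n)) k)) (sym (*-assoc (E b) _ _)))))
              (*-monoʳ (^-nonNeg (0≤ρ (suc n)) k) (*-monoˡ (0≤E b) (grow k≤s))))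
        ; log-E = Log≤-* (0≤E b) (^-nonNeg 0≤1+c s) (log-E b) (Log≤-^ 0≤1+c (Log≤-1+ (step n)) s)
        ; u≤    = ≤-trans (+-mono-≤ (u≤ b) s*c≤) (≤-reflexive (trans
            (cong (λ M → budget C N + (2ℚ * Z * (M + 1ℚ) + 180ℚ)) (ι-suc (suc n)))
            (trans (solve 4 (λ C Z N t → C :+ Z :* (N :* (con 1ℚ :+ N)) :+ (con 2ℚ :* Z :+ t) :* N
                    :+ (con 2ℚ :* Z :* ((con 1ℚ :+ N) :+ con 1ℚ) :+ t)
                  := C :+ Z :* ((con 1ℚ :+ N) :* (con 1ℚ :+ (con 1ℚ :+ N))) :+ (con 2ℚ :* Z :+ t) :* (con 1ℚ :+ N))
                refl C Z N 180ℚ)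
              (cong (budget C) (sym (ι-suc (suc n)))))))
        }
        where
        c = 1/suc (step n)
        N = ι (suc n)
        M = ι (suc (suc n))
        s = proj₁ (cutoff (suc n))
        le = proj₁ (proj₂ (cutoff (suc n)))
        0≤1+c = <⇒≤ 0<1 ⊕ 0≤1/suc (step n)
        grow : ∀ {k} → k ℕ.≤ s → (1ℚ + c) ^ℚ k ≤ (1ℚ + c) ^ℚ s
        grow {k} k≤s = subst (λ s → (1ℚ + c) ^ℚ k ≤ (1ℚ + c) ^ℚ s) (ℕₚ.m+[n∸m]≡n k≤s)
          (≤-trans (≤-reflexive (sym (*-identityʳ _)))
            (≤-trans (*-monoˡ (^-nonNeg 0≤1+c k) (1≤^ (≤-by _ (0≤1/suc (step n)) refl) (s ℕ.∸ k)))
              (≤-reflexive (sym (^-+ (1ℚ + c) k (s ℕ.∸ k))))))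
        MMc : M * M * c ≡ 1ℚ + c
        MMc = trans (cong (λ M → M * M * c) (ι-suc (suc n)))
          (trans (solve 2 (λ N c → (con 1ℚ :+ N) :* (con 1ℚ :+ N) :* c := N :* (con 1ℚ :+ (con 1ℚ :+ N)) :* c :+ c) refl N c)
            (cong (_+ c) (trans (cong (λ P → N * P * c) (sym (trans (ι-suc (suc (suc n))) (cong (1ℚ +_) (ι-suc (suc n))))))
              (trans (cong (_* c) (sym (ι-* (suc n) (suc (suc (suc n)))))) (ι*1/suc (step n))))))
        Mc≤1 : M * c ≤ 1ℚ
        Mc≤1 = ≤-trans (*-monoʳ (0≤1/suc (step n)) (ι-mono (ℕₚ.m≤n⇒m≤1+n (ℕₚ.m≤m+n (suc (suc n)) _))))
                 (≤-reflexive (ι*1/suc (step n)))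
        -- `s ≤ 2 Z M³ + 90 M²` and `M² c = 1 + c`, so the cost is at most
        -- `2 Z M (1 + c) + 90 (1 + c)`, where `M c ≤ 1` and `c ≤ 1`.
        s*c≤ : ι s * c ≤ 2ℚ * Z * (M + 1ℚ) + 180ℚ
        s*c≤ = ≤-trans (*-monoʳ (0≤1/suc (step n)) (proj₂ (proj₂ (cutoff (suc n)))))
          (≤-trans (≤-reflexive (trans
              (solve 4 (λ w M c t → (w :* (M :* (M :* M)) :+ t :* (M :* M)) :* c
                                 := w :* (M :* (M :* M :* c)) :+ t :* (M :* M :* c)) refl (2ℚ * Z) M c 90ℚ)
              (cong (λ q → 2ℚ * Z * (M * q) + 90ℚ * q) MMc)))
            (+-mono-≤
              (*-monoˡ (nonNegative⁻¹ 2ℚ ⊗ 0≤Z) (≤-trans (≤-reflexive (solve 2 (λ M c → M :* (con 1ℚ :+ c) := M :+ M :* c) refl M c))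
                (+-monoʳ-≤ M Mc≤1)))
              (≤-trans (*-monoˡ (nonNegative⁻¹ 90ℚ) (+-monoʳ-≤ 1ℚ (1/suc≤1 (step n)))) ≤-refl)))

      all : ∀ n → Bound (proj₁ first) n
      all zero    = proj₂ first
      all (suc n) = next n (all n)

    log-p-upper : ∃[ C ] (0ℚ ≤ C × ∀ n k → 1 ℕ.≤ p k → logSeq (p k) ≲
      (λ _ → C + Z * (ι (suc n) * (1ℚ + ι (suc n))) + (2ℚ * Z + 180ℚ) * ι (suc n) + ι k * (1/suc n)))
    log-p-upper = proj₁ first , 0≤ι _ , λ n k 1≤p → go n k (p k) (bound (all n) k) 1≤p
      where
      go : ∀ n k P → ι P ≤ E (all n) * ρ n ^ℚ k → 1 ℕ.≤ P → logSeq P ≲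
           (λ _ → budget (proj₁ first) (ι (suc n)) + ι k * (1/suc n))
      go n k (suc P) le _ = ≲-trans
        (log-upper le (Log≤-* (0≤E (all n)) (^-nonNeg (0≤ρ n) k) (log-E (all n))
          (Log≤-^ (0≤ρ n) (Log≤-1+ n) k)))
        (≤⇒≲ (λ _ → +-monoˡ-≤ (ι k * (1/suc n)) (u≤ (all n))))

-- Sums of squares against powers of `χ n`, from below.

module Lower where
  open import Data.Nat as ℕ using (ℕ; zero; suc)
  import Data.Nat.Properties as ℕₚ
  import Data.Nat.Solver as ℕSolver
  import Data.Integer as ℤ
  open import Data.Rational as ℚ using (ℚ; 0ℚ; 1ℚ; ½; _+_; _*_; _-_; -_; _≤_; _/_)
  open import Data.Rational.Properties
  open import Data.Rational.Solver using (module +-*-Solver)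
  open import Algebra.Definitions.RawSemiring ℚ.+-*-rawSemiring using () renaming (_^_ to _^ℚ_)
  open import Relation.Binary.PropositionalEquality
  open import Defs using (∑ℚ; *-mono-≤-nonNeg; 1/suc_; ^-nonNeg; ^-mono)
  open +-*-Solver using (solve; _:+_; _:*_; _:-_; :-_; _:=_; con)
  open Shift
  open Rational
  open Logarithm
  open Geometric
  open Upper

  -- Makes the tail beyond `d = N²` negligible. From `4` on `N³` at most doubles in a step; the
  -- inequality still fails at `15`.
  11*cube≤2^ : ∀ {N} → 16 ℕ.≤ N → 11 ℕ.* (N ℕ.* (N ℕ.* N)) ℕ.≤ 2 ℕ.^ N
  11*cube≤2^ {N} 16≤N = subst P (ℕₚ.m∸n+n≡m 16≤N) (go (N ℕ.∸ 16))
    where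
    open ℕSolver.+-*-Solver using () renaming (solve to solveℕ; _:+_ to _⊞_; _:*_ to _⊠_; _:=_ to _⩵_; con to conℕ)
    P : ℕ → Set
    P N = 11 ℕ.* (N ℕ.* (N ℕ.* N)) ℕ.≤ 2 ℕ.^ N
    double-step : ∀ j → suc (j ℕ.+ 4) ℕ.* (suc (j ℕ.+ 4) ℕ.* suc (j ℕ.+ 4))
      ℕ.≤ 2 ℕ.* ((j ℕ.+ 4) ℕ.* ((j ℕ.+ 4) ℕ.* (j ℕ.+ 4)))
    double-step j = ℕₚ.≤-trans (ℕₚ.m≤m+n _ (3 ℕ.+ 21 ℕ.* j ℕ.+ 9 ℕ.* (j ℕ.* j) ℕ.+ j ℕ.* (j ℕ.* j)))
      (ℕₚ.≤-reflexive (solveℕ 1 (λ j → let s = conℕ 1 ⊞ (j ⊞ conℕ 4) ; t = j ⊞ conℕ 4 in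
        s ⊠ (s ⊠ s) ⊞ (conℕ 3 ⊞ conℕ 21 ⊠ j ⊞ conℕ 9 ⊠ (j ⊠ j) ⊞ j ⊠ (j ⊠ j))
        ⩵ conℕ 2 ⊠ (t ⊠ (t ⊠ t))) refl j))
    next : ∀ N → 4 ℕ.≤ N → P N → P (suc N)
    next N 4≤N h = ℕₚ.≤-trans
      (ℕₚ.*-monoʳ-≤ 11 (subst (λ N → suc N ℕ.* (suc N ℕ.* suc N) ℕ.≤ 2 ℕ.* (N ℕ.* (N ℕ.* N)))
        (ℕₚ.m∸n+n≡m 4≤N) (double-step (N ℕ.∸ 4))))
      (ℕₚ.≤-trans (ℕₚ.≤-reflexive (x*[2*y]≡2*[x*y] 11 (N ℕ.* (N ℕ.* N)))) (ℕₚ.*-monoʳ-≤ 2 h))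
      where
      x*[2*y]≡2*[x*y] : ∀ x y → x ℕ.* (2 ℕ.* y) ≡ 2 ℕ.* (x ℕ.* y)
      x*[2*y]≡2*[x*y] = solveℕ 2 (λ x y → x ⊠ (conℕ 2 ⊠ y) ⩵ conℕ 2 ⊠ (x ⊠ y)) refl
    go : ∀ j → P (j ℕ.+ 16)
    go zero    = ℕₚ.≤ᵇ⇒≤ (11 ℕ.* (16 ℕ.* (16 ℕ.* 16))) (2 ℕ.^ 16) _
    go (suc j) = next (j ℕ.+ 16) (ℕₚ.≤-trans (ℕₚ.≤ᵇ⇒≤ 4 16 _) (ℕₚ.m≤n+m 16 j)) (go j)

  ι-^ : ∀ m k → ι (m ℕ.^ k) ≡ ι m ^ℚ k
  ι-^ m zero    = ι-1
  ι-^ m (suc k) = trans (ι-* m (m ℕ.^ k)) (cong (ι m *_) (ι-^ m k))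

  -- `w / (w + m)` is a product of `m` factors `x / (x + 1)` with `x ≤ N`, each at most
  -- `N / (N + 1)`, which is `χ n`.
  χ-power : ∀ n w m → w ℕ.+ m ℕ.≤ suc n → ι w ≤ ι (w ℕ.+ m) * χ n ^ℚ m
  χ-power n w zero    _  = ≤-reflexive (trans (cong ι (sym (ℕₚ.+-identityʳ w))) (sym (*-identityʳ _)))
  χ-power n w (suc m) le = ≤-trans (χ-power n w m (ℕₚ.≤-trans (ℕₚ.n≤1+n _) le′))
    (≤-trans (*-monoʳ (^-nonNeg (0≤χ n) m) lower)
      (≤-reflexive (trans (*-assoc (1ℚ + W) (χ n) _)
        (cong (_* (χ n * χ n ^ℚ m)) (sym (trans (cong ι (ℕₚ.+-suc w m)) (ι-suc (w ℕ.+ m))))))))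
    where
    W = ι (w ℕ.+ m)
    b = 1/suc (suc n)
    le′ : suc (w ℕ.+ m) ℕ.≤ suc n
    le′ = ℕₚ.≤-trans (ℕₚ.≤-reflexive (sym (ℕₚ.+-suc w m))) le
    lower : W ≤ (1ℚ + W) * χ n
    lower = ≤-by (1ℚ - (1ℚ + W) * b)
      (≤⇒0≤- (≤-trans (*-monoʳ (0≤1/suc (suc n)) (≤-trans (≤-reflexive (sym (ι-suc (w ℕ.+ m))))
        (ι-mono (ℕₚ.m≤n⇒m≤1+n le′)))) (≤-reflexive (ι*1/suc (suc n)))))
      (solve 2 (λ W b → W :+ (con 1ℚ :- (con 1ℚ :+ W) :* b) := (con 1ℚ :+ W) :* (con 1ℚ :- b)) refl W b)

  χ^N≤½ : ∀ n → χ n ^ℚ suc n * 2ℚ ≤ 1ℚ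
  χ^N≤½ n = ≤-trans (*-monoˡ (^-nonNeg (0≤χ n) (suc n)) two≤) (≤-reflexive (χ^*ρ^ n (suc n)))
    where
    two≤ : 2ℚ ≤ ρ n ^ℚ suc n
    two≤ = ≤-trans (≤-trans (≤-reflexive (cong (1ℚ +_) (sym (ι*1/suc n))))
      (≤-by _ (nonNegative⁻¹ ½ ⊗ ≤⇒0≤- (ι≤ι² (suc n)) ⊗ (0≤1/suc n ⊗ 0≤1/suc n)) refl))
      (binomial-lower (0≤1/suc n) (suc n))

  -- `(1 + 1/N)^N` is at least `2`; the `N`-th power of this.
  χ^N²-small : ∀ n → χ n ^ℚ (suc n ℕ.* suc n) * ι (2 ℕ.^ suc n) ≤ 1ℚ
  χ^N²-small n = ≤-trans (≤-reflexive (trans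
      (cong₂ _*_ (^-* (χ n) (suc n) (suc n)) (trans (ι-^ 2 (suc n)) (cong (_^ℚ suc n) (ι≡ 2))))
      (sym (*-^ (χ n ^ℚ suc n) 2ℚ (suc n)))))
    (^≤1 (^-nonNeg (0≤χ n) (suc n) ⊗ nonNegative⁻¹ 2ℚ) (χ^N≤½ n) (suc n))

  tail-mono : ∀ {r s D} → 0ℚ ≤ D → 0ℚ ≤ r → r ≤ s → tail r D ≤ tail s D
  tail-mono {r} {s} {D} 0≤D 0≤r r≤s = +-mono-≤
    (+-mono-≤ (*-monoˡ (0≤D ⊗ 0≤D) r≤s) (*-monoˡ (nonNegative⁻¹ 2ℚ ⊗ 0≤D) rr))
    (*-mono-≤-nonNeg (0≤r ⊗ 0≤1+r) rr (<⇒≤ 0<1 ⊕ nonNegative⁻¹ 2ℚ ⊗ 0≤r)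
      (+-monoʳ-≤ 1ℚ (*-monoˡ (nonNegative⁻¹ 2ℚ) r≤s)))
    where
    0≤1+r = <⇒≤ 0<1 ⊕ 0≤r
    rr = *-mono-≤-nonNeg 0≤r r≤s 0≤1+r (+-monoʳ-≤ 1ℚ r≤s)

  private
    11ℚ = ℤ.+ 11 / 1

  -- As a polynomial in `N` the tail has degree `5`, and its three summands have coefficient sums
  -- `1`, `4` and `6`, together `11`.
  tail-crude : ∀ n → tail (ι (suc n)) (ι (suc n) * ι (suc n)) ≤
               11ℚ * cube (ι (suc n)) * (ι (suc n) * ι (suc n))
  tail-crude n = subst (λ N → tail N (N * N) ≤ 11ℚ * cube N * (N * N)) (sym (ι-suc n))
    (≤-by (M * (2ℚ * (N * N * N * N) + 4ℚ * (N * N * N) * (N + 1ℚ) + 3ℚ * (N * N) * (N * N + N + 1ℚ)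
                 + N * (N * N * N + N * N + N + 1ℚ)))
      (0≤M ⊗ (nonNegative⁻¹ 2ℚ ⊗ (0≤N ⊗ 0≤N ⊗ 0≤N ⊗ 0≤N) ⊕ nonNegative⁻¹ 4ℚ ⊗ (0≤N ⊗ 0≤N ⊗ 0≤N) ⊗ (0≤N ⊕ <⇒≤ 0<1)
        ⊕ nonNegative⁻¹ 3ℚ ⊗ (0≤N ⊗ 0≤N) ⊗ (0≤N ⊗ 0≤N ⊕ 0≤N ⊕ <⇒≤ 0<1)
        ⊕ 0≤N ⊗ (0≤N ⊗ 0≤N ⊗ 0≤N ⊕ 0≤N ⊗ 0≤N ⊕ 0≤N ⊕ <⇒≤ 0<1)))
      (solve 1 (λ M → let N = con 1ℚ :+ M ; D = N :* N in
        D :* D :* N :+ con 2ℚ :* D :* (N :* (con 1ℚ :+ N)) :+ N :* (con 1ℚ :+ N) :* (con 1ℚ :+ con 2ℚ :* N)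
          :+ M :* (con 2ℚ :* (N :* N :* N :* N) :+ con 4ℚ :* (N :* N :* N) :* (N :+ con 1ℚ)
            :+ con 3ℚ :* (N :* N) :* (N :* N :+ N :+ con 1ℚ) :+ N :* (N :* N :* N :+ N :* N :+ N :+ con 1ℚ))
        := con 11ℚ :* (N :* (N :* N)) :* (N :* N)) refl M))
    where
    4ℚ = ℤ.+ 4 / 1
    M = ι n
    N = 1ℚ + M
    0≤M = 0≤ι n
    0≤N = <⇒≤ 0<1 ⊕ 0≤M

  -- The loss from `N` to `w` ensures `χ^(m + 1) ≥ r / (1 + r)` for `r = w/(m + 1)`. Stopping at
  -- `d = N²` costs at most `11 N⁵ χ^(N²) ≤ N²`.
  squares-χ-lower : ∀ n w m → 16 ℕ.≤ suc n → w ℕ.+ suc m ℕ.≤ suc n →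
    2ℚ * cube (ι w) * cube (1/suc m) ≤
    squares (χ n ^ℚ suc m) (suc n ℕ.* suc n) + ι (suc n) * ι (suc n)
  squares-χ-lower n w m 16≤N le = ≤-trans
    (≤-by (3ℚ * (r * r) + r) (nonNegative⁻¹ 3ℚ ⊗ (0≤r ⊗ 0≤r) ⊕ 0≤r)
      (solve 2 (λ w i → let r = w :* i in con 2ℚ :* (w :* (w :* w)) :* (i :* (i :* i)) :+ (con 3ℚ :* (r :* r) :+ r)
        := r :* (con 1ℚ :+ r) :* (con 1ℚ :+ con 2ℚ :* r)) refl (ι w) i))
    (≤-trans (squares-lower 0≤y 0≤r ratio (suc n ℕ.* suc n)) (+-monoʳ-≤ (squares y (suc n ℕ.* suc n)) small))
    where
    N = ι (suc n)
    i = 1/suc m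
    y = χ n ^ℚ suc m
    r = ι w * i
    0≤y = ^-nonNeg (0≤χ n) (suc m)
    0≤r : 0ℚ ≤ r
    0≤r = 0≤ι w ⊗ 0≤1/suc m
    r≤N : r ≤ N
    r≤N = ≤-trans (*-mono-≤-nonNeg (0≤ι w) (ι-mono (ℕₚ.≤-trans (ℕₚ.m≤m+n w (suc m)) le)) (0≤1/suc m) (1/suc≤1 m))
            (≤-reflexive (*-identityʳ N))
    ratio : r ≤ y * (1ℚ + r)
    ratio = ≤-trans (*-monoʳ (0≤1/suc m) (χ-power n w (suc m) le)) (≤-reflexive (trans
      (cong (λ t → t * y * i) (ι-+ w (suc m)))
      (trans (solve 4 (λ w s y i → (w :+ s) :* y :* i := y :* (s :* i :+ w :* i)) refl (ι w) (ι (suc m)) y i)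
        (cong (λ t → y * (t + r)) (ι*1/suc m)))))
    y≤χ : y ≤ χ n
    y≤χ = ≤-trans (*-monoˡ (0≤χ n) (^≤1 (0≤χ n) (χ≤1 n) m)) (≤-reflexive (*-identityʳ _))
    small : y ^ℚ (suc n ℕ.* suc n) * tail r (ι (suc n ℕ.* suc n)) ≤ N * N
    small = ≤-trans
      (*-mono-≤-nonNeg (^-nonNeg 0≤y (suc n ℕ.* suc n)) (^-mono 0≤y y≤χ (suc n ℕ.* suc n)) (0≤tail 0≤r (0≤ι (suc n ℕ.* suc n)))
        (≤-trans (tail-mono (0≤ι (suc n ℕ.* suc n)) 0≤r r≤N)
          (≤-trans (≤-reflexive (cong (tail N) (ι-* (suc n) (suc n)))) (tail-crude n))))
      (≤-trans (≤-reflexive (sym (*-assoc (χ n ^ℚ (suc n ℕ.* suc n)) (11ℚ * cube N) (N * N))))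
        (≤-trans (*-monoʳ (0≤ι (suc n) ⊗ 0≤ι (suc n)) (≤-trans
            (*-monoˡ (^-nonNeg (0≤χ n) (suc n ℕ.* suc n)) eleven) (χ^N²-small n)))
          (≤-reflexive (*-identityˡ _))))
      where
      eleven : 11ℚ * cube N ≤ ι (2 ℕ.^ suc n)
      eleven = ≤-trans (≤-reflexive (sym (trans (ι-* 11 _) (cong₂ _*_ (ι≡ 11)
          (trans (ι-* (suc n) _) (cong (N *_) (ι-* (suc n) (suc n))))))))
        (ι-mono (11*cube≤2^ 16≤N))

  ∑-squares-χ-lower : ∀ n w K → 16 ℕ.≤ suc n → w ℕ.+ K ℕ.≤ suc n →
    2ℚ * zeta₃ K * cube (ι w) ≤
    ∑ℚ K (λ m → squares (χ n ^ℚ suc m) (suc n ℕ.* suc n)) + ι K * (ι (suc n) * ι (suc n))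
  ∑-squares-χ-lower n w K 16≤N le = ≤-trans
    (≤-reflexive (trans (solve 3 (λ t z c → t :* z :* c := t :* c :* z) refl 2ℚ (zeta₃ K) (cube (ι w)))
      (sym (∑ℚ-distribˡ K (2ℚ * cube (ι w)) (λ m → cube (1/suc m))))))
    (≤-trans (∑ℚ-mono K (λ m m<K → squares-χ-lower n w m 16≤N
        (ℕₚ.≤-trans (ℕₚ.+-monoʳ-≤ w m<K) le)))
      (≤-reflexive (trans (∑ℚ-distrib-+ K f (λ _ → N²)) (cong (∑ℚ K f +_) (constant K)))))
    where
    N² = ι (suc n) * ι (suc n)
    f : ℕ → ℚ
    f m = squares (χ n ^ℚ suc m) (suc n ℕ.* suc n)
    constant : ∀ K → ∑ℚ K (λ _ → N²) ≡ ι K * N²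
    constant zero    = sym (trans (cong (_* N²) ι-0) (*-zeroˡ N²))
    constant (suc K) = trans (cong (_+ N²) (constant K))
      (trans (solve 2 (λ k n → k :* n :+ n := (con 1ℚ :+ k) :* n) refl (ι K) N²) (cong (_* N²) (sym (ι-suc K))))

  double-mono : ∀ p k {M D M′ D′} → M ℕ.≤ M′ → D ℕ.≤ D′ → double p k M D ≤ double p k M′ D′
  double-mono p k {M} {D} {M′} {D′} M≤ D≤ = ≤-trans
    (∑ℚ-mono M (λ m _ → ∑ℚ-range D D′ D≤ (λ d → 0≤term m d)))
    (∑ℚ-range M M′ M≤ (λ m → 0≤∑ℚ D′ (λ d _ → 0≤term m d)))
    where
    0≤term : ∀ m d → 0ℚ ≤ ι (suc d) * ι (suc d) * ι (shift (suc m ℕ.* suc d) p k)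
    0≤term m d = 0≤ι (suc d) ⊗ 0≤ι (suc d) ⊗ 0≤ι _

  χ-step : ∀ n → χ n ≡ χ (step n) * χ (suc n)
  χ-step n = sym (begin
    σ * x                                 ≡⟨ sym (*-identityʳ _) ⟩
    σ * x * 1ℚ                            ≡⟨ cong (σ * x *_) (sym (χ*ρ n)) ⟩
    σ * x * (χ n * ρ n)                   ≡⟨ cong (λ r → σ * x * (χ n * r)) (ρ-step n) ⟩
    σ * x * (χ n * (ρ (step n) * ρ (suc n)))
      ≡⟨ solve 5 (λ s x z r t → s :* x :* (z :* (r :* t)) := z :* ((s :* r) :* (x :* t))) refl
           σ x (χ n) (ρ (step n)) (ρ (suc n)) ⟩
    χ n * ((σ * ρ (step n)) * (x * ρ (suc n)))
      ≡⟨ cong₂ (λ s t → χ n * (s * t)) (χ*ρ (step n)) (χ*ρ (suc n)) ⟩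
    χ n * (1ℚ * 1ℚ)                       ≡⟨ *-identityʳ (χ n) ⟩
    χ n ∎)
    where
    open ≡-Reasoning
    σ = χ (step n)
    x = χ (suc n)

  ^-antitone : ∀ {a j k} → 0ℚ ≤ a → a ≤ 1ℚ → j ℕ.≤ k → a ^ℚ k ≤ a ^ℚ j
  ^-antitone {a} {j} {k} 0≤a a≤1 j≤k = subst (λ k → a ^ℚ k ≤ a ^ℚ j) (ℕₚ.m+[n∸m]≡n j≤k)
    (≤-trans (≤-reflexive (^-+ a j (k ℕ.∸ j)))
      (≤-trans (*-monoˡ (^-nonNeg 0≤a j) (^≤1 0≤a a≤1 (k ℕ.∸ j))) (≤-reflexive (*-identityʳ _))))

-- The lower bound: induction over windows of arguments.

module LowerBound where
  open import Data.Nat as ℕ using (ℕ; zero; suc)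
  import Data.Nat.Properties as ℕₚ
  import Data.Nat.Solver as ℕSolver
  open import Data.Nat.Induction using (<-rec)
  import Data.Integer as ℤ
  open import Data.Rational as ℚ using (ℚ; 0ℚ; 1ℚ; _+_; _*_; _-_; -_; _≤_; _<_; _/_)
  open import Data.Rational.Properties
  open import Data.Rational.Solver using (module +-*-Solver)
  open import Algebra.Definitions.RawSemiring ℚ.+-*-rawSemiring using () renaming (_^_ to _^ℚ_)
  open import Data.Product using (∃-syntax; _×_; _,_; proj₁; proj₂)
  open import Data.Sum using (inj₁; inj₂)
  open import Relation.Binary.PropositionalEquality
  open import Defs using (∑ℚ; *-mono-≤-nonNeg; 1/suc_; ^-nonNeg; logSeq)
  open +-*-Solver using (solve; _:+_; _:*_; _:-_; :-_; _:=_; con)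
  open ℕSolver.+-*-Solver using () renaming (solve to solveℕ; _:+_ to _⊞_; _:*_ to _⊠_; _:=_ to _⩵_;
    con to conℕ)
  open Shift
  open Rational
  open Logarithm
  open Geometric
  open Upper
  open Lower

  module _ (p : ℕ → ℕ) (rec : Recurrence p) (1≤p : ∀ k → 1 ℕ.≤ p k) (K′ : ℕ) where

    private
      K = suc K′
      Z = zeta₃ K

      1≤Z : 1ℚ ≤ Z
      1≤Z = ∑ℚ-range 1 K (ℕ.s≤s ℕ.z≤n) (λ k → 0≤1/suc k ⊗ (0≤1/suc k ⊗ 0≤1/suc k))

      0≤Z : 0ℚ ≤ Z
      0≤Z = ≤-trans (<⇒≤ 0<1) 1≤Z

      0≤2 : 0ℚ ≤ 2ℚ
      0≤2 = nonNegative⁻¹ 2ℚ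

      volume : ℕ → ℚ
      volume v = 2ℚ * Z * cube (ι v)

      0≤volume : ∀ v → 0ℚ ≤ volume v
      0≤volume v = 0≤2 ⊗ 0≤Z ⊗ (0≤ι v ⊗ (0≤ι v ⊗ 0≤ι v))

      opaque
        F : ℕ → ℕ
        F v = proj₁ (floor (0≤volume v))

        F≤ : ∀ v → ι (F v) ≤ volume v
        F≤ v = proj₁ (proj₂ (floor (0≤volume v)))

        <F : ∀ v → volume v < ι (suc (F v))
        <F v = proj₂ (proj₂ (floor (0≤volume v)))

      -- Makes `N v = v + 3 K`. The truncated sum reaches `2 Z w³ - K N²` for `w + K ≤ N v`; with
      -- `w = v + 2 K` the surplus of `2 Z w³` over `2 Z v³` pays for the error `K N²`.
      c : ℕ
      c = 2 ℕ.+ 3 ℕ.* K′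

      -- On (F (v - 1) , F v] the growth rate is compared with χ (n v).
      n N : ℕ → ℕ
      n v = v ℕ.+ c
      N v = suc (n v)

      -- The furthest that the recurrence truncated to `m ≤ K` and `d ≤ N²` looks back.
      W : ℕ → ℕ
      W v = K ℕ.* (N v ℕ.* N v)

      module Large (v : ℕ) (16K≤v : 16 ℕ.* K ℕ.≤ v) where

        private
          sN≤2v : suc (N v) ℕ.≤ v ℕ.+ v
          sN≤2v = ℕₚ.≤-trans (ℕₚ.≤-reflexive (sym (trans (ℕₚ.+-suc v (suc c)) (cong suc (ℕₚ.+-suc v c)))))
            (ℕₚ.+-monoʳ-≤ v (ℕₚ.≤-trans (ℕₚ.≤-trans (ℕₚ.m≤m+n (2 ℕ.+ c) (12 ℕ.+ 13 ℕ.* K′))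
              (ℕₚ.≤-reflexive (solveℕ 1 (λ k → (conℕ 4 ⊞ conℕ 3 ⊠ k) ⊞ (conℕ 12 ⊞ conℕ 13 ⊠ k)
                ⩵ conℕ 16 ⊠ (conℕ 1 ⊞ k)) refl K′))) 16K≤v))

          K*≤v : ∀ i → i ℕ.≤ 16 → i ℕ.* K ℕ.≤ v
          K*≤v i i≤16 = ℕₚ.≤-trans (ℕₚ.*-monoˡ-≤ K i≤16) 16K≤v

          1≤v : 1 ℕ.≤ v
          1≤v = ℕₚ.≤-trans (ℕ.s≤s ℕ.z≤n) 16K≤v

        16≤N : 16 ℕ.≤ N v
        16≤N = ℕₚ.≤-trans (ℕₚ.≤-trans (ℕₚ.m≤m*n 16 K) 16K≤v) (ℕₚ.≤-trans (ℕₚ.m≤m+n v c) (ℕₚ.n≤1+n (n v)))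

        -- `W (suc v)` is at most `4 K v²`, whereas `F v` is at least `v³`. The factor `16` in
        -- `16 K ≤ v` is due to `16≤N`; `4` would do here.
        W≤F : W (suc v) ℕ.≤ F v
        W≤F = ℕₚ.≤-trans (ℕₚ.*-monoʳ-≤ K (ℕₚ.*-mono-≤ sN≤2v sN≤2v))
          (ℕₚ.≤-trans (ℕₚ.≤-reflexive (solveℕ 2 (λ k v → k ⊠ ((v ⊞ v) ⊠ (v ⊞ v)) ⩵ (conℕ 4 ⊠ k) ⊠ (v ⊠ v)) refl K v))
            (ℕₚ.≤-trans (ℕₚ.*-monoˡ-≤ (v ℕ.* v) (K*≤v 4 (ℕₚ.≤ᵇ⇒≤ 4 16 _)))
              (ℕₚ.≤-pred (ι-cancel-< (≤-<-trans v³≤ (<F v))))))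
          where
          V = ι v
          v³≤ : ι (v ℕ.* (v ℕ.* v)) ≤ volume v
          v³≤ = ≤-trans (≤-reflexive (trans (ι-* v (v ℕ.* v)) (cong (V *_) (ι-* v v))))
            (≤-by ((1ℚ + 2ℚ * (Z - 1ℚ)) * cube V) ((<⇒≤ 0<1 ⊕ 0≤2 ⊗ ≤⇒0≤- 1≤Z) ⊗ (0≤ι v ⊗ (0≤ι v ⊗ 0≤ι v)))
              (solve 2 (λ z t → t :+ (con 1ℚ :+ con 2ℚ :* (z :- con 1ℚ)) :* t := con 2ℚ :* z :* t) refl Z (cube V)))

        F-gap : F v ℕ.+ v ℕ.* v ℕ.≤ F (suc v)
        F-gap = ℕₚ.≤-pred (ι-cancel-< (≤-<-trans (≤-trans
          (≤-reflexive (trans (ι-+ (F v) (v ℕ.* v)) (cong (ι (F v) +_) (ι-* v v))))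
          (≤-trans (+-monoˡ-≤ (V * V) (F≤ v))
            (≤-by (5ℚ * (V * V) + 6ℚ * V + 2ℚ + 2ℚ * (Z - 1ℚ) * (3ℚ * (V * V) + 3ℚ * V + 1ℚ))
              (nonNegative⁻¹ 5ℚ ⊗ (0≤V ⊗ 0≤V) ⊕ nonNegative⁻¹ 6ℚ ⊗ 0≤V ⊕ 0≤2
                ⊕ 0≤2 ⊗ ≤⇒0≤- 1≤Z ⊗ (nonNegative⁻¹ 3ℚ ⊗ (0≤V ⊗ 0≤V) ⊕ nonNegative⁻¹ 3ℚ ⊗ 0≤V ⊕ <⇒≤ 0<1))
              (trans (solve 2 (λ z V → let S = con 1ℚ :+ V in con 2ℚ :* z :* (V :* (V :* V)) :+ V :* V
                    :+ (con 5ℚ :* (V :* V) :+ con 6ℚ :* V :+ con 2ℚ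
                      :+ con 2ℚ :* (z :- con 1ℚ) :* (con 3ℚ :* (V :* V) :+ con 3ℚ :* V :+ con 1ℚ))
                  := con 2ℚ :* z :* (S :* (S :* S))) refl Z V)
                (cong (λ t → 2ℚ * Z * cube t) (sym (ι-suc v)))))))
          (<F (suc v))))
          where
          5ℚ = ℤ.+ 5 / 1
          6ℚ = ℤ.+ 6 / 1
          V = ι v
          0≤V = 0≤ι v

        -- `F` grows by at least `v²`, `W` only by `K (2 N + 3) ≤ 5 K v`. Hence the arguments
        -- covered after one step include all that the next step looks back at.
        F∸W-mono : F v ℕ.∸ W (suc v) ℕ.≤ F (suc v) ℕ.∸ W (suc (suc v))
        F∸W-mono = ℕₚ.m+n≤o⇒m≤o∸n (F v ℕ.∸ W (suc v)) (ℕₚ.≤-trans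
          (ℕₚ.≤-reflexive (trans
            (cong (F v ℕ.∸ W (suc v) ℕ.+_) (solveℕ 2 (λ k N → let s = conℕ 2 ⊞ N ; t = conℕ 1 ⊞ N in
              k ⊠ (s ⊠ s) ⩵ k ⊠ (t ⊠ t) ⊞ k ⊠ (N ⊞ N ⊞ conℕ 3)) refl K (N v)))
            (trans (sym (ℕₚ.+-assoc (F v ℕ.∸ W (suc v)) (W (suc v)) _))
              (cong (ℕ._+ K ℕ.* (N v ℕ.+ N v ℕ.+ 3)) (ℕₚ.m∸n+n≡m W≤F)))))
          (ℕₚ.≤-trans (ℕₚ.+-monoʳ-≤ (F v) (ℕₚ.≤-trans (ℕₚ.*-monoʳ-≤ K linear)
              (ℕₚ.≤-trans (ℕₚ.≤-reflexive (solveℕ 2 (λ k v → k ⊠ (conℕ 5 ⊠ v) ⩵ (conℕ 5 ⊠ k) ⊠ v) refl K v))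
                (ℕₚ.*-monoˡ-≤ v (K*≤v 5 (ℕₚ.≤ᵇ⇒≤ 5 16 _))))))
            F-gap))
          where
          linear : N v ℕ.+ N v ℕ.+ 3 ℕ.≤ 5 ℕ.* v
          linear = ℕₚ.≤-trans
            (ℕₚ.≤-reflexive (solveℕ 1 (λ N → N ⊞ N ⊞ conℕ 3 ⩵ ((conℕ 1 ⊞ N) ⊞ (conℕ 1 ⊞ N)) ⊞ conℕ 1) refl (N v)))
            (ℕₚ.≤-trans (ℕₚ.+-mono-≤ (ℕₚ.+-mono-≤ sN≤2v sN≤2v) 1≤v)
              (ℕₚ.≤-reflexive (solveℕ 1 (λ v → ((v ⊞ v) ⊞ (v ⊞ v)) ⊞ v ⩵ conℕ 5 ⊠ v) refl v)))

        volume≤squares : volume v ≤ ∑ℚ K (λ m → squares (χ (n v) ^ℚ suc m) (N v ℕ.* N v))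
        volume≤squares = ≤-trans
          (≤-by _ (≤⇒0≤- poly) (solve 3 (λ a b t → a :+ (t :- (a :+ b)) := t :- b) refl (volume v) (κ * (M * M)) (volume w)))
          (≤-trans (+-monoˡ-≤ (- (κ * (M * M))) (∑-squares-χ-lower (n v) w K 16≤N
              (ℕₚ.≤-reflexive (solveℕ 2 (λ v k → (v ⊞ conℕ 2 ⊠ (conℕ 1 ⊞ k)) ⊞ (conℕ 1 ⊞ k)
                ⩵ conℕ 1 ⊞ (v ⊞ (conℕ 2 ⊞ conℕ 3 ⊠ k))) refl v K′))))
            (≤-reflexive (solve 2 (λ s b → (s :+ b) :- b := s) refl
              (∑ℚ K (λ m → squares (χ (n v) ^ℚ suc m) (N v ℕ.* N v))) (κ * (M * M)))))
          where
          w = v ℕ.+ 2 ℕ.* K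
          V = ι v
          κ = ι K
          M = ι (N v)
          11ℚ = ℤ.+ 11 / 1
          18ℚ = ℤ.+ 18 / 1
          7ℚ = ℤ.+ 7 / 1
          6ℚ = ℤ.+ 6 / 1
          12ℚ = ℤ.+ 12 / 1
          8ℚ = ℤ.+ 8 / 1
          ιw : ι w ≡ V + 2ℚ * κ
          ιw = trans (ι-+ v (2 ℕ.* K)) (cong (V +_) (trans (ι-* 2 K) (cong (_* κ) (ι≡ 2))))
          M≡ : M ≡ V + 3ℚ * κ
          M≡ = trans (cong ι (solveℕ 2 (λ v k → conℕ 1 ⊞ (v ⊞ (conℕ 2 ⊞ conℕ 3 ⊠ k))
                 ⩵ v ⊞ conℕ 3 ⊠ (conℕ 1 ⊞ k)) refl v K′))
            (trans (ι-+ v (3 ℕ.* K)) (cong (V +_) (trans (ι-* 3 K) (cong (_* κ) (ι≡ 3)))))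
          poly : volume v + κ * (M * M) ≤ volume w
          poly = subst₂ (λ w M → volume v + κ * (M * M) ≤ 2ℚ * Z * cube w) (sym ιw) (sym M≡)
            (≤-by (κ * (11ℚ * (V * V) + 18ℚ * (κ * V) + 7ℚ * (κ * κ)
                    + 2ℚ * (Z - 1ℚ) * (6ℚ * (V * V) + 12ℚ * (κ * V) + 8ℚ * (κ * κ))))
              (0≤κ ⊗ (nonNegative⁻¹ 11ℚ ⊗ (0≤V ⊗ 0≤V) ⊕ nonNegative⁻¹ 18ℚ ⊗ (0≤κ ⊗ 0≤V) ⊕ nonNegative⁻¹ 7ℚ ⊗ (0≤κ ⊗ 0≤κ)
                ⊕ 0≤2 ⊗ ≤⇒0≤- 1≤Z ⊗ (nonNegative⁻¹ 6ℚ ⊗ (0≤V ⊗ 0≤V) ⊕ nonNegative⁻¹ 12ℚ ⊗ (0≤κ ⊗ 0≤V)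
                  ⊕ nonNegative⁻¹ 8ℚ ⊗ (0≤κ ⊗ 0≤κ))))
              (solve 3 (λ z V k → let w = V :+ con 2ℚ :* k ; M = V :+ con 3ℚ :* k in
                con 2ℚ :* z :* (V :* (V :* V)) :+ k :* (M :* M)
                :+ k :* (con 11ℚ :* (V :* V) :+ con 18ℚ :* (k :* V) :+ con 7ℚ :* (k :* k)
                  :+ con 2ℚ :* (z :- con 1ℚ) :* (con 6ℚ :* (V :* V) :+ con 12ℚ :* (k :* V) :+ con 8ℚ :* (k :* k)))
                := con 2ℚ :* z :* (w :* (w :* w))) refl Z V κ))
            where
            0≤V = 0≤ι v
            0≤κ = 0≤ι K

      b : ℚ
      b = ι (2 ℕ.+ c)

      4ℚ = ℤ.+ 4 / 1

      -- Chosen so that `budget` drops exactly by the amount in `gain` when `V` grows by one.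
      L : ℚ
      L = 4ℚ * Z * b + 1ℚ + ι K + Z

      0≤L : 0ℚ ≤ L
      0≤L = nonNegative⁻¹ 4ℚ ⊗ 0≤Z ⊗ 0≤ι (2 ℕ.+ c) ⊕ <⇒≤ 0<1 ⊕ 0≤ι K ⊕ 0≤Z

      budget : ℚ → ℚ → ℚ
      budget C V = C - Z * (V * V) + L * V

      -- `bound` is `p k ≥ ρ^k / e` without the division. It is required only between `t` and `F v`,
      -- where `t` lies far enough back for the next application of the recurrence.
      record Bound (C : ℚ) (v : ℕ) : Set where
        field
          e u   : ℚ
          t     : ℕ
          t≤    : t ℕ.≤ F v ℕ.∸ W (suc v)
          0≤e   : 0ℚ ≤ e
          bound : ∀ k → t ℕ.≤ k → k ℕ.≤ F v → 1ℚ ≤ ι (p k) * (e * χ (n v) ^ℚ k)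
          log-e : Log≤ e u
          u≤    : u ≤ budget C (ι v)
      open Bound

      1≤ιp : ∀ k → 1ℚ ≤ ι (p k)
      1≤ιp k = ≤-trans (≤-reflexive (sym ι-1)) (ι-mono (1≤p k))

      module First (v : ℕ) where

        C : ℚ
        C = ι (F v) * (1/suc (n v)) + Z * (ι v * ι v)

        0≤C : 0ℚ ≤ C
        0≤C = 0≤ι (F v) ⊗ 0≤1/suc (n v) ⊕ 0≤Z ⊗ (0≤ι v ⊗ 0≤ι v)

        -- At the start only `1 ≤ p k` is available; `e = ρ^(F v)` outweighs `χ^k` for all
        -- `k ≤ F v`.
        first : Bound C v
        first = record
          { e     = ρ (n v) ^ℚ F v
          ; u     = ι (F v) * (1/suc (n v))
          ; t     = 0
          ; t≤    = ℕ.z≤n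
          ; 0≤e   = ^-nonNeg (0≤ρ (n v)) (F v)
          ; bound = λ k _ k≤F → ≤-trans (≤-reflexive (sym (*-identityˡ 1ℚ)))
              (*-mono-≤-nonNeg (<⇒≤ 0<1) (1≤ιp k) (<⇒≤ 0<1)
                (≤-trans (≤-reflexive (sym (trans (*-comm (ρ (n v) ^ℚ F v) (χ (n v) ^ℚ F v)) (χ^*ρ^ (n v) (F v)))))
                  (*-monoˡ (^-nonNeg (0≤ρ (n v)) (F v)) (^-antitone (0≤χ (n v)) (χ≤1 (n v)) k≤F))))
          ; log-e = Log≤-^ (0≤ρ (n v)) (Log≤-1+ (n v)) (F v)
          ; u≤    = ≤-by (L * ι v) (0≤L ⊗ 0≤ι v)
              (solve 3 (λ u s t → u :+ t := ((u :+ s) :- s) :+ t) refl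
                (ι (F v) * (1/suc (n v))) (Z * (ι v * ι v)) (L * ι v))
          }

      module Next {C₀ : ℚ} (v : ℕ) (16K≤v : 16 ℕ.* K ℕ.≤ v) (B : Bound C₀ v) where
        open Large v 16K≤v

        σ g : ℚ
        σ = χ (step (n v))
        g = 1/suc (suc (step (n v)))

        x : ℚ
        x = χ (n (suc v))

        t′ : ℕ
        t′ = F v ℕ.∸ W (suc v)

        -- The old bound carries the factor `σ^k` with `σ ≤ 1`, which is at most `σ^t′` from `t′`
        -- on: giving up the arguments below `t′` is what improves the constant.
        e′ : ℚ
        e′ = e B * σ ^ℚ t′

        0≤e′ : 0ℚ ≤ e′
        0≤e′ = 0≤e B ⊗ ^-nonNeg (0≤χ (step (n v))) t′

        inherit : ∀ k → t′ ℕ.≤ k → k ℕ.≤ F v → 1ℚ ≤ ι (p k) * (e′ * x ^ℚ k)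
        inherit k t′≤k k≤F = ≤-trans (bound B k (ℕₚ.≤-trans (t≤ B) t′≤k) k≤F)
          (*-monoˡ (0≤ι (p k)) (≤-trans
            (≤-reflexive (trans (cong (λ y → e B * y ^ℚ k) (χ-step (n v)))
              (trans (cong (e B *_) (*-^ σ x k)) (sym (*-assoc (e B) _ _)))))
            (*-monoʳ (^-nonNeg (0≤χ (n (suc v))) k)
              (*-monoˡ (0≤e B) (^-antitone (0≤χ (step (n v))) (χ≤1 (step (n v))) t′≤k)))))

        D : ℕ
        D = N (suc v) ℕ.* N (suc v)

        -- `k ≤ F (suc v)` is below the double sum of `d² x^(m d)`. The bound at `k - m d` gives
        -- `x^(m d) ≤ X p(k - m d)` with `X = e′ x^k`, so the recurrence yields `k ≤ X k p(k)`, and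
        -- `k` cancels.
        extend : ∀ k → (∀ {j} → j ℕ.< k → t′ ℕ.≤ j → j ℕ.≤ F (suc v) → 1ℚ ≤ ι (p j) * (e′ * x ^ℚ j)) →
                 F v ℕ.< k → k ℕ.≤ F (suc v) → 1ℚ ≤ ι (p k) * (e′ * x ^ℚ k)
        extend k ih F<k k≤F′ = *-cancelʳ 0<k (≤-trans (≤-reflexive (*-identityˡ (ι k)))
          (≤-trans (≤-trans (ι-mono k≤F′) (≤-trans (F≤ (suc v)) (Large.volume≤squares (suc v) (ℕₚ.m≤n⇒m≤1+n 16K≤v))))
            (≤-trans (≤-reflexive (sym (trans (∑-factor 1ℚ (n (suc v)) K D) (*-identityˡ _))))
              (≤-trans (∑ℚ-mono K (λ m m<K → ∑ℚ-mono D (λ d d<D →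
                  *-monoˡ (0≤ι (suc d) ⊗ 0≤ι (suc d)) (shift-lower m d m<K d<D))))
                (≤-trans (≤-reflexive factor)
                  (≤-trans (*-monoˡ 0≤X (double-mono p k K≤ D≤))
                    (≤-reflexive (trans (cong (X *_) (sym (recurrence-ℚ rec k)))
                      (solve 3 (λ X k p → X :* (k :* p) := (p :* X) :* k) refl X (ι k) (ι (p k)))))))))))
          where
          X = e′ * x ^ℚ k
          0≤X : 0ℚ ≤ X
          0≤X = 0≤e′ ⊗ ^-nonNeg (0≤χ (n (suc v))) k
          0<k : 0ℚ < ι k
          0<k = <-≤-trans (0<ι (F v)) (ι-mono F<k)
          W≤k : W (suc v) ℕ.≤ k
          W≤k = ℕₚ.≤-trans W≤F (ℕₚ.<⇒≤ F<k)
          K≤ : K ℕ.≤ suc k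
          K≤ = ℕₚ.m≤n⇒m≤1+n (ℕₚ.≤-trans (ℕₚ.m≤m*n K D) W≤k)
          D≤ : D ℕ.≤ suc k
          D≤ = ℕₚ.m≤n⇒m≤1+n (ℕₚ.≤-trans (ℕₚ.m≤n*m D K) W≤k)
          factor : ∑ℚ K (λ m → ∑ℚ D (λ d → ι (suc d) * ι (suc d) * (X * ι (shift (suc m ℕ.* suc d) p k))))
                   ≡ X * double p k K D
          factor = trans
            (∑ℚ-cong< K (λ m _ → trans
              (∑ℚ-cong< D (λ d _ → solve 3 (λ s X t → s :* (X :* t) := X :* (s :* t)) refl
                (ι (suc d) * ι (suc d)) X (ι (shift (suc m ℕ.* suc d) p k))))
              (∑ℚ-distribˡ D X (λ d → ι (suc d) * ι (suc d) * ι (shift (suc m ℕ.* suc d) p k)))))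
            (∑ℚ-distribˡ K X (λ m → ∑ℚ D (λ d → ι (suc d) * ι (suc d) * ι (shift (suc m ℕ.* suc d) p k))))
          shift-lower : ∀ m d → m ℕ.< K → d ℕ.< D →
            1ℚ * x ^ℚ (suc m ℕ.* suc d) ≤ X * ι (shift (suc m ℕ.* suc d) p k)
          shift-lower m d m<K d<D = ≤-trans (*-monoʳ (^-nonNeg (0≤χ (n (suc v))) j)
              (ih (ℕₚ.∸-monoʳ-< (ℕ.s≤s ℕ.z≤n) j≤k) (ℕₚ.∸-mono (ℕₚ.<⇒≤ F<k) j≤W)
                  (ℕₚ.≤-trans (ℕₚ.m∸n≤m k j) k≤F′)))
            (≤-reflexive (trans
              (solve 4 (λ q e y z → (q :* (e :* y)) :* z := (e :* (y :* z)) :* q) refl (ι (p (k ℕ.∸ j))) e′ (x ^ℚ (k ℕ.∸ j)) (x ^ℚ j))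
              (cong₂ (λ y q → e′ * y * ι q)
                (trans (sym (^-+ x (k ℕ.∸ j) j)) (cong (x ^ℚ_) (ℕₚ.m∸n+n≡m j≤k)))
                (sym (shift-≤ j p k j≤k)))))
            where
            j = suc m ℕ.* suc d
            j≤W : j ℕ.≤ W (suc v)
            j≤W = ℕₚ.*-mono-≤ m<K d<D
            j≤k : j ℕ.≤ k
            j≤k = ℕₚ.≤-trans j≤W W≤k

        bound′ : ∀ k → t′ ℕ.≤ k → k ℕ.≤ F (suc v) → 1ℚ ≤ ι (p k) * (e′ * x ^ℚ k)
        bound′ = <-rec _ go
          where
          go : ∀ k → (∀ {j} → j ℕ.< k → t′ ℕ.≤ j → j ℕ.≤ F (suc v) → 1ℚ ≤ ι (p j) * (e′ * x ^ℚ j)) →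
               t′ ℕ.≤ k → k ℕ.≤ F (suc v) → 1ℚ ≤ ι (p k) * (e′ * x ^ℚ k)
          go k ih t′≤k k≤F′ with ℕₚ.≤-<-connex k (F v)
          ... | inj₁ k≤F = inherit k t′≤k k≤F
          ... | inj₂ F<k = extend k ih F<k k≤F′

        V = ι v
        M = ι (suc (suc (n v)))

        -- `step (n v) + 2` is `N (N + 2) + 1`, the square of `N + 1`.
        MMg : M * M * g ≡ 1ℚ
        MMg = trans (cong (_* g) (trans
            (trans (cong (λ M → M * M) (ι-suc (suc (n v))))
              (solve 1 (λ N → (con 1ℚ :+ N) :* (con 1ℚ :+ N) := con 1ℚ :+ N :* (con 1ℚ :+ (con 1ℚ :+ N))) refl (ι (suc (n v)))))
            (sym (trans (ι-suc (suc (step (n v)))) (cong (1ℚ +_) (trans (ι-* (suc (n v)) (suc (suc (suc (n v)))))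
              (cong (ι (suc (n v)) *_) (trans (ι-suc (suc (suc (n v)))) (cong (1ℚ +_) (ι-suc (suc (n v)))))))))))) 
          (ι*1/suc (suc (step (n v))))

        M≡ : M ≡ V + b
        M≡ = trans (cong ι (sym (trans (ℕₚ.+-suc v (suc c)) (cong suc (ℕₚ.+-suc v c))))) (ι-+ v (2 ℕ.+ c))

        0≤g = 0≤1/suc (suc (step (n v)))

        V-2b≤ : V - 2ℚ * b ≤ cube V * g
        V-2b≤ = ≤-trans (≤-reflexive (sym (trans (*-assoc (V - 2ℚ * b) (M * M) g) (trans (cong ((V - 2ℚ * b) *_) MMg) (*-identityʳ _)))))
          (*-monoʳ 0≤g (≤-by {p = (V - 2ℚ * b) * (M * M)} (b * b * (3ℚ * V + 2ℚ * b))
            (0≤ι (2 ℕ.+ c) ⊗ 0≤ι (2 ℕ.+ c) ⊗ (nonNegative⁻¹ 3ℚ ⊗ 0≤ι v ⊕ 0≤2 ⊗ 0≤ι (2 ℕ.+ c)))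
            (trans (cong (λ M → (V - 2ℚ * b) * (M * M) + b * b * (3ℚ * V + 2ℚ * b)) M≡)
              (solve 2 (λ V b → (V :- con 2ℚ :* b) :* ((V :+ b) :* (V :+ b)) :+ b :* b :* (con 3ℚ :* V :+ con 2ℚ :* b)
                := V :* (V :* V)) refl V b))))

        ιt′ : 2ℚ * Z * cube V - 1ℚ - ι K * (M * M) ≤ ι t′
        ιt′ = ≤-by (1ℚ + ι (F v) - volume v) (≤⇒0≤- (≤-trans (<⇒≤ (<F v)) (≤-reflexive (ι-suc (F v)))))
          (trans (cong (λ f → 2ℚ * Z * cube V - 1ℚ - ι K * (M * M) + (1ℚ + f - volume v)) (sym F≡))
            (solve 3 (λ y w t → (y :- con 1ℚ :- w) :+ (con 1ℚ :+ (t :+ w) :- y) := t) refl (volume v) (ι K * (M * M)) (ι t′)))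
          where
          F≡ : ι t′ + ι K * (M * M) ≡ ι (F v)
          F≡ = trans (cong (ι t′ +_) (sym (trans (ι-* K _) (cong (ι K *_) (ι-* (N (suc v)) (N (suc v)))))))
            (trans (sym (ι-+ t′ (W (suc v)))) (cong ι (ℕₚ.m∸n+n≡m W≤F)))

        -- `t′ ≥ 2 Z V³ - 1 - K M²` is multiplied by `g = 1/M²` with `M = V + b`, and
        -- `V³/(V + b)² ≥ V - 2 b`.
        gain : 2ℚ * Z * (V - 2ℚ * b) - 1ℚ - ι K ≤ ι t′ * g
        gain = ≤-trans (+-monoˡ-≤ (- ι K) (+-mono-≤ (*-monoˡ (0≤2 ⊗ 0≤Z) V-2b≤) (neg-antimono-≤ (1/suc≤1 (suc (step (n v)))))))
          (≤-trans (≤-reflexive (trans (cong (λ o → 2ℚ * Z * (cube V * g) - g - o) (sym (trans (cong (ι K *_) MMg) (*-identityʳ (ι K)))))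
              (solve 5 (λ z y g k M → z :* (y :* g) :- g :- k :* (M :* M :* g) := (z :* y :- con 1ℚ :- k :* (M :* M)) :* g) refl
                (2ℚ * Z) (cube V) g (ι K) M)))
            (*-monoʳ 0≤g ιt′))

        next : Bound C₀ (suc v)
        next = record
          { e     = e′
          ; u     = u B + ι t′ * (- g)
          ; t     = t′
          ; t≤    = F∸W-mono
          ; 0≤e   = 0≤e′
          ; bound = bound′
          ; log-e = Log≤-* (0≤e B) (^-nonNeg (0≤χ (step (n v))) t′) (log-e B)
                      (Log≤-^ (0≤χ (step (n v))) (Log≤-1- (step (n v))) t′)
          ; u≤    = ≤-trans (+-mono-≤ (u≤ B)
              (≤-trans (≤-reflexive (sym (neg-distribʳ-* (ι t′) g))) (neg-antimono-≤ gain)))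
              (≤-reflexive (trans
                (solve 5 (λ C Z V b k → let L = con 4ℚ :* Z :* b :+ con 1ℚ :+ k :+ Z ; S = con 1ℚ :+ V in
                  (C :- Z :* (V :* V) :+ L :* V) :+ :- (con 2ℚ :* Z :* (V :- con 2ℚ :* b) :- con 1ℚ :- k)
                  := C :- Z :* (S :* S) :+ L :* S) refl C₀ Z V b (ι K))
                (cong (budget C₀) (sym (ι-suc v)))))
          }

      v₀ = 16 ℕ.* K

      C₀ : ℚ
      C₀ = First.C v₀

      0≤C₀ : 0ℚ ≤ C₀
      0≤C₀ = First.0≤C v₀

      all : ∀ j → Bound C₀ (j ℕ.+ v₀)
      all zero    = First.first v₀
      all (suc j) = Next.next (j ℕ.+ v₀) (ℕₚ.m≤n+m v₀ j) (all j)

      a : ℚ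
      a = ι (3 ℕ.+ c)

      C : ℚ
      C = 2ℚ * Z * a + L + C₀

    log-p-lower : ∃[ C ] (0ℚ ≤ C × ∀ v → 16 ℕ.* K ℕ.≤ v → ∀ k → 2ℚ * Z * cube (ι v) ≤ ι k → ι k < 2ℚ * Z * cube (ι (suc v)) →
      (λ _ → 3ℚ * Z * (ι v * ι v) - C * (1ℚ + ι v)) ≲ logSeq (p k))
    log-p-lower = C , 0≤2 ⊗ 0≤Z ⊗ 0≤ι (3 ℕ.+ c) ⊕ 0≤L ⊕ 0≤C₀ , λ v v₀≤v k lo hi → subst
      (λ v → volume v ≤ ι k → ι k < volume (suc v) → (λ _ → 3ℚ * Z * (ι v * ι v) - C * (1ℚ + ι v)) ≲ logSeq (p k))
      (ℕₚ.m∸n+n≡m v₀≤v) (conclude (v ℕ.∸ v₀) k) lo hi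
      where
      conclude : ∀ j k (let v = j ℕ.+ v₀) → volume v ≤ ι k → ι k < volume (suc v) →
        (λ _ → 3ℚ * Z * (ι v * ι v) - C * (1ℚ + ι v)) ≲ logSeq (p k)
      conclude j k lo hi = go (p k) refl
        where
        v = j ℕ.+ v₀
        V = ι v
        -- Between the two volumes the bound at `suc v` applies: its `t` unfolds to
        -- `F v ∸ W (suc v)`, which is at most `k`.
        B : Bound C₀ (suc v)
        B = all (suc j)
        m = suc (suc (n (suc v)))
        β = 1/suc (suc (n (suc v)))
        F≤k : F v ℕ.≤ k
        F≤k = ι-cancel (≤-trans (F≤ v) lo)
        k≤F : k ℕ.≤ F (suc v)
        k≤F = ℕₚ.≤-pred (ι-cancel-< (<-trans hi (<F (suc v))))
        m≡ : ι m ≡ V + a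
        m≡ = trans (cong ι (sym (trans (ℕₚ.+-suc v (suc (suc c))) (cong suc (trans (ℕₚ.+-suc v (suc c)) (cong suc (ℕₚ.+-suc v c)))))))
          (ι-+ v (3 ℕ.+ c))
        cube≥ : V * V - a * V ≤ cube V * β
        cube≥ = ≤-trans (≤-reflexive (sym (trans (*-assoc (V * V - a * V) (ι m) β)
            (trans (cong ((V * V - a * V) *_) (ι*1/suc (suc (n (suc v))))) (*-identityʳ _)))))
          (*-monoʳ (0≤1/suc (suc (n (suc v)))) (≤-by {p = (V * V - a * V) * ι m} (a * a * V) (0≤ι (3 ℕ.+ c) ⊗ 0≤ι (3 ℕ.+ c) ⊗ 0≤ι v)
            (trans (cong (λ m → (V * V - a * V) * m + a * a * V) m≡)
              (solve 2 (λ V a → (V :* V :- a :* V) :* (V :+ a) :+ a :* a :* V := V :* (V :* V)) refl V a))))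
        kβ≥ : 2ℚ * Z * (V * V - a * V) ≤ ι k * β
        kβ≥ = ≤-trans (*-monoˡ (0≤2 ⊗ 0≤Z) cube≥)
          (≤-trans (≤-reflexive (sym (*-assoc (2ℚ * Z) (cube V) β))) (*-monoʳ (0≤1/suc (suc (n (suc v)))) lo))
        -- With `S = 1 + V`, the constant contributes at least `Z S² - L S - C₀` and the power of
        -- `χ` at least `2 Z (V² - a V)`; together `3 Z V²` up to linear terms.
        value : 3ℚ * Z * (V * V) - C * (1ℚ + V) ≤ - (u B + ι k * (- β))
        value = ≤-trans
          (≤-by (2ℚ * Z * a + C₀ * V + 2ℚ * Z * V + Z)
            (0≤2 ⊗ 0≤Z ⊗ 0≤ι (3 ℕ.+ c) ⊕ 0≤C₀ ⊗ 0≤ι v ⊕ 0≤2 ⊗ 0≤Z ⊗ 0≤ι v ⊕ 0≤Z)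
            (solve 5 (λ Z V a L C → let S = con 1ℚ :+ V in
              con 3ℚ :* Z :* (V :* V) :- (con 2ℚ :* Z :* a :+ L :+ C) :* S :+ (con 2ℚ :* Z :* a :+ C :* V :+ con 2ℚ :* Z :* V :+ Z)
              := (:- (C :- Z :* (S :* S) :+ L :* S)) :+ con 2ℚ :* Z :* (V :* V :- a :* V)) refl Z V a L C₀))
          (≤-trans (+-mono-≤ (neg-antimono-≤ (≤-trans (u≤ B) (≤-reflexive (cong (budget C₀) (ι-suc v))))) kβ≥)
            (≤-reflexive (solve 3 (λ u k β → (:- u) :+ k :* β := :- (u :+ k :* (:- β))) refl (u B) (ι k) β)))
        go : ∀ P → p k ≡ P → (λ _ → 3ℚ * Z * (V * V) - C * (1ℚ + V)) ≲ logSeq P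
        go zero    eq with ℕₚ.≤-trans (1≤p k) (ℕₚ.≤-reflexive eq)
        ... | ()
        go (suc P) eq = ≲-trans (≤⇒≲ (λ _ → value)) (log-lower
          (subst (λ q → 1ℚ ≤ ι q * (e B * χ (n (suc v)) ^ℚ k)) eq
            (bound B k (ℕₚ.≤-trans (ℕₚ.m∸n≤m (F v) (W (suc v))) F≤k) k≤F))
          (Log≤-* (0≤e B) (^-nonNeg (0≤χ (n (suc v))) k) (log-e B)
            (Log≤-^ (0≤χ (n (suc v))) (Log≤-1- (n (suc v))) k)))

-- From bounds at levels to bounds relative to the cube root of `(27/4) Z n²`.

module Asymptotics where
  open import Data.Nat as ℕ using (ℕ; zero; suc)
  import Data.Nat.Properties as ℕₚ
  import Data.Integer as ℤ
  open import Data.Rational as ℚ using (ℚ; 0ℚ; 1ℚ; ½; _+_; _*_; _-_; -_; _≤_; _<_; _/_; positive)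
  open import Data.Rational.Properties
  open import Data.Rational.Solver using (module +-*-Solver)
  open import Algebra.Definitions.RawSemiring ℚ.+-*-rawSemiring using () renaming (_^_ to _^ℚ_)
  open import Data.Product using (∃-syntax; _×_; _,_; proj₁; proj₂)
  open import Data.Empty using (⊥-elim)
  open import Relation.Nullary using (yes; no)
  open import Relation.Binary.PropositionalEquality
  open import Defs using (*-mono-≤-nonNeg; *-pos; 1/suc_; logSeq; recip; module RootCauchy; ζ; ℝ; p≤∣p∣;
    /-*-/)
  open +-*-Solver using (solve; _:+_; _:*_; _:-_; :-_; _:=_; con)
  open Rational
  open Logarithm
  open Geometric
  open Upper
  open LowerBound

  cube-mono : ∀ {x y} → 0ℚ ≤ x → x ≤ y → cube x ≤ cube y
  cube-mono 0≤x x≤y = *-mono-≤-nonNeg 0≤x x≤y (0≤x ⊗ 0≤x) (*-mono-≤-nonNeg 0≤x x≤y 0≤x x≤y)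

  cube-cancel : ∀ {x y} → 0ℚ ≤ y → cube x ≤ cube y → x ≤ y
  cube-cancel {x} {y} 0≤y le with x ≤? y
  ... | yes x≤y = x≤y
  ... | no x≰y  = ⊥-elim (<-irrefl refl (<-≤-trans (≤-<-trans
      (*-monoˡ 0≤y (*-mono-≤-nonNeg 0≤y (<⇒≤ y<x) 0≤y (<⇒≤ y<x)))
      (*-monoˡ-<-pos (x * x) {{positive (*-pos 0<x 0<x)}} y<x)) le))
    where
    y<x = ≰⇒> x≰y
    0<x = ≤-<-trans 0≤y y<x

  cube-* : ∀ x y → cube (x * y) ≡ cube x * cube y
  cube-* = solve 2 (λ x y → (x :* y) :* ((x :* y) :* (x :* y)) := (x :* (x :* x)) :* (y :* (y :* y))) refl

  0≤cube : ∀ {x} → 0ℚ ≤ x → 0ℚ ≤ cube x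
  0≤cube 0≤x = 0≤x ⊗ (0≤x ⊗ 0≤x)

  x≤cube : ∀ {x} → 1ℚ ≤ x → x ≤ cube x
  x≤cube {x} 1≤x = ≤-trans (≤-reflexive (sym (*-identityʳ x)))
    (*-monoˡ (≤-trans (<⇒≤ 0<1) 1≤x) (≤-trans (≤-reflexive (sym (*-identityʳ 1ℚ)))
      (*-mono-≤-nonNeg (<⇒≤ 0<1) 1≤x (<⇒≤ 0<1) 1≤x)))

  27/4 = ℤ.+ 27 / 4

  -- v = ⌊(n / 2Z)^{1/3}⌋
  module _ {Z : ℚ} (1≤Z : 1ℚ ≤ Z) where
    private
      0≤2Z : 0ℚ ≤ 2ℚ * Z
      0≤2Z = nonNegative⁻¹ 2ℚ ⊗ ≤-trans (<⇒≤ 0<1) 1≤Z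

    level : ∀ n → ∃[ v ] (2ℚ * Z * cube (ι v) ≤ ι n × ι n < 2ℚ * Z * cube (ι (suc v)))
    level n = go (suc n) (<-≤-trans (ι-mono-< (ℕₚ.n<1+n n)) (≤-trans
        (x≤cube (≤-trans (≤-reflexive (sym ι-1)) (ι-mono (ℕ.s≤s ℕ.z≤n))))
        (≤-by ((1ℚ + 2ℚ * (Z - 1ℚ)) * cube (ι (suc n)))
          ((<⇒≤ 0<1 ⊕ nonNegative⁻¹ 2ℚ ⊗ ≤⇒0≤- 1≤Z) ⊗ 0≤cube (0≤ι (suc n)))
          (solve 2 (λ z t → t :+ (con 1ℚ :+ con 2ℚ :* (z :- con 1ℚ)) :* t := con 2ℚ :* z :* t) refl Z (cube (ι (suc n)))))))
      where
      go : ∀ B → ι n < 2ℚ * Z * cube (ι B) → ∃[ v ] (2ℚ * Z * cube (ι v) ≤ ι n × ι n < 2ℚ * Z * cube (ι (suc v)))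
      go zero    lt = ⊥-elim (<-irrefl refl (≤-<-trans (0≤ι n) (<-≤-trans lt (≤-reflexive
        (trans (cong (λ z → 2ℚ * Z * cube z) ι-0) (*-zeroʳ (2ℚ * Z)))))))
      go (suc B) lt with 2ℚ * Z * cube (ι B) ≤? ι n
      ... | yes le = B , le , lt
      ... | no nle = go B (≰⇒> nle)

    level-large : ∀ w → ∃[ N ] (∀ n → N ℕ.≤ n → w ℕ.≤ proj₁ (level n))
    level-large w = let (N , <N) = ≤ι (2ℚ * Z * cube (ι w)) in N , λ n N≤n → ℕₚ.≮⇒≥ λ v<w →
      <-irrefl refl (<-≤-trans (proj₂ (proj₂ (level n))) (≤-trans
        (*-monoˡ 0≤2Z (cube-mono (0≤ι (suc (proj₁ (level n)))) (ι-mono v<w)))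
        (≤-trans (<⇒≤ <N) (ι-mono N≤n))))

  exceed : ∀ {θ} → 0ℚ < θ → ∀ q → ∃[ w ] (∀ v → w ℕ.≤ v → q ≤ θ * ι v)
  exceed {θ} 0<θ q = let (r , 0<r , rθ) = recip θ 0<θ ; (w , <w) = ≤ι (q * r) in
    w , λ v w≤v → ≤-trans
      (≤-reflexive (sym (trans (solve 3 (λ θ q r → θ :* (q :* r) := q :* (r :* θ)) refl θ q r)
        (trans (cong (q *_) rθ) (*-identityʳ q)))))
      (*-monoˡ (<⇒≤ 0<θ) (≤-trans (<⇒≤ <w) (ι-mono w≤v)))

  module _ (p : ℕ → ℕ) (rec : Recurrence p) (1≤p : ∀ k → 1 ℕ.≤ p k) {θ : ℚ} (0<θ : 0ℚ < θ) where

    -- A rational `X`, known through its cube, stands in for the cube root. All lower-order terms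
    -- together are at most `V (17 Z + 181 + C)`, hence at most `θ X` once `V` is large.
    upper-eventually : ∀ {Z} → 1ℚ ≤ Z → (∀ M → zeta₃ M ≤ Z) → ∃[ N ] (∀ n → N ℕ.≤ n →
      ∃[ X ] (0ℚ ≤ X × cube X ≤ 27/4 * Z * (ι n * ι n) × ∃[ K ] (∀ k → K ℕ.≤ k → logSeq (p n) k ≤ (1ℚ + θ) * X)))
    upper-eventually {Z} 1≤Z zeta≤Z =
      let (C , 0≤C , h) = UpperBound.log-p-upper p rec Z zeta≤Z
          (w , w-large) = exceed 0<θ (17ℚ * Z + 181ℚ + C)
          (N , N-large) = level-large 1≤Z (suc w)
      in N , λ n N≤n →
        let (v , lo , hi) = level 1≤Z n in
        conclude C 0≤C h n v lo hi (ℕₚ.≤-trans (ℕ.s≤s ℕ.z≤n) (N-large n N≤n))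
          (w-large v (ℕₚ.≤-trans (ℕₚ.n≤1+n w) (N-large n N≤n)))
      where
      17ℚ = ℤ.+ 17 / 1
      8ℚ = ℤ.+ 8 / 1
      180ℚ = ℤ.+ 180 / 1
      181ℚ = ℤ.+ 181 / 1
      4ℚ = ℤ.+ 4 / 1
      0≤Z = ≤-trans (<⇒≤ 0<1) 1≤Z
      conclude : ∀ C → 0ℚ ≤ C →
        (∀ m k → 1 ℕ.≤ p k → logSeq (p k) ≲
          (λ _ → C + Z * (ι (suc m) * (1ℚ + ι (suc m))) + (2ℚ * Z + 180ℚ) * ι (suc m) + ι k * (1/suc m))) →
        ∀ n v → 2ℚ * Z * cube (ι v) ≤ ι n → ι n < 2ℚ * Z * cube (ι (suc v)) → 1 ℕ.≤ v →
        17ℚ * Z + 181ℚ + C ≤ θ * ι v →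
        ∃[ X ] (0ℚ ≤ X × cube X ≤ 27/4 * Z * (ι n * ι n) × ∃[ K ] (∀ k → K ℕ.≤ k → logSeq (p n) k ≤ (1ℚ + θ) * X))
      conclude C 0≤C h n (suc m) lo hi _ large =
        X , 0≤X , cube-X , proj₁ ev , λ k K≤k → ≤-trans (proj₂ ev k K≤k) value
        where
        V = ι (suc m)
        i = 1/suc m
        0≤V = 0≤ι (suc m)
        1≤V : 1ℚ ≤ V
        1≤V = ≤-trans (≤-reflexive (sym ι-1)) (ι-mono (ℕ.s≤s ℕ.z≤n))
        X = 3ℚ * Z * (V * V)
        0≤X : 0ℚ ≤ X
        0≤X = nonNegative⁻¹ 3ℚ ⊗ 0≤Z ⊗ (0≤V ⊗ 0≤V)
        -- An error of `1` in the comparison of limits is one more lower-order term.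
        ev = within (h m n (1≤p n)) 1ℚ 0<1
        t = 2ℚ * Z * cube V
        0≤t : 0ℚ ≤ t
        0≤t = nonNegative⁻¹ 2ℚ ⊗ 0≤Z ⊗ 0≤cube 0≤V
        cube-X : cube X ≤ 27/4 * Z * (ι n * ι n)
        cube-X = ≤-trans
          (≤-reflexive (solve 2 (λ Z V → let X = con 3ℚ :* Z :* (V :* V) ; t = con 2ℚ :* Z :* (V :* (V :* V)) in
            X :* (X :* X) := con 27/4 :* Z :* (t :* t)) refl Z V))
          (*-monoˡ (nonNegative⁻¹ 27/4 ⊗ 0≤Z) (*-mono-≤-nonNeg 0≤t lo 0≤t lo))
        ni≤ : ι n * i ≤ 2ℚ * Z * (V * V + 3ℚ * V + 4ℚ)
        ni≤ = ≤-trans (*-monoʳ (0≤1/suc m) (<⇒≤ hi)) (≤-trans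
          (≤-reflexive (trans (cong (λ S → 2ℚ * Z * cube S * i) (ι-suc (suc m)))
            (trans (solve 3 (λ Z V i → let S = con 1ℚ :+ V in con 2ℚ :* Z :* (S :* (S :* S)) :* i
                := con 2ℚ :* Z :* ((V :* i) :* (V :* V) :+ con 3ℚ :* ((V :* i) :* V) :+ con 3ℚ :* (V :* i) :+ i)) refl Z V i)
              (cong (λ u → 2ℚ * Z * (u * (V * V) + 3ℚ * (u * V) + 3ℚ * u + i)) (ι*1/suc m)))))
          (*-monoˡ (nonNegative⁻¹ 2ℚ ⊗ 0≤Z) (≤-by (1ℚ - i) (≤⇒0≤- (1/suc≤1 m))
            (solve 2 (λ V i → (con 1ℚ :* (V :* V) :+ con 3ℚ :* (con 1ℚ :* V) :+ con 3ℚ :* con 1ℚ :+ i) :+ (con 1ℚ :- i)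
              := V :* V :+ con 3ℚ :* V :+ con 4ℚ) refl V i))))
        value : C + Z * (V * (1ℚ + V)) + (2ℚ * Z + 180ℚ) * V + ι n * i + 1ℚ ≤ (1ℚ + θ) * X
        value = ≤-trans (+-monoˡ-≤ 1ℚ (+-monoʳ-≤ (C + Z * (V * (1ℚ + V)) + (2ℚ * Z + 180ℚ) * V) ni≤))
          (≤-trans (≤-by ((V - 1ℚ) * (8ℚ * Z + 1ℚ + C))
              (≤⇒0≤- 1≤V ⊗ (nonNegative⁻¹ 8ℚ ⊗ 0≤Z ⊕ <⇒≤ 0<1 ⊕ 0≤C))
              (solve 3 (λ Z V C → (C :+ Z :* (V :* (con 1ℚ :+ V)) :+ (con 2ℚ :* Z :+ con 180ℚ) :* V
                  :+ con 2ℚ :* Z :* (V :* V :+ con 3ℚ :* V :+ con 4ℚ) :+ con 1ℚ)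
                :+ (V :- con 1ℚ) :* (con 8ℚ :* Z :+ con 1ℚ :+ C)
                := con 3ℚ :* Z :* (V :* V) :+ V :* (con 17ℚ :* Z :+ con 181ℚ :+ C)) refl Z V C))
            (≤-trans (+-monoʳ-≤ X (*-monoˡ 0≤V large))
              (≤-by (θ * ((2ℚ * Z + (Z - 1ℚ)) * (V * V)))
                (<⇒≤ 0<θ ⊗ ((nonNegative⁻¹ 2ℚ ⊗ 0≤Z ⊕ ≤⇒0≤- 1≤Z) ⊗ (0≤V ⊗ 0≤V)))
                (solve 3 (λ Z V θ → let X = con 3ℚ :* Z :* (V :* V) in
                  X :+ V :* (θ :* V) :+ θ :* ((con 2ℚ :* Z :+ (Z :- con 1ℚ)) :* (V :* V))
                  := (con 1ℚ :+ θ) :* X) refl Z V θ))))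

    lower-eventually : ∀ K′ → let Z = zeta₃ (suc K′) in 1ℚ ≤ Z → ∃[ N ] (∀ n → N ℕ.≤ n →
      ∃[ Y ] (0ℚ ≤ Y × 27/4 * Z * (ι n * ι n) ≤ cube Y × ∃[ K ] (∀ k → K ℕ.≤ k → (1ℚ - θ) * Y ≤ logSeq (p n) k)))
    lower-eventually K′ 1≤Z =
      let (C , 0≤C , h) = log-p-lower p rec 1≤p K′
          (w , w-large) = exceed 0<θ (7ℚ + C)
          (N , N-large) = level-large 1≤Z (16 ℕ.* suc K′ ℕ.+ w)
      in N , λ n N≤n →
        let (v , lo , hi) = level 1≤Z n
            v-large = N-large n N≤n
        in conclude C 0≤C n v hi
             (h v (ℕₚ.≤-trans (ℕₚ.m≤m+n (16 ℕ.* suc K′) w) v-large) n lo hi)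
             (w-large v (ℕₚ.≤-trans (ℕₚ.m≤n+m w (16 ℕ.* suc K′)) v-large))
      where
      7ℚ = ℤ.+ 7 / 1
      15ℚ = ℤ.+ 15 / 1
      Z = zeta₃ (suc K′)
      0≤Z = ≤-trans (<⇒≤ 0<1) 1≤Z
      conclude : ∀ C → 0ℚ ≤ C → ∀ n v → ι n < 2ℚ * Z * cube (ι (suc v)) →
        (λ _ → 3ℚ * Z * (ι v * ι v) - C * (1ℚ + ι v)) ≲ logSeq (p n) → 7ℚ + C ≤ θ * ι v →
        ∃[ Y ] (0ℚ ≤ Y × 27/4 * Z * (ι n * ι n) ≤ cube Y × ∃[ K ] (∀ k → K ℕ.≤ k → (1ℚ - θ) * Y ≤ logSeq (p n) k))
      conclude C 0≤C n v hi h large = Y , 0≤Y , ≤-cube-Y , proj₁ ev , λ k K≤k →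
        ≤-trans value (≤-trans (+-monoˡ-≤ (- 1ℚ) (proj₂ ev k K≤k))
          (≤-reflexive (solve 1 (λ s → (s :+ con 1ℚ) :- con 1ℚ := s) refl (logSeq (p n) k))))
        where
        V = ι v
        S = 1ℚ + V
        0≤V = 0≤ι v
        0≤S = <⇒≤ 0<1 ⊕ 0≤V
        -- `n` lies below the level of `S = 1 + V`, and replacing `V` by `S` changes `3 Z V²` only
        -- by O(V).
        Y = 3ℚ * Z * (S * S)
        0≤Y : 0ℚ ≤ Y
        0≤Y = nonNegative⁻¹ 3ℚ ⊗ 0≤Z ⊗ (0≤S ⊗ 0≤S)
        ev = within h 1ℚ 0<1
        ≤-cube-Y : 27/4 * Z * (ι n * ι n) ≤ cube Y
        ≤-cube-Y = ≤-trans
          (*-monoˡ (nonNegative⁻¹ 27/4 ⊗ 0≤Z) (*-mono-≤-nonNeg (0≤ι n) hi′ (0≤ι n) hi′))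
          (≤-reflexive (solve 2 (λ Z S → let Y = con 3ℚ :* Z :* (S :* S) ; t = con 2ℚ :* Z :* (S :* (S :* S)) in
            con 27/4 :* Z :* (t :* t) := Y :* (Y :* Y)) refl Z S))
          where
          hi′ : ι n ≤ 2ℚ * Z * cube S
          hi′ = subst (λ s → ι n ≤ 2ℚ * Z * cube s) (ι-suc v) (<⇒≤ hi)
        value : (1ℚ - θ) * Y ≤ 3ℚ * Z * (V * V) - C * S - 1ℚ
        value = ≤-by
          (3ℚ * Z * S * (θ * V - (7ℚ + C)) + 3ℚ * Z * S * θ + 15ℚ * Z * S + (2ℚ * Z + (Z - 1ℚ)) * (1ℚ + C * S))
          (0≤3ZS ⊗ ≤⇒0≤- large ⊕ 0≤3ZS ⊗ <⇒≤ 0<θ ⊕ nonNegative⁻¹ 15ℚ ⊗ 0≤Z ⊗ 0≤S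
            ⊕ (nonNegative⁻¹ 2ℚ ⊗ 0≤Z ⊕ ≤⇒0≤- 1≤Z) ⊗ (<⇒≤ 0<1 ⊕ 0≤C ⊗ 0≤S))
          (solve 4 (λ Z V C θ → let S = con 1ℚ :+ V in
            (con 1ℚ :- θ) :* (con 3ℚ :* Z :* (S :* S))
              :+ (con 3ℚ :* Z :* S :* (θ :* V :- (con 7ℚ :+ C)) :+ con 3ℚ :* Z :* S :* θ :+ con 15ℚ :* Z :* S
                :+ (con 2ℚ :* Z :+ (Z :- con 1ℚ)) :* (con 1ℚ :+ C :* S))
            := con 3ℚ :* Z :* (V :* V) :- C :* S :- con 1ℚ) refl Z V C θ)
          where
          0≤3ZS = nonNegative⁻¹ 3ℚ ⊗ 0≤Z ⊗ 0≤S

  module Root {a r : ℚ} {k : ℕ} (1≤a : 1ℚ ≤ a) (A : RootCauchy.Approx 2 a k r) where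
    open RootCauchy.Approx A renaming (nonNeg to 0≤r)

    private
      ^3 : ∀ x → x ^ℚ 3 ≡ cube x
      ^3 x = cong (λ y → x * (x * y)) (*-identityʳ x)

    -- The rounded root has its power bounded by `a` only when it is positive; otherwise `1 ≤ a`
    -- takes over.
    cube-r≤ : cube r ≤ a
    cube-r≤ with r ≤? 0ℚ
    ... | yes r≤0 = ≤-trans (cube-mono 0≤r r≤0) (≤-trans (<⇒≤ 0<1) 1≤a)
    ... | no r≰0  = ≤-trans (≤-reflexive (sym (^3 r))) (lower (≰⇒> r≰0))

    a≤cube : a ≤ cube (r + 1/suc k)
    a≤cube = ≤-trans (<⇒≤ upper) (≤-reflexive (^3 (r + 1/suc k)))

    1≤r+τ : 1ℚ ≤ r + 1/suc k
    1≤r+τ = cube-cancel (0≤r ⊕ 0≤1/suc k) (≤-trans 1≤a a≤cube)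

  ½≤root : ∀ {r τ} → 1ℚ ≤ r + τ → τ ≤ ½ → ½ ≤ r
  ½≤root {r} {τ} 1≤ τ≤½ = ≤-by (((r + τ) - 1ℚ) + (½ - τ)) (≤⇒0≤- 1≤ ⊕ ≤⇒0≤- τ≤½)
    (solve 2 (λ r τ → con ½ :+ (((r :+ τ) :- con 1ℚ) :+ (con ½ :- τ)) := r) refl r τ)

  -- r + τ ≤ (1 + 2τ) r for r ≥ ½, and (1 + 2τ)² ≤ 1 + 8τ.
  root-product : ∀ {r₁ r₂ τ θ} → ½ ≤ r₁ → ½ ≤ r₂ → 0ℚ ≤ τ → τ ≤ ½ → (ℤ.+ 8 / 1) * τ ≤ θ →
    (r₁ + τ) * (r₂ + τ) ≤ (1ℚ + θ) * (r₁ * r₂)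
  root-product {r₁} {r₂} {τ} {θ} ½≤r₁ ½≤r₂ 0≤τ τ≤½ 8τ≤θ = ≤-trans
    (*-mono-≤-nonNeg (0≤r₁ ⊕ 0≤τ) (stretch ½≤r₁) (0≤r₂ ⊕ 0≤τ) (stretch ½≤r₂))
    (≤-trans (≤-by ((4ℚ * τ * (½ - τ) + 2ℚ * τ + (θ - 8ℚ * τ)) * (r₁ * r₂))
        ((nonNegative⁻¹ 4ℚ ⊗ 0≤τ ⊗ ≤⇒0≤- τ≤½ ⊕ nonNegative⁻¹ 2ℚ ⊗ 0≤τ ⊕ ≤⇒0≤- 8τ≤θ) ⊗ (0≤r₁ ⊗ 0≤r₂))
        (solve 4 (λ r s τ θ → (con 1ℚ :+ con 2ℚ :* τ) :* r :* ((con 1ℚ :+ con 2ℚ :* τ) :* s)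
            :+ (con 4ℚ :* τ :* (con ½ :- τ) :+ con 2ℚ :* τ :+ (θ :- con 8ℚ :* τ)) :* (r :* s)
          := (con 1ℚ :+ θ) :* (r :* s)) refl r₁ r₂ τ θ))
      ≤-refl)
    where
    4ℚ = ℤ.+ 4 / 1
    8ℚ = ℤ.+ 8 / 1
    0≤r₁ = ≤-trans (nonNegative⁻¹ ½) ½≤r₁
    0≤r₂ = ≤-trans (nonNegative⁻¹ ½) ½≤r₂
    stretch : ∀ {r} → ½ ≤ r → r + τ ≤ (1ℚ + 2ℚ * τ) * r
    stretch {r} ½≤r = ≤-by (2ℚ * τ * (r - ½)) (nonNegative⁻¹ 2ℚ ⊗ 0≤τ ⊗ ≤⇒0≤- ½≤r)
      (solve 2 (λ r τ → (r :+ τ) :+ con 2ℚ :* τ :* (r :- con ½) := (con 1ℚ :+ con 2ℚ :* τ) :* r) refl r τ)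

  -- The factor `1 + θ` between `Z` and `z` stands under a cube root; enlarging it to `(1 + θ)³`
  -- lets it be extracted.
  upper-compare : ∀ {θ a Z z m h X} → 0ℚ ≤ θ → 0ℚ ≤ h → 0ℚ ≤ m → 0ℚ ≤ z → cube X ≤ 27/4 * Z * m →
    Z ≤ (1ℚ + θ) * z → a ≡ 27/4 * z * m → a ≤ cube ((1ℚ + θ) * h) → X ≤ (1ℚ + θ) * ((1ℚ + θ) * h)
  upper-compare {θ} {a} {Z} {z} {m} {h} {X} 0≤θ 0≤h 0≤m 0≤z cX Z≤ a≡ a≤ = cube-cancel (0≤1+θ ⊗ (0≤1+θ ⊗ 0≤h))
    (≤-trans cX (≤-trans (*-monoʳ 0≤m (*-monoˡ (nonNegative⁻¹ 27/4) Z≤))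
      (≤-trans (≤-reflexive (trans (solve 4 (λ q t z m → q :* (t :* z) :* m := t :* (q :* z :* m)) refl 27/4 (1ℚ + θ) z m)
          (cong ((1ℚ + θ) *_) (sym a≡))))
        (≤-trans (*-mono-≤-nonNeg 0≤1+θ (x≤cube 1≤1+θ) 0≤a a≤)
          (≤-reflexive (sym (cube-* (1ℚ + θ) ((1ℚ + θ) * h))))))))
    where
    0≤1+θ = <⇒≤ 0<1 ⊕ 0≤θ
    1≤1+θ : 1ℚ ≤ 1ℚ + θ
    1≤1+θ = ≤-by θ 0≤θ refl
    0≤a : 0ℚ ≤ a
    0≤a = subst (0ℚ ≤_) (sym a≡) (nonNegative⁻¹ 27/4 ⊗ 0≤z ⊗ 0≤m)

  lower-compare : ∀ {θ a Z z m h Y} → 0ℚ ≤ θ → 0ℚ ≤ Y → 0ℚ ≤ m → 27/4 * Z * m ≤ cube Y →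
    z ≤ (1ℚ + θ) * Z → a ≡ 27/4 * z * m → cube h ≤ a → h ≤ (1ℚ + θ) * Y
  lower-compare {θ} {a} {Z} {z} {m} {h} {Y} 0≤θ 0≤Y 0≤m cY z≤ a≡ ≤a = cube-cancel (0≤1+θ ⊗ 0≤Y)
    (≤-trans ≤a (≤-trans (≤-reflexive a≡) (≤-trans (*-monoʳ 0≤m (*-monoˡ (nonNegative⁻¹ 27/4) z≤))
      (≤-trans (≤-reflexive (solve 4 (λ q t z m → q :* (t :* z) :* m := t :* (q :* z :* m)) refl 27/4 (1ℚ + θ) Z m))
        (≤-trans (*-monoˡ 0≤1+θ cY) (≤-trans (*-monoʳ (0≤cube 0≤Y) (x≤cube 1≤1+θ))
          (≤-reflexive (sym (cube-* (1ℚ + θ) Y)))))))))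
    where
    0≤1+θ = <⇒≤ 0<1 ⊕ 0≤θ
    1≤1+θ : 1ℚ ≤ 1ℚ + θ
    1≤1+θ = ≤-by θ 0≤θ refl

  -- Three factors `1 + θ` accumulate, and `(1 + θ)³ ≤ 1 + 7 θ` for `θ ≤ 1`.
  upper-ratio : ∀ {θ η g h X} → 0ℚ ≤ θ → θ ≤ 1ℚ → (ℤ.+ 7 / 1) * θ ≤ η → 0ℚ ≤ h →
    g ≤ (1ℚ + θ) * X → X ≤ (1ℚ + θ) * ((1ℚ + θ) * h) → g ≤ (1ℚ + η) * h
  upper-ratio {θ} {η} {g} {h} 0≤θ θ≤1 7θ≤η 0≤h g≤ X≤ = ≤-trans g≤ (≤-trans (*-monoˡ (<⇒≤ 0<1 ⊕ 0≤θ) X≤)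
    (≤-by (((η - 7ℚ * θ) + θ * (1ℚ - θ) * (4ℚ + θ)) * h)
      ((≤⇒0≤- 7θ≤η ⊕ 0≤θ ⊗ ≤⇒0≤- θ≤1 ⊗ (nonNegative⁻¹ 4ℚ ⊕ 0≤θ)) ⊗ 0≤h)
      (solve 3 (λ θ η h → let T = con 1ℚ :+ θ in T :* (T :* (T :* h))
          :+ ((η :- con 7ℚ :* θ) :+ θ :* (con 1ℚ :- θ) :* (con 4ℚ :+ θ)) :* h := (con 1ℚ :+ η) :* h) refl θ η h)))
    where
    7ℚ = ℤ.+ 7 / 1
    4ℚ = ℤ.+ 4 / 1

  -- `1 - 7 θ ≤ (1 - θ)²` and `(1 - θ)² (1 + θ) ≤ 1 - θ`.
  lower-ratio : ∀ {θ η g h Y} → 0ℚ ≤ θ → θ ≤ 1ℚ → (ℤ.+ 7 / 1) * θ ≤ η → 0ℚ ≤ h → 0ℚ ≤ Y →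
    (1ℚ - θ) * Y ≤ g → h ≤ (1ℚ + θ) * Y → (1ℚ - η) * h ≤ g
  lower-ratio {θ} {η} {g} {h} {Y} 0≤θ θ≤1 7θ≤η 0≤h 0≤Y ≤g h≤ = ≤-trans
    (≤-trans (≤-by (((η - 7ℚ * θ) + 5ℚ * θ + θ * θ) * h)
        ((≤⇒0≤- 7θ≤η ⊕ nonNegative⁻¹ 5ℚ ⊗ 0≤θ ⊕ 0≤θ ⊗ 0≤θ) ⊗ 0≤h)
        (solve 3 (λ θ η h → (con 1ℚ :- η) :* h :+ ((η :- con 7ℚ :* θ) :+ con 5ℚ :* θ :+ θ :* θ) :* h
          := (con 1ℚ :- θ) :* (con 1ℚ :- θ) :* h) refl θ η h))
      (≤-trans (*-monoˡ (≤⇒0≤- θ≤1 ⊗ ≤⇒0≤- θ≤1) h≤)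
        (≤-by ((1ℚ - θ) * (θ * θ) * Y) (≤⇒0≤- θ≤1 ⊗ (0≤θ ⊗ 0≤θ) ⊗ 0≤Y)
          (solve 2 (λ θ Y → (con 1ℚ :- θ) :* (con 1ℚ :- θ) :* ((con 1ℚ :+ θ) :* Y) :+ (con 1ℚ :- θ) :* (θ :* θ) :* Y
            := (con 1ℚ :- θ) :* Y) refl θ Y))))
    ≤g
    where
    7ℚ = ℤ.+ 7 / 1
    5ℚ = ℤ.+ 5 / 1

  zeta₃≡ζ : ∀ m → zeta₃ (suc m) ≡ ℝ.seq (ζ 3) m
  zeta₃≡ζ m = ∑ℚ-cong< (suc m) (λ k _ → trans
    (cong ((1/suc k) *_) (/-*-/ 1 (suc k) 1 (suc k) 1 (suc k ℕ.* suc k) refl))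
    (/-*-/ 1 (suc k) 1 (suc k ℕ.* suc k) 1 (suc k ℕ.^ 3) {{_}} {{_}} {{ℕₚ.m^n≢0 (suc k) 3}}
      (trans (ℕₚ.*-identityˡ (suc k ℕ.^ 3)) (trans
        (cong (λ t → suc k ℕ.* (suc k ℕ.* t)) (ℕₚ.*-identityʳ (suc k)))
        (sym (ℕₚ.*-identityˡ _))))))

  1≤zeta₃ : ∀ K → 1ℚ ≤ zeta₃ (suc K)
  1≤zeta₃ K = ∑ℚ-range 1 (suc K) (ℕ.s≤s ℕ.z≤n) (λ k → 0≤cube (0≤1/suc k))

  zeta₃-mono : ∀ {m n} → m ℕ.≤ n → zeta₃ m ≤ zeta₃ n
  zeta₃-mono {m} {n} m≤n = ∑ℚ-range m n m≤n (λ k → 0≤cube (0≤1/suc k))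

  zeta₃-tail : ∀ {θ} → 0ℚ < θ → ∃[ K ] (∀ M → zeta₃ M ≤ zeta₃ (suc K) + θ)
  zeta₃-tail {θ} 0<θ = let (K , h) = ℝ.cauchy (ζ 3) θ 0<θ in K , λ M →
    ≤-trans (zeta₃-mono (ℕₚ.m≤n⇒m≤1+n (ℕₚ.m≤n+m M K)))
      (≤-by _ (≤⇒0≤- (≤-trans (p≤∣p∣ _) (<⇒≤ (subst₂ (λ x y → ℚ.∣ x - y ∣ < θ)
          (sym (zeta₃≡ζ (K ℕ.+ M))) (sym (zeta₃≡ζ K)) (h (K ℕ.+ M) K (ℕₚ.m≤m+n K M) ℕₚ.≤-refl)))))
        (solve 3 (λ x y t → x :+ (t :- (x :- y)) := y :+ t) refl (zeta₃ (suc (K ℕ.+ M))) (zeta₃ (suc K)) θ))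

module P9b where

-- Convergence of the ratio to one.

module Main where
  open import Data.Nat as ℕ using (ℕ; suc)
  import Data.Nat.Properties as ℕₚ
  import Data.Integer as ℤ
  open import Data.Rational as ℚ using (ℚ; 0ℚ; 1ℚ; ½; _+_; _*_; _-_; -_; _≤_; _<_; _/_)
  open import Data.Rational.Properties
  open import Data.Rational.Solver using (module +-*-Solver)
  open import Data.Product using (∃-syntax; _×_; _,_)
  open import Relation.Binary.PropositionalEquality
  open import Defs using (*-mono-≤-nonNeg; *-pos; 1/suc_; 1/suc-pos; 1/suc-antitone; archimedean; halves;
    half-pos; logSeq; module RootCauchy; rootApprox; inv; inv-inverse; ∣-∣-≤; p≤∣p∣; ℝ; log; ζ; Apart0;
    _^[_∕_]; _∼_)
  import Defs
  open +-*-Solver using (solve; _:+_; _:*_; _:-_; :-_; _:=_; con)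
  open ℝ using (seq)
  open Rational
  open Geometric
  open Upper using (Recurrence)
  open Asymptotics

  -- Half of `ε` bounds the deviation; the other half is the fixed gap that `<` on reals demands.
  ratio-close : ∀ {ε g h} → 0ℚ < h → g ≤ (1ℚ + ½ * ε) * h → (1ℚ - ½ * ε) * h ≤ g →
    ℚ.∣ g * inv h - 1ℚ ∣ + ½ * ε ≤ ε
  ratio-close {ε} {g} {h} 0<h g≤ ≤g = ≤-trans (+-monoˡ-≤ (½ * ε) (∣-∣-≤ {g * inv h - 1ℚ} {½ * ε}
      (≤-by (1ℚ + ½ * ε - g * i) (≤⇒0≤- (≤-trans (*-monoʳ 0≤i g≤) (≤-reflexive (unit (1ℚ + ½ * ε)))))
        (solve 2 (λ q e → (q :- con 1ℚ) :+ (con 1ℚ :+ e :- q) := e) refl (g * i) (½ * ε)))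
      (≤-by (g * i - (1ℚ - ½ * ε)) (≤⇒0≤- (≤-trans (≤-reflexive (sym (unit (1ℚ - ½ * ε)))) (*-monoʳ 0≤i ≤g)))
        (solve 2 (λ q e → :- (q :- con 1ℚ) :+ (q :- (con 1ℚ :- e)) := e) refl (g * i) (½ * ε)))))
    (≤-reflexive (halves ε))
    where
    i = inv h
    ih : i * h ≡ 1ℚ
    ih = inv-inverse 0<h (p≤∣p∣ h)
    0≤i : 0ℚ ≤ i
    0≤i = *-cancelʳ 0<h (subst₂ _≤_ (sym (*-zeroˡ h)) (sym ih) (<⇒≤ 0<1))
    unit : ∀ c → c * h * i ≡ c
    unit c = trans (*-assoc c h i) (trans (cong (c *_) (trans (*-comm h i) ih)) (*-identityʳ c))

  product-bounds : ∀ {a₁ a₂ r₁ r₂ θ} k → RootCauchy.Approx 2 a₁ k r₁ → RootCauchy.Approx 2 a₂ k r₂ →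
    1ℚ ≤ a₁ → 1ℚ ≤ a₂ → 1/suc k ≤ ½ → (ℤ.+ 8 / 1) * (1/suc k) ≤ θ →
    ½ * ½ ≤ r₁ * r₂ × cube (r₁ * r₂) ≤ a₁ * a₂ × a₁ * a₂ ≤ cube ((1ℚ + θ) * (r₁ * r₂))
  product-bounds {a₁} {a₂} {r₁} {r₂} k A₁ A₂ 1≤a₁ 1≤a₂ τ≤½ 8τ≤θ =
      *-mono-≤-nonNeg (nonNegative⁻¹ ½) ½≤r₁ (nonNegative⁻¹ ½) ½≤r₂
    , ≤-trans (≤-reflexive (cube-* r₁ r₂)) (*-mono-≤-nonNeg (0≤cube 0≤r₁) R₁.cube-r≤ (0≤cube 0≤r₂) R₂.cube-r≤)
    , ≤-trans (*-mono-≤-nonNeg (≤-trans (<⇒≤ 0<1) 1≤a₁) R₁.a≤cube (≤-trans (<⇒≤ 0<1) 1≤a₂) R₂.a≤cube)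
        (≤-trans (≤-reflexive (sym (cube-* (r₁ + 1/suc k) (r₂ + 1/suc k))))
          (cube-mono ((0≤r₁ ⊕ 0≤1/suc k) ⊗ (0≤r₂ ⊕ 0≤1/suc k))
            (root-product {r₁} {r₂} ½≤r₁ ½≤r₂ (0≤1/suc k) τ≤½ 8τ≤θ)))
    where
    module R₁ = Root 1≤a₁ A₁
    module R₂ = Root 1≤a₂ A₂
    0≤r₁ = RootCauchy.Approx.nonNeg A₁
    0≤r₂ = RootCauchy.Approx.nonNeg A₂
    ½≤r₁ = ½≤root {r₁} {1/suc k} R₁.1≤r+τ τ≤½
    ½≤r₂ = ½≤root {r₂} {1/suc k} R₂.1≤r+τ τ≤½

  log-seq : ∀ n .{{_ : ℕ.NonZero n}} k → seq (log n) k ≡ logSeq n k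
  log-seq (suc n) k = refl

  opaque
    cubeRoot : ℚ → ℕ → ℚ
    cubeRoot a k = rootApprox 3 a k

    cubeRoot-approx : ∀ a k → RootCauchy.Approx 2 a k (cubeRoot a k)
    cubeRoot-approx a k = RootCauchy.approx 2 a k

    ^-seq : ∀ x p k {a} → seq (x Defs.^ p) k ≡ a → seq (x ^[ p ∕ 3 ]) k ≡ cubeRoot a k
    ^-seq x p k refl = refl

  *-seq : ∀ x y k {a b} → seq x k ≡ a → seq y k ≡ b → seq (x Defs.* y) k ≡ a * b
  *-seq x y k refl refl = refl

  ^1-seq : ∀ x k {a} → seq x k ≡ a → seq (x Defs.^ 1) k ≡ a * 1ℚ
  ^1-seq x k refl = refl

  ^2-seq : ∀ x k {a} → seq x k ≡ a → seq (x Defs.^ 2) k ≡ a * (a * 1ℚ)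
  ^2-seq x k refl = refl

  -- h³ is within a factor (1 + θ)³ of (27/4) ζ(3) n², with ζ(3) truncated after k + 1 terms.
  record Height (θ : ℚ) (n k : ℕ) (h : ℚ) : Set where
    field
      ¼≤h    : ½ * ½ ≤ h
      cube-h : cube h ≤ 27/4 * zeta₃ (suc k) * (ι n * ι n)
      ≤cube  : 27/4 * zeta₃ (suc k) * (ι n * ι n) ≤ cube ((1ℚ + θ) * h)

  -- The condition on `k` keeps the rounding of the two roots within a factor `1 + θ` of their
  -- product.
  Heights : (ℕ → ℝ) → Set
  Heights h = ∀ n → 1 ℕ.≤ n → ∀ {θ} → θ ≤ 1ℚ → ∀ k → (ℤ.+ 8 / 1) * (1/suc k) ≤ θ → Height θ n k (seq (h n) k)

  product-height : ∀ {r₁ r₂ θ n k} → 1 ℕ.≤ n → θ ≤ 1ℚ → (ℤ.+ 8 / 1) * (1/suc k) ≤ θ →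
    RootCauchy.Approx 2 (27/4 * zeta₃ (suc k) * 1ℚ) k r₁ → RootCauchy.Approx 2 (ι n * (ι n * 1ℚ)) k r₂ →
    Height θ n k (r₁ * r₂)
  product-height {θ = θ} {n = n} {k} 1≤n θ≤1 8τ≤θ A₁ A₂ =
    let (a , b , c) = product-bounds k A₁ A₂ 1≤a₁ 1≤a₂ τ≤½ 8τ≤θ in record
    { ¼≤h    = a
    ; cube-h = ≤-trans b (≤-reflexive a≡)
    ; ≤cube  = ≤-trans (≤-reflexive (sym a≡)) c }
    where
    z = zeta₃ (suc k)
    q = ι n
    1≤q : 1ℚ ≤ q
    1≤q = subst (_≤ q) ι-1 (ι-mono 1≤n)
    1≤* : ∀ {x y} → 1ℚ ≤ x → 1ℚ ≤ y → 1ℚ ≤ x * y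
    1≤* 1≤x 1≤y = ≤-trans (≤-reflexive (sym (*-identityˡ 1ℚ))) (*-mono-≤-nonNeg (<⇒≤ 0<1) 1≤x (<⇒≤ 0<1) 1≤y)
    1≤a₁ : 1ℚ ≤ 27/4 * z * 1ℚ
    1≤a₁ = 1≤* (1≤* (≤-by (ℤ.+ 23 / 4) (nonNegative⁻¹ (ℤ.+ 23 / 4)) refl) (1≤zeta₃ k)) ≤-refl
    1≤a₂ : 1ℚ ≤ q * (q * 1ℚ)
    1≤a₂ = 1≤* 1≤q (1≤* 1≤q ≤-refl)
    a≡ : 27/4 * z * 1ℚ * (q * (q * 1ℚ)) ≡ 27/4 * z * (q * q)
    a≡ = cong₂ _*_ (*-identityʳ (27/4 * z)) (cong (q *_) (*-identityʳ q))
    τ≤½ : 1/suc k ≤ ½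
    τ≤½ = ≤-by ((ℤ.+ 1 / 8) * (θ - (ℤ.+ 8 / 1) * (1/suc k)) + (ℤ.+ 1 / 8) * (1ℚ - θ) + (ℤ.+ 3 / 8))
      (nonNegative⁻¹ (ℤ.+ 1 / 8) ⊗ ≤⇒0≤- 8τ≤θ ⊕ nonNegative⁻¹ (ℤ.+ 1 / 8) ⊗ ≤⇒0≤- θ≤1 ⊕ nonNegative⁻¹ (ℤ.+ 3 / 8))
      (solve 2 (λ τ θ → τ :+ (con (ℤ.+ 1 / 8) :* (θ :- con (ℤ.+ 8 / 1) :* τ) :+ con (ℤ.+ 1 / 8) :* (con 1ℚ :- θ) :+ con (ℤ.+ 3 / 8))
        := con ½) refl (1/suc k) θ)

  height-at : ∀ (x y : ℝ) {n} → 1 ℕ.≤ n → ∀ {θ} → θ ≤ 1ℚ → ∀ k → (ℤ.+ 8 / 1) * (1/suc k) ≤ θ →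
    seq x k ≡ 27/4 * zeta₃ (suc k) → seq y k ≡ ι n → Height θ n k (seq (x ^[ 1 ∕ 3 ] Defs.* y ^[ 2 ∕ 3 ]) k)
  height-at x y {n} 1≤n {θ} θ≤1 k 8τ≤θ x≡ y≡ = subst (Height θ n k)
    (sym (*-seq (x ^[ 1 ∕ 3 ]) (y ^[ 2 ∕ 3 ]) k
      (^-seq x 1 k (^1-seq x k x≡)) (^-seq y 2 k (^2-seq y k y≡))))
    (product-height 1≤n θ≤1 8τ≤θ
      (cubeRoot-approx (27/4 * zeta₃ (suc k) * 1ℚ) k) (cubeRoot-approx (ι n * (ι n * 1ℚ)) k))

  ∼-intro : ∀ (g h : ℕ → ℝ) →
    (∀ ε → 0ℚ < ε → ∃[ N ] (∀ n → N ℕ.≤ n → Apart0 (h n) × ∃[ K ] (∀ k → K ℕ.≤ k →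
      ℚ.∣ seq (g n) k * inv (seq (h n) k) - 1ℚ ∣ + ½ * ε ≤ ε))) → g ∼ h
  ∼-intro g h close ε 0<ε = let (N , c) = close ε 0<ε in
    N , λ n N≤n → let (h≉0 , bound) = c n N≤n in h≉0 , ½ * ε , half-pos 0<ε , bound

  module _ (p : ℕ → ℕ) (p-nonZero : ∀ n → ℕ.NonZero (p n)) (rec : Recurrence p)
           (h : ℕ → ℝ) (bounds : Heights h) where
    open Height
    private
      1≤p : ∀ n → 1 ℕ.≤ p n
      1≤p n = ℕ.>-nonZero⁻¹ (p n) {{p-nonZero n}}

      0<¼ : 0ℚ < ½ * ½
      0<¼ = positive⁻¹ (½ * ½)

    module _ {ε θ : ℚ} (0<θ : 0ℚ < θ) (θ≤1 : θ ≤ 1ℚ) (7θ≤ : (ℤ.+ 7 / 1) * θ ≤ ½ * ε)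
             (K : ℕ) (zeta₃≤ : ∀ M → zeta₃ M ≤ zeta₃ (suc K) + θ)
             (K₀ : ℕ) (small : ∀ {k} → K₀ ℕ.≤ k → (ℤ.+ 8 / 1) * (1/suc k) ≤ θ) where
      private
        0≤θ : 0ℚ ≤ θ
        0≤θ = <⇒≤ 0<θ

        Z⁻ Z⁺ : ℚ
        Z⁻ = zeta₃ (suc K)
        Z⁺ = Z⁻ + θ

        -- Partial sums are at least `1`, which turns the additive error `θ` into a factor.
        Z⁺≤ : ∀ {z} → Z⁻ ≤ z → Z⁺ ≤ (1ℚ + θ) * z
        Z⁺≤ {z} Z⁻≤z = ≤-by ((z - Z⁻) + θ * (z - 1ℚ))
          (≤⇒0≤- Z⁻≤z ⊕ 0≤θ ⊗ ≤⇒0≤- (≤-trans (1≤zeta₃ K) Z⁻≤z))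
          (solve 3 (λ Z θ z → (Z :+ θ) :+ ((z :- Z) :+ θ :* (z :- con 1ℚ)) := (con 1ℚ :+ θ) :* z) refl Z⁻ θ z)

      ratio-at : ∀ {n k X Y g t} → K ℕ.≤ k → Height θ n k t → 0ℚ ≤ Y →
        cube X ≤ 27/4 * Z⁺ * (ι n * ι n) → 27/4 * Z⁻ * (ι n * ι n) ≤ cube Y →
        g ≤ (1ℚ + θ) * X → (1ℚ - θ) * Y ≤ g → ℚ.∣ g * inv t - 1ℚ ∣ + ½ * ε ≤ ε
      ratio-at {n} {k} K≤k H 0≤Y cube-X cube-Y g≤ ≤g = ratio-close 0<h
        (upper-ratio 0≤θ θ≤1 7θ≤ (<⇒≤ 0<h) g≤
          (upper-compare {θ} {27/4 * z * (ι n * ι n)} {Z⁺} {z} 0≤θ (<⇒≤ 0<h) 0≤n² 0≤z cube-X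
            (Z⁺≤ (zeta₃-mono (ℕ.s≤s K≤k))) refl (≤cube H)))
        (lower-ratio 0≤θ θ≤1 7θ≤ (<⇒≤ 0<h) 0≤Y ≤g
          (lower-compare {θ} {27/4 * z * (ι n * ι n)} {Z⁻} {z} 0≤θ 0≤Y 0≤n² cube-Y
            (≤-trans (zeta₃≤ (suc k)) (Z⁺≤ ≤-refl)) refl (cube-h H)))
        where
        0<h = <-≤-trans 0<¼ (¼≤h H)
        z = zeta₃ (suc k)
        0≤n² = 0≤ι n ⊗ 0≤ι n
        0≤z = ≤-trans (<⇒≤ 0<1) (1≤zeta₃ k)

      ratio-eventually : ∃[ N ] (∀ n → N ℕ.≤ n → Apart0 (h n) × ∃[ K ] (∀ k → K ℕ.≤ k →
        ℚ.∣ seq (log (p n) {{p-nonZero n}}) k * inv (seq (h n) k) - 1ℚ ∣ + ½ * ε ≤ ε))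
      ratio-eventually =
        let (N₁ , U) = upper-eventually p rec 1≤p 0<θ (≤-trans (1≤zeta₃ K) (≤-by θ 0≤θ refl)) zeta₃≤
            (N₂ , L) = lower-eventually p rec 1≤p 0<θ K (1≤zeta₃ K)
        in suc (N₁ ℕ.+ N₂) , λ n N≤n →
          let 1≤n = ℕₚ.≤-trans (ℕ.s≤s ℕ.z≤n) N≤n
              N₁₂≤n = ℕₚ.≤-trans (ℕₚ.n≤1+n (N₁ ℕ.+ N₂)) N≤n
              (X , 0≤X , cube-X , k₁ , g≤) = U n (ℕₚ.m+n≤o⇒m≤o N₁ N₁₂≤n)
              (Y , 0≤Y , cube-Y , k₂ , ≤g) = L n (ℕₚ.m+n≤o⇒n≤o N₁ N₁₂≤n)
          in (½ * ½ , 0<¼ , K₀ , λ k K₀≤k →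
               ≤-trans (¼≤h (bounds n 1≤n θ≤1 k (small K₀≤k))) (p≤∣p∣ (seq (h n) k)))
           , (K₀ ℕ.+ K) ℕ.+ (k₁ ℕ.+ k₂) , λ k le →
               let K₀K≤k = ℕₚ.m+n≤o⇒m≤o (K₀ ℕ.+ K) le
                   k₁₂≤k = ℕₚ.m+n≤o⇒n≤o (K₀ ℕ.+ K) le
               in subst (λ g → ℚ.∣ g * inv (seq (h n) k) - 1ℚ ∣ + ½ * ε ≤ ε) (sym (log-seq (p n) {{p-nonZero n}} k))
                    (ratio-at (ℕₚ.m+n≤o⇒n≤o K₀ K₀K≤k)
                      (bounds n 1≤n θ≤1 k (small (ℕₚ.m+n≤o⇒m≤o K₀ K₀K≤k))) 0≤Y cube-X cube-Y
                      (g≤ k (ℕₚ.m+n≤o⇒m≤o k₁ k₁₂≤k)) (≤g k (ℕₚ.m+n≤o⇒n≤o k₁ k₁₂≤k)))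

    log-∼ : (λ n → log (p n) {{p-nonZero n}}) ∼ h
    log-∼ = ∼-intro (λ n → log (p n) {{p-nonZero n}}) h λ ε 0<ε →
      -- `7 θ ≤ ½ ε` covers the losses in the ratios, `K` the truncation of ζ(3), and
      -- `8/(k + 1) ≤ θ` from `K₀` on the rounded roots.
      let (T , T<)   = archimedean ((ℤ.+ 1 / 7) * (½ * ε)) (*-pos (positive⁻¹ (ℤ.+ 1 / 7)) (half-pos 0<ε))
          (K , tail) = zeta₃-tail (1/suc-pos T)
          (K₀ , K₀<) = archimedean ((ℤ.+ 1 / 8) * (1/suc T)) (*-pos (positive⁻¹ (ℤ.+ 1 / 8)) (1/suc-pos T))
      in ratio-eventually {ε} {1/suc T} (1/suc-pos T) (1/suc≤1 T)
           (≤-trans (*-monoˡ (nonNegative⁻¹ (ℤ.+ 7 / 1)) (<⇒≤ T<))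
             (≤-reflexive (solve 1 (λ η → con (ℤ.+ 7 / 1) :* (con (ℤ.+ 1 / 7) :* η) := η) refl (½ * ε))))
           K tail K₀
           (λ K₀≤k → ≤-trans (*-monoˡ (nonNegative⁻¹ (ℤ.+ 8 / 1)) (≤-trans (1/suc-antitone K₀≤k) (<⇒≤ K₀<)))
             (≤-reflexive (solve 1 (λ θ → con (ℤ.+ 8 / 1) :* (con (ℤ.+ 1 / 8) :* θ) := θ) refl (1/suc T))))

open import Data.Nat using (ℕ; nonTrivial)
open import Data.Integer using (+_)
open import Data.Rational using (_/_)
open import Relation.Binary.PropositionalEquality using (refl; sym)
open import Defs using (PL; PL-nonZero; log; ζ; fromℕ; fromℚ; _*_; _^[_∕_]; _∼_)

theorem1p3 : (λ n → log (PL n) {{PL-nonZero n}}) ∼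
    (λ n → (fromℚ (+ 27 / 4) * ζ 3) ^[ 1 ∕ 3 ] * fromℕ n ^[ 2 ∕ 3 ])
theorem1p3 = Main.log-∼ PL PL-nonZero MacMahon.PL-recurrence
  (λ n → (fromℚ (+ 27 / 4) * ζ 3) ^[ 1 ∕ 3 ] * fromℕ n ^[ 2 ∕ 3 ])
  (λ n 1≤n θ≤1 k small → Main.height-at (fromℚ (+ 27 / 4) * ζ 3) (fromℕ n) 1≤n θ≤1 k small
    (Main.*-seq (fromℚ (+ 27 / 4)) (ζ 3) k refl (sym (Asymptotics.zeta₃≡ζ k)))
    (sym (Rational.ι≡ n)))
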